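{- Let $X$ be a weighted graph on $n$ vertices, let $M\in\{A(X),L(X),Q(X)\}$, let $U(t)=e^{\mathrm{i}tM}$, and let $u$ be a vertex of $X$. The following are equivalent. (1) Local $\epsilon$-uniform mixing occurs at $u$ (relative to $M$). (2) There is a sequence $\{\tau_m\}\subseteq\mathbb{R}$ and a vector $\boldsymbol{\mu}\in\mathbb{C}^n$ all of whose entries have modulus $1$ such that $\lim_{m\to\infty}\sqrt{n}\,U(\tau_m)\mathbf{e}_u=\boldsymbol{\mu}$. (3) There is a sequence $\{\tau_m\}\subseteq\mathbb{R}$ and a vector $\boldsymbol{\mu}\in\mathbb{C}^n$ all of whose entries have modulus $1$ such that, for every $\lambda\in\Phi_{\mathbf{e}_u}$, the limit $\lim_{m\to\infty}e^{\mathrm{i}\tau_m\lambda}$ exists and $\big(\lim_{m\to\infty}e^{\mathrm{i}\tau_m\lambda}\big)\sqrt{n}\,E_\lambda\mathbf{e}_u=E_\lambda\boldsymbol{\mu}$. Moreover, the condition in (3) is equivalent to: for each eigenpair $(\mathbf{v},\lambda)$ of $M$ with $\lambda\in\Phi_{\mathbf{e}_u}$, the limit $\lim_{m\to\infty}e^{\mathrm{i}\tau_m\lambda}$ exists and $\big(\lim_{m\to\infty}e^{\mathrm{i}\tau_m\lambda}\big)\sqrt{n}\,(\mathbf{v}^T\mathbf{e}_u)=\mathbf{v}^T\boldsymbol{\mu}$.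
   Context: Graphs are finite, simple, undirected and connected, with positive real edge weights. $A(X)$ is the weighted adjacency matrix, $D(X)$ is the diagonal matrix of vertex degrees (degree = sum of weights of incident edges), $L(X)=D(X)-A(X)$ is the Laplacian and $Q(X)=D(X)+A(X)$ the signless Laplacian. $\mathbf{e}_u$ is the characteristic vector of $u$, $\mathbf{1}$ is the all-ones vector, $\circ$ is the entrywise (Schur) product. For an eigenvalue $\lambda$ of $M$, $E_\lambda$ is the orthogonal projection onto the $\lambda$-eigenspace of $M$. The eigenvalue support of a vector $\mathbf{x}$ is $\Phi_{\mathbf{x}}=\{\lambda\in\mathrm{spec}(M): E_\lambda\mathbf{x}\neq\mathbf{0}\}$. Local $\epsilon$-uniform mixing occurs at $u$ relative to $M$ if for each $\epsilon>0$ there is a time $\tau\in\mathbb{R}$ such that $\big\|(U(\tau)\mathbf{e}_u)\circ(\overline{U(\tau)}\mathbf{e}_u)-\tfrac1n\mathbf{1}\big\|<\epsilon$. -}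

module Defs where

open import Level using (0ℓ)
open import Algebra.Bundles using (CommutativeRing; RawRing)
open import Axiom.ExcludedMiddle using (ExcludedMiddle)
open import Data.Fin.Base using (Fin; toℕ)
open import Data.Fin.Properties using (_≟_)
open import Data.Nat.Base as ℕ using (ℕ; zero; suc; _!)
open import Data.Product.Base using (∃; _×_; _,_)
open import Data.Vec.Functional using (Vector)
open import Relation.Binary.Construct.Closure.ReflexiveTransitive using (Star)
open import Relation.Binary.Core using (Rel)
open import Relation.Binary.Definitions using (Symmetric; Irreflexive)
open import Relation.Binary.PropositionalEquality.Core using (_≡_)
open import Relation.Binary.Structures using (IsTotalOrder)
open import Relation.Nullary using (¬_; yes; no)
open import Relation.Unary using (Pred)
import Algebra.Definitions.RawSemiring as RawSemiringDefinitions
import Relation.Binary.Construct.NonStrictToStrict as ToStrict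

-- The real numbers, axiomatised as a Dedekind-complete ordered field; under
-- excluded middle this determines them up to isomorphism.  The value of _⁻¹
-- at zero is unconstrained.

record CompleteOrderedField : Set₁ where
  infix 4 _≤_
  infix 8 _⁻¹

  field
    commutativeRing : CommutativeRing 0ℓ 0ℓ

  open CommutativeRing commutativeRing public

  field
    _≤_          : Rel Carrier 0ℓ
    isTotalOrder : IsTotalOrder _≈_ _≤_
    +-mono-≤     : ∀ {x y} z → x ≤ y → x + z ≤ y + z
    *-nonneg     : ∀ {x y} → 0# ≤ x → 0# ≤ y → 0# ≤ x * y
    0≉1          : ¬ (0# ≈ 1#)
    _⁻¹          : Carrier → Carrier
    ⁻¹-inverse   : ∀ {x} → ¬ (x ≈ 0#) → x * x ⁻¹ ≈ 1#

  UpperBound : Pred Carrier 0ℓ → Pred Carrier 0ℓ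
  UpperBound S b = ∀ {x} → S x → x ≤ b

  field
    supremum : (S : Pred Carrier 0ℓ) → ∃ S → ∃ (UpperBound S) →
               ∃ λ s → UpperBound S s × (∀ {b} → UpperBound S b → s ≤ b)

  open ToStrict _≈_ _≤_ public using (_<_)
  open RawSemiringDefinitions
    (RawRing.rawSemiring (CommutativeRing.rawRing commutativeRing)) public
    using (sum) renaming (_×_ to _×ⁿ_)

  fromℕ : ℕ → Carrier
  fromℕ n = n ×ⁿ 1#

-- Everything below is classical mathematics over the reals 𝓡.

module Mixing (em : ExcludedMiddle 0ℓ) (𝓡 : CompleteOrderedField) where

  module ℝ = CompleteOrderedField 𝓡
  open ℝ public using (_≤_; _<_) renaming (Carrier to ℝ)

  -- An element satisfying P if there is one, and d otherwise.  It is used only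
  -- for predicates satisfied by at most one element up to equality.

  choose : {A : Set} → A → (A → Set) → A
  choose {A} d P with em {∃ P}
  ... | yes (a , _) = a
  ... | no  _       = d

  √ : ℝ → ℝ
  √ x = choose ℝ.0# (λ y → ℝ.0# ≤ y × y ℝ.* y ℝ.≈ x)

  ------------------------------------------------------------------------
  -- Complex numbers

  record ℂ : Set where
    constructor _+i_
    field
      re : ℝ
      im : ℝ

  open ℂ public

  infix  4 _≈_
  infixl 6 _+_ _-_
  infixl 7 _*_

  _≈_ : Rel ℂ 0ℓ
  z ≈ w = re z ℝ.≈ re w × im z ℝ.≈ im w

  _+_ _*_ _-_ : ℂ → ℂ → ℂ
  z + w = (re z ℝ.+ re w) +i (im z ℝ.+ im w)
  z * w = (re z ℝ.* re w ℝ.- im z ℝ.* im w) +i (re z ℝ.* im w ℝ.+ im z ℝ.* re w)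
  z - w = (re z ℝ.- re w) +i (im z ℝ.- im w)

  -_ conj : ℂ → ℂ
  - z    = (ℝ.- re z) +i (ℝ.- im z)
  conj z = re z +i (ℝ.- im z)

  ⟦_⟧ : ℝ → ℂ
  ⟦ x ⟧ = x +i ℝ.0#

  0ᶜ 1ᶜ i : ℂ
  0ᶜ = ⟦ ℝ.0# ⟧
  1ᶜ = ⟦ ℝ.1# ⟧
  i  = ℝ.0# +i ℝ.1#

  ℂ-rawRing : RawRing 0ℓ 0ℓ
  ℂ-rawRing = record
    { Carrier = ℂ ; _≈_ = _≈_ ; _+_ = _+_ ; _*_ = _*_ ; -_ = -_ ; 0# = 0ᶜ ; 1# = 1ᶜ }

  open RawSemiringDefinitions (RawRing.rawSemiring ℂ-rawRing) public
    using (sum; _^_)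

  ∣_∣² : ℂ → ℝ
  ∣ z ∣² = re z ℝ.* re z ℝ.+ im z ℝ.* im z

  ∣_∣ : ℂ → ℝ
  ∣ z ∣ = √ ∣ z ∣²

  infix 4 _⟶_

  _⟶_ : (ℕ → ℂ) → ℂ → Set
  s ⟶ l = ∀ ε → ℝ.0# < ε → ∃ λ N → ∀ m → N ℕ.≤ m → ∣ s m - l ∣ < ε

  lim : (ℕ → ℂ) → ℂ
  lim s = choose 0ᶜ (s ⟶_)

  ∑∞ : (ℕ → ℂ) → ℂ
  ∑∞ f = lim (λ N → sum {N} (λ k → f (toℕ k)))

  1/_! : ℕ → ℂ
  1/ k ! = ⟦ ℝ.fromℕ (k !) ℝ.⁻¹ ⟧

  exp : ℂ → ℂ
  exp z = ∑∞ (λ k → 1/ k ! * z ^ k)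

  ------------------------------------------------------------------------
  -- Complex vectors and matrices

  Vec Mat : ℕ → Set
  Vec n = Vector ℂ n
  Mat n = Fin n → Fin n → ℂ

  module _ {n : ℕ} where

    infix  4 _≈ᵛ_ _⟶ᵛ_
    infixl 6 _-ᵛ_
    infixr 7 _·_ _*ᵛ_ _*ᴹ_
    infixl 7 _⊙_
    infixr 8 _^ᴹ_
    infix  8 _ᵀ·_

    _≈ᵛ_ : Rel (Vec n) 0ℓ
    x ≈ᵛ y = ∀ j → x j ≈ y j

    0ᵛ : Vec n
    0ᵛ _ = 0ᶜ

    𝟏 : Vec n
    𝟏 _ = 1ᶜ

    𝐞 : Fin n → Vec n
    𝐞 u j with u ≟ j
    ... | yes _ = 1ᶜ
    ... | no  _ = 0ᶜ

    _-ᵛ_ _⊙_ : Vec n → Vec n → Vec n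
    (x -ᵛ y) j = x j - y j
    (x ⊙ y)  j = x j * y j

    _·_ : ℂ → Vec n → Vec n
    (c · x) j = c * x j

    _ᵀ·_ : Vec n → Vec n → ℂ
    x ᵀ· y = sum (λ j → x j * y j)

    ⟨_,_⟩ : Vec n → Vec n → ℂ
    ⟨ x , y ⟩ = (λ j → conj (x j)) ᵀ· y

    ‖_‖ : Vec n → ℝ
    ‖ x ‖ = √ (ℝ.sum (λ j → ∣ x j ∣²))

    _⟶ᵛ_ : (ℕ → Vec n) → Vec n → Set
    s ⟶ᵛ l = ∀ ε → ℝ.0# < ε → ∃ λ N → ∀ m → N ℕ.≤ m → ‖ s m -ᵛ l ‖ < ε

    _*ᵛ_ : Mat n → Vec n → Vec n
    (B *ᵛ x) j = sum (λ k → B j k * x k)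

    _*ᴹ_ : Mat n → Mat n → Mat n
    (B *ᴹ C) j k = sum (λ l → B j l * C l k)

    0ᴹ 1ᴹ : Mat n
    0ᴹ _ _ = 0ᶜ
    1ᴹ j   = 𝐞 j

    _^ᴹ_ : Mat n → ℕ → Mat n
    B ^ᴹ zero  = 1ᴹ
    B ^ᴹ suc k = B *ᴹ B ^ᴹ k

    conjᴹ : Mat n → Mat n
    conjᴹ B j k = conj (B j k)

    expᴹ : Mat n → Mat n
    expᴹ B j l = ∑∞ (λ k → 1/ k ! * (B ^ᴹ k) j l)

    Unimodular : Vec n → Set
    Unimodular μ = ∀ j → ∣ μ j ∣ ℝ.≈ ℝ.1#

  ------------------------------------------------------------------------
  -- Spectral notions for a square matrix

  module _ {n : ℕ} (M : Mat n) where

    InEigenspace : ℂ → Vec n → Set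
    InEigenspace λ′ v = M *ᵛ v ≈ᵛ λ′ · v

    IsEigenpair : Vec n → ℂ → Set
    IsEigenpair v λ′ = ¬ (v ≈ᵛ 0ᵛ) × InEigenspace λ′ v

    Spec : ℂ → Set
    Spec λ′ = ∃ λ v → IsEigenpair v λ′

    IsOrthogonalProjection : ℂ → Mat n → Set
    IsOrthogonalProjection λ′ P =
      ∀ x → InEigenspace λ′ (P *ᵛ x) ×
            (∀ w → InEigenspace λ′ w → ⟨ w , x -ᵛ (P *ᵛ x) ⟩ ≈ 0ᶜ)

    E : ℂ → Mat n
    E λ′ = choose 0ᴹ (IsOrthogonalProjection λ′)

    Φ : Vec n → ℂ → Set
    Φ x λ′ = Spec λ′ × ¬ (E λ′ *ᵛ x ≈ᵛ 0ᵛ)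

    U : ℝ → Mat n
    U t = expᴹ (λ j k → i * ⟦ t ⟧ * M j k)

    LocalεUniformMixing : Fin n → Set
    LocalεUniformMixing u =
      ∀ ε → ℝ.0# < ε → ∃ λ τ →
        ‖ (U τ *ᵛ 𝐞 u) ⊙ (conjᴹ (U τ) *ᵛ 𝐞 u) -ᵛ ⟦ ℝ.fromℕ n ℝ.⁻¹ ⟧ · 𝟏 ‖ < ε

  ------------------------------------------------------------------------
  -- Weighted graphs

  record WeightedGraph (n : ℕ) : Set₁ where
    field
      Adj       : Rel (Fin n) 0ℓ
      symmetric : Symmetric Adj
      loopless  : Irreflexive _≡_ Adj
      connected : ∀ u v → Star Adj u v
      weight    : Fin n → Fin n → ℝ
      weight-symmetric : ∀ u v → weight u v ℝ.≈ weight v u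
      weight-edge      : ∀ {u v} → Adj u v → ℝ.0# < weight u v
      weight-nonedge   : ∀ {u v} → ¬ Adj u v → weight u v ℝ.≈ ℝ.0#

  module _ {n : ℕ} (X : WeightedGraph n) where
    open WeightedGraph X

    degree : Fin n → ℝ
    degree u = ℝ.sum (weight u)

    𝐀 𝐃 𝐋 𝐐 : Mat n
    𝐀 u v = ⟦ weight u v ⟧
    𝐃 u v = ⟦ degree u ⟧ * 1ᴹ u v
    𝐋 u v = 𝐃 u v - 𝐀 u v
    𝐐 u v = 𝐃 u v + 𝐀 u v

{-# OPTIONS --safe #-}

-- Only the moduli of the entries of U(τ) e_u enter (1), so that (1) ⇔ (2) is a
-- compactness argument.  For the rest, let q_r be an orthonormal basis of real
-- eigenvectors, M q_r = θ_r q_r.  The r-th coordinate of √n U(τ) e_u in this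
-- basis is √n q_r(u) exp(iτθ_r), and both forms of (3) say that it tends to the
-- r-th coordinate of μ for all r with q_r(u) ≠ 0.  The other coordinates vanish
-- identically, and those of μ vanish as well, since |exp(iy)| = 1 makes the
-- squared moduli of the limits add up to n = ‖μ‖².
--
-- The eigenbasis comes from a matrix Q maximising ∑_r r (QᵀMQ)_rr among the
-- orthogonal matrices: a nonzero off-diagonal entry of QᵀMQ would allow the trace
-- to be increased by a reflection.  For |exp(iy)| = 1, the Cauchy product of the
-- series of exp(iy) with its conjugate has the partial sums 1, and the error made
-- by the product of partial sums is dominated by that for a positive series.

module Submission where

open import Defs
open import Level using (0ℓ)
open import Algebra.Bundles using (CommutativeRing; RawRing)
open import Algebra.Solver.Ring.AlmostCommutativeRing using (_-Raw-AlmostCommutative⟶_; fromCommutativeRing)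
open import Axiom.ExcludedMiddle using (ExcludedMiddle)
open import Data.Fin.Base using (Fin; zero; suc; toℕ; combine; remQuot)
open import Data.Fin.Properties using (_≟_; remQuot-combine; toℕ-injective)
open import Data.List.Base using (_∷_; [])
open import Data.List.Membership.Propositional using (_∈_)
open import Data.List.Relation.Unary.Any using (here; there)
open import Data.Maybe.Base using (Maybe; just; nothing)
open import Data.Nat.Base as ℕ using (ℕ; zero; suc; z≤n; s≤s; _!)
open import Data.Product.Base using (∃; ∃₂; _×_; _,_; proj₁; proj₂)
open import Data.Sum.Base using (_⊎_; inj₁; inj₂; [_,_]′)
open import Function.Base using (_∘_)
open import Function.Bundles using (_⇔_; mk⇔; module Equivalence)
open import Relation.Binary.Bundles using (Poset)
open import Relation.Binary.Definitions using (tri<; tri≈; tri>)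
open import Relation.Binary.Structures using (IsTotalOrder)
open import Relation.Nullary using (¬_; yes; no; contradiction)
open import Relation.Unary using (Pred)
import Algebra.Properties.AbelianGroup
import Algebra.Properties.Ring
import Algebra.Properties.Semiring.Mult
import Algebra.Properties.Semiring.Mult.TCOptimised
import Algebra.Properties.Semiring.Sum
import Algebra.Solver.Ring
import Data.Nat.Properties as ℕ
import Relation.Binary.PropositionalEquality as ≡
import Relation.Binary.Reasoning.PartialOrder
import Relation.Binary.Reasoning.Setoid

-- The reals are given only by their axioms and `exp` only as a limit of partial sums, so neither
-- angles nor roots of a characteristic polynomial are at hand. This shapes the search for an
-- eigenbasis: the maximiser comes from compactness, and it is tested against reflections, whose
-- entries are rational in the coordinates of the normal vector, instead of against rotations. The
-- weights r in the trace must be distinct, because the plain trace is invariant under conjugation.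
-- A reflection is never close to the identity, but conjugation by the one in e_p only flips signs
-- off the diagonal; a normal tilted from e_p towards e_q therefore acts on the diagonal like a
-- small rotation.
--
-- The eigenbasis is real even though the vectors are complex, so coordinates are taken with the
-- bilinear product and conjugation enters only through norms. The objects defined by choice (`√`,
-- `lim`, `E`) are accessible only through their defining properties; for `E` this means that its
-- coordinates are computed from membership in the eigenspace and orthogonality of the residual.

module RingTools (R : CommutativeRing 0ℓ 0ℓ) where

  -- A ring solver with integer coefficients

  open CommutativeRing R
  open Algebra.Properties.Semiring.Mult semiring
    using (×-homo-+; ×1-homo-*; ×-congˡ) renaming (_×_ to _⋆_)
  open Algebra.Properties.Semiring.Mult.TCOptimised semiring
    using (×ᵤ≈×) renaming (_×_ to _⋆′_)
  open Algebra.Properties.Semiring.Sum semiring public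
    using (sum; sum-cong-≋; ∑-distrib-+; ∑-comm; *-distribˡ-sum; *-distribʳ-sum; sum-replicate-zero)
  open Algebra.Properties.Ring ring public
    using (-‿distribˡ-*; -‿distribʳ-*; -‿involutive; -0#≈0#)
  open Algebra.Properties.AbelianGroup +-abelianGroup public using () renaming (⁻¹-∙-comm to -‿+-comm)
  module Eq = Relation.Binary.Reasoning.Setoid setoid

  -- The pair (a , b) stands for the integer a − b.  It is evaluated in lowest
  -- terms, so that equal coefficients of normal forms become identical.
  private
    Diff : RawRing 0ℓ 0ℓ
    Diff = record
      { Carrier = ℕ × ℕ ; _≈_ = ≡._≡_
      ; _+_ = λ (a , b) (c , d) → a ℕ.+ c , b ℕ.+ d
      ; _*_ = λ (a , b) (c , d) → a ℕ.* c ℕ.+ b ℕ.* d , a ℕ.* d ℕ.+ b ℕ.* c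
      ; -_ = λ (a , b) → b , a
      ; 0# = 0 , 0 ; 1# = 1 , 0 }

    evaluate : ℕ × ℕ → Carrier
    evaluate (a     , zero)  = a ⋆′ 1#
    evaluate (zero  , suc b) = - (suc b ⋆′ 1#)
    evaluate (suc a , suc b) = evaluate (a , b)

    difference : ℕ × ℕ → Carrier
    difference (a , b) = a ⋆ 1# - b ⋆ 1#

    interchange : ∀ a b c d → (a + b) + (c + d) ≈ (a + c) + (b + d)
    interchange a b c d = begin
      (a + b) + (c + d) ≈⟨ +-assoc a b _ ⟩
      a + (b + (c + d)) ≈⟨ +-congˡ (+-assoc b c d) ⟨
      a + ((b + c) + d) ≈⟨ +-congˡ (+-congʳ (+-comm b c)) ⟩
      a + ((c + b) + d) ≈⟨ +-congˡ (+-assoc c b d) ⟩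
      a + (c + (b + d)) ≈⟨ +-assoc a c _ ⟨
      (a + c) + (b + d) ∎
      where open Eq

    evaluate≈ : ∀ p → evaluate p ≈ difference p
    evaluate≈ (a , zero)  = begin
      a ⋆′ 1#          ≈⟨ ×ᵤ≈× a 1# ⟨
      a ⋆ 1#           ≈⟨ +-identityʳ _ ⟨
      a ⋆ 1# + 0#      ≈⟨ +-congˡ -0#≈0# ⟨
      a ⋆ 1# - 0#      ∎
      where open Eq
    evaluate≈ (zero , suc b) = trans (-‿cong (sym (×ᵤ≈× (suc b) 1#))) (sym (+-identityˡ _))
    evaluate≈ (suc a , suc b) = begin
      evaluate (a , b)                       ≈⟨ evaluate≈ (a , b) ⟩
      a ⋆ 1# - b ⋆ 1#                        ≈⟨ +-identityˡ _ ⟨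
      0# + (a ⋆ 1# - b ⋆ 1#)                 ≈⟨ +-congʳ (-‿inverseʳ 1#) ⟨
      (1# - 1#) + (a ⋆ 1# - b ⋆ 1#)          ≈⟨ interchange _ _ _ _ ⟩
      (1# + a ⋆ 1#) + (- 1# + - (b ⋆ 1#))    ≈⟨ +-congˡ (-‿+-comm _ _) ⟩
      (1# + a ⋆ 1#) - (1# + b ⋆ 1#)          ∎
      where open Eq

    difference-+ : ∀ a b c d → difference (a ℕ.+ c , b ℕ.+ d) ≈ difference (a , b) + difference (c , d)
    difference-+ a b c d = begin
      (a ℕ.+ c) ⋆ 1# - (b ℕ.+ d) ⋆ 1#
        ≈⟨ +-cong (×-homo-+ 1# a c) (-‿cong (×-homo-+ 1# b d)) ⟩
      (a ⋆ 1# + c ⋆ 1#) - (b ⋆ 1# + d ⋆ 1#)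
        ≈⟨ +-congˡ (-‿+-comm _ _) ⟨
      (a ⋆ 1# + c ⋆ 1#) + (- (b ⋆ 1#) + - (d ⋆ 1#))
        ≈⟨ interchange _ _ _ _ ⟩
      difference (a , b) + difference (c , d) ∎
      where open Eq

    *-difference : ∀ x y z w → (x - y) * (z - w) ≈ (x * z + y * w) - (x * w + y * z)
    *-difference x y z w = begin
      (x - y) * (z - w)
        ≈⟨ distribʳ _ _ _ ⟩
      x * (z - w) + (- y) * (z - w)
        ≈⟨ +-cong (distribˡ _ _ _) (distribˡ _ _ _) ⟩
      (x * z + x * - w) + ((- y) * z + (- y) * - w)
        ≈⟨ +-cong (+-congˡ (-‿distribʳ-* x w)) (+-comm _ _) ⟨
      (x * z + - (x * w)) + ((- y) * - w + (- y) * z)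
        ≈⟨ +-congˡ (+-cong
             (trans (sym (-‿distribˡ-* y _)) (trans (-‿cong (sym (-‿distribʳ-* y w))) (-‿involutive _)))
             (sym (-‿distribˡ-* y z))) ⟩
      (x * z + - (x * w)) + (y * w + - (y * z))
        ≈⟨ interchange _ _ _ _ ⟩
      (x * z + y * w) + (- (x * w) + - (y * z))
        ≈⟨ +-congˡ (-‿+-comm _ _) ⟩
      (x * z + y * w) - (x * w + y * z) ∎
      where open Eq

    ⋆-bilinear : ∀ a b c d → (a ℕ.* c ℕ.+ b ℕ.* d) ⋆ 1# ≈ a ⋆ 1# * c ⋆ 1# + b ⋆ 1# * d ⋆ 1#
    ⋆-bilinear a b c d =
      trans (×-homo-+ 1# (a ℕ.* c) (b ℕ.* d)) (+-cong (×1-homo-* a c) (×1-homo-* b d))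

    morphism : Diff -Raw-AlmostCommutative⟶ fromCommutativeRing R
    morphism = record
      { ⟦_⟧    = evaluate
      ; +-homo = λ p@(a , b) q@(c , d) → trans (evaluate≈ (a ℕ.+ c , b ℕ.+ d))
          (trans (difference-+ a b c d) (sym (+-cong (evaluate≈ p) (evaluate≈ q))))
      ; *-homo = λ p@(a , b) q@(c , d) → trans (evaluate≈ (a ℕ.* c ℕ.+ b ℕ.* d , a ℕ.* d ℕ.+ b ℕ.* c))
          (trans (+-cong (⋆-bilinear a b c d) (-‿cong (⋆-bilinear a b d c)))
          (trans (sym (*-difference _ _ _ _)) (sym (*-cong (evaluate≈ p) (evaluate≈ q)))))
      ; -‿homo = λ p@(a , b) → trans (evaluate≈ (b , a))
          (trans (+-comm _ _)
          (trans (+-congˡ (sym (-‿involutive _)))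
          (trans (-‿+-comm _ _) (-‿cong (sym (evaluate≈ p))))))
      ; 0-homo = refl
      ; 1-homo = refl }

    -- A sufficient test only: in positive characteristic, different integers may evaluate to equal
    -- elements. The cross sums a + d and c + b compare the two differences inside ℕ.
    _≟ᶜ_ : ∀ p q → Maybe (evaluate p ≈ evaluate q)
    p@(a , b) ≟ᶜ q@(c , d) with a ℕ.+ d ℕ.≟ c ℕ.+ b
    ... | no  _  = nothing
    ... | yes eq = just (trans (evaluate≈ p) (trans difference≈ (sym (evaluate≈ q))))
      where
      open Eq
      difference≈ : difference p ≈ difference q
      difference≈ = begin
        a ⋆ 1# - b ⋆ 1#
          ≈⟨ +-identityʳ _ ⟨
        (a ⋆ 1# - b ⋆ 1#) + 0#
          ≈⟨ +-congˡ (-‿inverseʳ (d ⋆ 1#)) ⟨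
        (a ⋆ 1# - b ⋆ 1#) + (d ⋆ 1# - d ⋆ 1#)
          ≈⟨ interchange _ _ _ _ ⟩
        (a ⋆ 1# + d ⋆ 1#) + (- (b ⋆ 1#) - d ⋆ 1#)
          ≈⟨ +-cong (trans (sym (×-homo-+ 1# a d)) (trans (×-congˡ eq) (×-homo-+ 1# c b))) (+-comm _ _) ⟩
        (c ⋆ 1# + b ⋆ 1#) + (- (d ⋆ 1#) - b ⋆ 1#)
          ≈⟨ interchange _ _ _ _ ⟩
        (c ⋆ 1# - d ⋆ 1#) + (b ⋆ 1# - b ⋆ 1#)
          ≈⟨ +-congˡ (-‿inverseʳ (b ⋆ 1#)) ⟩
        (c ⋆ 1# - d ⋆ 1#) + 0#
          ≈⟨ +-identityʳ _ ⟩
        c ⋆ 1# - d ⋆ 1# ∎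

  open Algebra.Solver.Ring Diff (fromCommutativeRing R) morphism _≟ᶜ_ public
    using (Polynomial; con; solve; _:=_; _:+_; _:*_; _:-_; :-_)

  :0 :1 : ∀ {n} → Polynomial n
  :0 = con (0 , 0)
  :1 = con (1 , 0)

  -- The Kronecker delta and finite sums

  δ : ∀ {n} → Fin n → Fin n → Carrier
  δ zero    zero    = 1#
  δ zero    (suc k) = 0#
  δ (suc j) zero    = 0#
  δ (suc j) (suc k) = δ j k

  δ-refl : ∀ {n} (j : Fin n) → δ j j ≈ 1#
  δ-refl zero    = refl
  δ-refl (suc j) = δ-refl j

  δ-≢ : ∀ {n} {j k : Fin n} → j ≡.≢ k → δ j k ≈ 0#
  δ-≢ {j = zero}  {zero}  j≢k = contradiction ≡.refl j≢k
  δ-≢ {j = zero}  {suc k} j≢k = refl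
  δ-≢ {j = suc j} {zero}  j≢k = refl
  δ-≢ {j = suc j} {suc k} j≢k = δ-≢ (λ j≡k → j≢k (≡.cong suc j≡k))

  δ-sym : ∀ {n} (j k : Fin n) → δ j k ≈ δ k j
  δ-sym zero    zero    = refl
  δ-sym zero    (suc k) = refl
  δ-sym (suc j) zero    = refl
  δ-sym (suc j) (suc k) = δ-sym j k

  sum-cong : ∀ {n} {f g : Fin n → Carrier} → (∀ j → f j ≈ g j) → sum f ≈ sum g
  sum-cong = sum-cong-≋

  sum-zero : ∀ {n} {f : Fin n → Carrier} → (∀ j → f j ≈ 0#) → sum f ≈ 0#
  sum-zero {n} f≈0 = trans (sum-cong f≈0) (sum-replicate-zero n)

  sum-δˡ : ∀ {n} (j : Fin n) (f : Fin n → Carrier) → sum (λ k → δ j k * f k) ≈ f j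
  sum-δˡ zero f = trans (+-cong (*-identityˡ _) (sum-zero (λ k → zeroˡ (f (suc k))))) (+-identityʳ _)
  sum-δˡ (suc j) f = trans (+-cong (zeroˡ _) (sum-δˡ j (λ k → f (suc k)))) (+-identityˡ _)

  sum-δʳ : ∀ {n} (j : Fin n) (f : Fin n → Carrier) → sum (λ k → f k * δ k j) ≈ f j
  sum-δʳ j f = trans (sum-cong (λ k → trans (*-comm _ _) (*-congʳ (δ-sym k j)))) (sum-δˡ j f)

  sum-- : ∀ {n} (f g : Fin n → Carrier) → sum (λ j → f j - g j) ≈ sum f - sum g
  sum-- {zero}  f g = sym (-‿inverseʳ 0#)
  sum-- {suc n} f g = trans (+-congˡ (sum-- (λ j → f (suc j)) (λ j → g (suc j))))
    (solve 4 (λ a b c d → (a :- b) :+ (c :- d) := (a :+ c) :- (b :+ d)) refl _ _ _ _)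

  -- Matrices, orthogonality and reflections

  Matrix : ℕ → Set
  Matrix n = Fin n → Fin n → Carrier

  module _ {n : ℕ} where

    infix  4 _≈ₘ_
    infixl 7 _⊗_
    infix  8 _ᵀ

    _≈ₘ_ : Matrix n → Matrix n → Set
    A ≈ₘ B = ∀ j k → A j k ≈ B j k

    _⊗_ : Matrix n → Matrix n → Matrix n
    (A ⊗ B) j k = sum (λ l → A j l * B l k)

    _ᵀ : Matrix n → Matrix n
    (A ᵀ) j k = A k j

    ≈ₘ-sym : ∀ {A B} → A ≈ₘ B → B ≈ₘ A
    ≈ₘ-sym A≈B j k = sym (A≈B j k)

    ≈ₘ-trans : ∀ {A B C} → A ≈ₘ B → B ≈ₘ C → A ≈ₘ C
    ≈ₘ-trans A≈B B≈C j k = trans (A≈B j k) (B≈C j k)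

    ⊗-congˡ : ∀ A {B C} → B ≈ₘ C → A ⊗ B ≈ₘ A ⊗ C
    ⊗-congˡ A B≈C j k = sum-cong {n} (λ l → *-congˡ (B≈C l k))

    ⊗-congʳ : ∀ A {B C} → B ≈ₘ C → B ⊗ A ≈ₘ C ⊗ A
    ⊗-congʳ A B≈C j k = sum-cong {n} (λ l → *-congʳ (B≈C j l))

    ⊗-assoc : ∀ A B C → (A ⊗ B) ⊗ C ≈ₘ A ⊗ (B ⊗ C)
    ⊗-assoc A B C j k = begin
      sum (λ l → sum (λ m → A j m * B m l) * C l k)
        ≈⟨ sum-cong {n} (λ l → *-distribʳ-sum (C l k) (λ m → A j m * B m l)) ⟩
      sum (λ l → sum (λ m → A j m * B m l * C l k))
        ≈⟨ ∑-comm (λ l m → A j m * B m l * C l k) ⟩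
      sum (λ m → sum (λ l → A j m * B m l * C l k))
        ≈⟨ sum-cong {n} (λ m → sum-cong {n} (λ l → *-assoc _ _ _)) ⟩
      sum (λ m → sum (λ l → A j m * (B m l * C l k)))
        ≈⟨ sum-cong {n} (λ m → sym (*-distribˡ-sum (A j m) (λ l → B m l * C l k))) ⟩
      sum (λ m → A j m * sum (λ l → B m l * C l k)) ∎
      where open Eq

    ⊗-identityˡ : ∀ A → δ ⊗ A ≈ₘ A
    ⊗-identityˡ A j k = sum-δˡ j (λ l → A l k)

    ᵀ-⊗ : ∀ A B → (A ⊗ B) ᵀ ≈ₘ B ᵀ ⊗ A ᵀ
    ᵀ-⊗ A B j k = sum-cong {n} (λ l → *-comm _ _)

    -- One identity makes the columns orthonormal, the other expands every vector in them. Both are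
    -- polynomial in the entries, so both pass to products and to entrywise limits.
    Orthogonal : Matrix n → Set
    Orthogonal Q = (Q ᵀ ⊗ Q ≈ₘ δ) × (Q ⊗ Q ᵀ ≈ₘ δ)

    Orthogonal-δ : Orthogonal δ
    Orthogonal-δ = (λ j k → trans (sum-cong {n} (λ l → *-congʳ (δ-sym l j))) (sum-δˡ j (λ l → δ l k)))
                 , (λ j k → trans (sum-δˡ j (λ l → δ k l)) (δ-sym k j))

    -- The common shape of both identities for a product of orthogonal matrices: the inner pair
    -- cancels, then the outer one.
    sandwich : ∀ {A A′ B B′} → A ⊗ A′ ≈ₘ δ → B ⊗ B′ ≈ₘ δ → (A ⊗ B) ⊗ (B′ ⊗ A′) ≈ₘ δ
    sandwich {A} {A′} {B} {B′} AA′ BB′ =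
      ≈ₘ-trans (⊗-assoc A B (B′ ⊗ A′))
      (≈ₘ-trans (⊗-congˡ A (≈ₘ-trans (≈ₘ-sym (⊗-assoc B B′ A′))
                           (≈ₘ-trans (⊗-congʳ A′ BB′) (⊗-identityˡ A′)))) AA′)

    Orthogonal-⊗ : ∀ {Q G} → Orthogonal Q → Orthogonal G → Orthogonal (Q ⊗ G)
    Orthogonal-⊗ {Q} {G} (QᵀQ , QQᵀ) (GᵀG , GGᵀ) =
      ≈ₘ-trans (⊗-congʳ (Q ⊗ G) (ᵀ-⊗ Q G)) (sandwich {A = G ᵀ} {A′ = G} {B = Q ᵀ} {B′ = Q} GᵀG QᵀQ) ,
      ≈ₘ-trans (⊗-congˡ (Q ⊗ G) (ᵀ-⊗ Q G)) (sandwich {A = Q} {A′ = Q ᵀ} {B = G} {B′ = G ᵀ} QQᵀ GGᵀ)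

    -- The Householder reflection with normal x e_p + y e_q. The hypothesis says κ = 2 / (x² + y²)
    -- without dividing, so that everything here is an identity over a commutative ring.
    module Reflection {p q : Fin n} (p≢q : p ≡.≢ q) (x y κ : Carrier)
                      (κ-norm : κ * (x * x + y * y) ≈ 1# + 1#) where

      normal : Fin n → Carrier
      normal j = x * δ p j + y * δ q j

      reflection : Matrix n
      reflection j k = δ j k - κ * normal j * normal k

      normal-p : normal p ≈ x
      normal-p = trans (+-cong (*-congˡ (δ-refl p)) (*-congˡ (δ-≢ (λ q≡p → p≢q (≡.sym q≡p)))))
                       (solve 2 (λ x y → x :* :1 :+ y :* :0 := x) refl x y)

      normal-q : normal q ≈ y
      normal-q = trans (+-cong (*-congˡ (δ-≢ p≢q)) (*-congˡ (δ-refl q)))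
                       (solve 2 (λ x y → x :* :0 :+ y :* :1 := y) refl x y)

      sum-normal : ∀ (f : Fin n → Carrier) → sum (λ l → normal l * f l) ≈ x * f p + y * f q
      sum-normal f = begin
        sum (λ l → (x * δ p l + y * δ q l) * f l)
          ≈⟨ sum-cong {n} (λ l → solve 5 (λ x d y e f → (x :* d :+ y :* e) :* f := x :* (d :* f) :+ y :* (e :* f))
               refl x (δ p l) y (δ q l) (f l)) ⟩
        sum (λ l → x * (δ p l * f l) + y * (δ q l * f l))
          ≈⟨ ∑-distrib-+ (λ l → x * (δ p l * f l)) (λ l → y * (δ q l * f l)) ⟩
        sum (λ l → x * (δ p l * f l)) + sum (λ l → y * (δ q l * f l))
          ≈⟨ +-cong (*-distribˡ-sum x (λ l → δ p l * f l)) (*-distribˡ-sum y (λ l → δ q l * f l)) ⟨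
        x * sum (λ l → δ p l * f l) + y * sum (λ l → δ q l * f l)
          ≈⟨ +-cong (*-congˡ (sum-δˡ p f)) (*-congˡ (sum-δˡ q f)) ⟩
        x * f p + y * f q ∎
        where open Eq

      reflection-sym : ∀ j k → reflection j k ≈ reflection k j
      reflection-sym j k = +-cong (δ-sym j k)
        (-‿cong (solve 3 (λ κ a b → κ :* a :* b := κ :* b :* a) refl κ _ _))

      reflection-⊗ : ∀ B j k → (reflection ⊗ B) j k ≈ B j k - κ * normal j * (x * B p k + y * B q k)
      reflection-⊗ B j k = begin
        sum (λ l → (δ j l - κ * normal j * normal l) * B l k)
          ≈⟨ sum-cong {n} (λ l → solve 4 (λ d a u b → (d :- a :* u) :* b := d :* b :- a :* (u :* b))
               refl (δ j l) (κ * normal j) (normal l) (B l k)) ⟩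
        sum (λ l → δ j l * B l k - κ * normal j * (normal l * B l k))
          ≈⟨ sum-- (λ l → δ j l * B l k) (λ l → κ * normal j * (normal l * B l k)) ⟩
        sum (λ l → δ j l * B l k) - sum (λ l → κ * normal j * (normal l * B l k))
          ≈⟨ +-cong (sum-δˡ j (λ l → B l k)) (-‿cong (trans (sym (*-distribˡ-sum (κ * normal j) (λ l → normal l * B l k)))
                                                     (*-congˡ (sum-normal (λ l → B l k))))) ⟩
        B j k - κ * normal j * (x * B p k + y * B q k) ∎
        where open Eq

      ⊗-reflection : ∀ B j k → (B ⊗ reflection) j k ≈ B j k - κ * normal k * (x * B j p + y * B j q)
      ⊗-reflection B j k =
        trans (sum-cong {n} (λ l → trans (*-comm _ _) (*-congʳ (reflection-sym l k))))
              (reflection-⊗ (B ᵀ) k j)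

      -- With normal v, the square is I - 2κ v vᵀ + κ (κ |v|²) v vᵀ, and κ |v|² = 2. As the
      -- reflection is symmetric, this is also its orthogonality.
      reflection-involutive : reflection ⊗ reflection ≈ₘ δ
      reflection-involutive j k = begin
        (reflection ⊗ reflection) j k
          ≈⟨ reflection-⊗ reflection j k ⟩
        reflection j k - κ * normal j * (x * (δ p k - κ * normal p * normal k) + y * (δ q k - κ * normal q * normal k))
          ≈⟨ +-congˡ (-‿cong (*-congˡ (+-cong (*-congˡ (+-congˡ (-‿cong (*-congʳ (*-congˡ normal-p)))))
                                              (*-congˡ (+-congˡ (-‿cong (*-congʳ (*-congˡ normal-q)))))))) ⟩
        reflection j k - κ * normal j * (x * (δ p k - κ * x * normal k) + y * (δ q k - κ * y * normal k))
          ≈⟨ solve 8 (λ κ d u v x y a b →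
               (d :- κ :* u :* v) :- κ :* u :* (x :* (a :- κ :* x :* v) :+ y :* (b :- κ :* y :* v))
               := d :- κ :* u :* v :- κ :* u :* (x :* a :+ y :* b) :+ (κ :* (x :* x :+ y :* y)) :* (κ :* u :* v))
               refl κ (δ j k) (normal j) (normal k) x y (δ p k) (δ q k) ⟩
        δ j k - κ * normal j * normal k - κ * normal j * normal k + κ * (x * x + y * y) * (κ * normal j * normal k)
          ≈⟨ +-congˡ (*-congʳ κ-norm) ⟩
        δ j k - κ * normal j * normal k - κ * normal j * normal k + (1# + 1#) * (κ * normal j * normal k)
          ≈⟨ solve 2 (λ d a → d :- a :- a :+ (:1 :+ :1) :* a := d) refl (δ j k) (κ * normal j * normal k) ⟩
        δ j k ∎
        where open Eq

      Orthogonal-reflection : Orthogonal reflection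
      Orthogonal-reflection =
        ≈ₘ-trans (⊗-congʳ reflection (λ j k → reflection-sym k j)) reflection-involutive ,
        ≈ₘ-trans (⊗-congˡ reflection (λ j k → reflection-sym k j)) reflection-involutive

      -- Only the p-th and q-th diagonal entries change; the factor N² clears the
      -- denominators of κ.
      sum-diagonal-conjugate : ∀ (w : Fin n → Carrier) (B : Matrix n) → (∀ j k → B j k ≈ B k j) →
        let N = x * x + y * y in
        N * N * (sum (λ r → w r * (reflection ⊗ B ⊗ reflection) r r) - sum (λ r → w r * B r r))
        ≈ (1# + 1#) * (1# + 1#) * (w p - w q) * (x * y) *
          ((x * x - y * y) * B p q - x * y * (B p p - B q q))
      sum-diagonal-conjugate w B B-sym = begin
        N * N * (sum (λ r → w r * (reflection ⊗ B ⊗ reflection) r r) - sum (λ r → w r * B r r))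
          ≈⟨ *-congˡ (+-congʳ (sum-cong {n} (λ r → *-congˡ (diagonal r)))) ⟩
        N * N * (sum (λ r → w r * (B r r + normal r * g r)) - sum (λ r → w r * B r r))
          ≈⟨ *-congˡ (+-congʳ (trans (sum-cong {n} (λ r → solve 4 (λ w b u g → w :* (b :+ u :* g) := w :* b :+ u :* (w :* g))
               refl (w r) (B r r) (normal r) (g r)))
                                     (∑-distrib-+ (λ r → w r * B r r) (λ r → normal r * (w r * g r))))) ⟩
        N * N * (sum (λ r → w r * B r r) + sum (λ r → normal r * (w r * g r)) - sum (λ r → w r * B r r))
          ≈⟨ *-congˡ (solve 2 (λ a b → a :+ b :- a := b) refl _ _) ⟩
        N * N * sum (λ r → normal r * (w r * g r))
          ≈⟨ *-congˡ (sum-normal (λ r → w r * g r)) ⟩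
        N * N * (x * (w p * g p) + y * (w q * g q))
          ≈⟨ *-congˡ (+-cong
               (*-congˡ (*-congˡ (+-cong (*-congˡ (+-congˡ (*-congˡ (B-sym q p)))) (*-congʳ (*-congˡ normal-p)))))
               (*-congˡ (*-congˡ (+-congˡ (*-congʳ (*-congˡ normal-q)))))) ⟩
        N * N * (x * (w p * (- (κ + κ) * (x * a + y * b) + κ * κ * x * S))
               + y * (w q * (- (κ + κ) * (x * b + y * d) + κ * κ * y * S)))
          ≈⟨ solve 9 (λ N x y wp wq κ X Y S →
               N :* N :* (x :* (wp :* (:- (κ :+ κ) :* X :+ κ :* κ :* x :* S))
                 :+ y :* (wq :* (:- (κ :+ κ) :* Y :+ κ :* κ :* y :* S)))
               := x :* (wp :* (:- (κ :* N :+ κ :* N) :* (N :* X) :+ (κ :* N) :* (κ :* N) :* x :* S))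
                 :+ y :* (wq :* (:- (κ :* N :+ κ :* N) :* (N :* Y) :+ (κ :* N) :* (κ :* N) :* y :* S)))
               refl N x y (w p) (w q) κ (x * a + y * b) (x * b + y * d) S ⟩
        x * (w p * (- (κ * N + κ * N) * (N * (x * a + y * b)) + (κ * N) * (κ * N) * x * S))
          + y * (w q * (- (κ * N + κ * N) * (N * (x * b + y * d)) + (κ * N) * (κ * N) * y * S))
          ≈⟨ +-cong (*-congˡ (*-congˡ (+-cong (*-congʳ (-‿cong (+-cong κ-norm κ-norm))) (*-congʳ (*-congʳ (*-cong κ-norm κ-norm))))))
                    (*-congˡ (*-congˡ (+-cong (*-congʳ (-‿cong (+-cong κ-norm κ-norm))) (*-congʳ (*-congʳ (*-cong κ-norm κ-norm)))))) ⟩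
        x * (w p * (- (2# + 2#) * (N * (x * a + y * b)) + 2# * 2# * x * S))
          + y * (w q * (- (2# + 2#) * (N * (x * b + y * d)) + 2# * 2# * y * S))
          ≈⟨ solve 7 (λ x y wp wq a b d →
               let N = x :* x :+ y :* y ; 2′ = :1 :+ :1
                   S = x :* (x :* a :+ y :* b) :+ y :* (x :* b :+ y :* d) in
               x :* (wp :* (:- (2′ :+ 2′) :* (N :* (x :* a :+ y :* b)) :+ 2′ :* 2′ :* x :* S))
                 :+ y :* (wq :* (:- (2′ :+ 2′) :* (N :* (x :* b :+ y :* d)) :+ 2′ :* 2′ :* y :* S))
               := 2′ :* 2′ :* (wp :- wq) :* (x :* y) :* ((x :* x :- y :* y) :* b :- x :* y :* (a :- d)))
               refl x y (w p) (w q) a b d ⟩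
        2# * 2# * (w p - w q) * (x * y) * ((x * x - y * y) * b - x * y * (a - d)) ∎
        where
        open Eq
        N 2# a b d S : Carrier
        N = x * x + y * y
        2# = 1# + 1#
        a = B p p
        b = B p q
        d = B q q
        S = x * (x * a + y * b) + y * (x * b + y * d)
        -- With H the reflection and v its normal, (H B H)_rr = B_rr - 2κ v_r (B v)_r + κ² v_r²
        -- vᵀBv. Here `S` is vᵀBv, and `g r` is what remains of the change after the factor v_r is
        -- split off; that factor lets `sum-normal` reduce the sum to p and q.
        g : Fin n → Carrier
        g r = - (κ + κ) * (x * B p r + y * B q r) + κ * κ * normal r * S
        diagonal : ∀ r → (reflection ⊗ B ⊗ reflection) r r ≈ B r r + normal r * g r
        diagonal r = begin
          (reflection ⊗ B ⊗ reflection) r r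
            ≈⟨ ⊗-reflection (reflection ⊗ B) r r ⟩
          (reflection ⊗ B) r r - κ * u * (x * (reflection ⊗ B) r p + y * (reflection ⊗ B) r q)
            ≈⟨ +-cong (reflection-⊗ B r r) (-‿cong (*-congˡ (+-cong (*-congˡ (reflection-⊗ B r p)) (*-congˡ (reflection-⊗ B r q))))) ⟩
          (B r r - κ * u * (x * B p r + y * B q r))
            - κ * u * (x * (B r p - κ * u * (x * B p p + y * B q p)) + y * (B r q - κ * u * (x * B p q + y * B q q)))
            ≈⟨ +-congˡ (-‿cong (*-congˡ (+-cong
                 (*-congˡ (+-cong (B-sym r p) (-‿cong (*-congˡ (+-congˡ (*-congˡ (B-sym q p)))))))
                 (*-congˡ (+-congʳ (B-sym r q)))))) ⟩
          (B r r - κ * u * (x * B p r + y * B q r))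
            - κ * u * (x * (B p r - κ * u * (x * a + y * b)) + y * (B q r - κ * u * (x * b + y * d)))
            ≈⟨ solve 9 (λ c κ u x y e f X Y →
                 (c :- κ :* u :* (x :* e :+ y :* f)) :- κ :* u :* (x :* (e :- κ :* u :* X) :+ y :* (f :- κ :* u :* Y))
                 := c :+ u :* (:- (κ :+ κ) :* (x :* e :+ y :* f) :+ κ :* κ :* u :* (x :* X :+ y :* Y)))
                 refl (B r r) κ u x y (B p r) (B q r) (x * a + y * b) (x * b + y * d) ⟩
          B r r + u * g r ∎
          where
          u : Carrier
          u = normal r

-- Formal exponential series and Cauchy products

module CauchyProduct (R : CommutativeRing 0ℓ 0ℓ) where

  open CommutativeRing R
  open RingTools R
  open Algebra.Properties.Semiring.Mult semiring using () renaming (_×_ to _⋆_)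

  ν : ℕ → Carrier
  ν n = n ⋆ 1#

  ∑< : (ℕ → Carrier) → ℕ → Carrier
  ∑< f N = sum {N} (λ k → f (toℕ k))

  ∑<-cong : ∀ {f g} → (∀ k → f k ≈ g k) → ∀ N → ∑< f N ≈ ∑< g N
  ∑<-cong f≈g N = sum-cong {N} (λ k → f≈g (toℕ k))

  ∑<-suc : ∀ f N → ∑< f (suc N) ≈ ∑< f N + f N
  ∑<-suc f zero    = +-comm _ _
  ∑<-suc f (suc N) = trans (+-congˡ (∑<-suc (f ∘ suc) N)) (sym (+-assoc _ _ _))

  -- The coefficients of the product of two power series. The recursion shifts the first factor
  -- only, so inductions run on the index with `a` generalised and `b` fixed.
  conv : (ℕ → Carrier) → (ℕ → Carrier) → ℕ → Carrier
  conv a b zero    = a 0 * b 0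
  conv a b (suc m) = a 0 * b (suc m) + conv (a ∘ suc) b m

  conv-cong : ∀ {a a′ b b′} → (∀ k → a k ≈ a′ k) → (∀ k → b k ≈ b′ k) → ∀ m → conv a b m ≈ conv a′ b′ m
  conv-cong a≈ b≈ zero    = *-cong (a≈ 0) (b≈ 0)
  conv-cong a≈ b≈ (suc m) = +-cong (*-cong (a≈ 0) (b≈ (suc m))) (conv-cong (a≈ ∘ suc) b≈ m)

  conv-+ˡ : ∀ a a′ b m → conv (λ k → a k + a′ k) b m ≈ conv a b m + conv a′ b m
  conv-+ˡ a a′ b zero    = distribʳ _ _ _
  conv-+ˡ a a′ b (suc m) = trans (+-congˡ (conv-+ˡ (a ∘ suc) (a′ ∘ suc) b m))
    (solve 5 (λ x y b c d → (x :+ y) :* b :+ (c :+ d) := (x :* b :+ c) :+ (y :* b :+ d)) refl _ _ _ _ _)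

  conv-*ˡ : ∀ z a b m → conv (λ k → z * a k) b m ≈ z * conv a b m
  conv-*ˡ z a b zero    = *-assoc _ _ _
  conv-*ˡ z a b (suc m) = trans (+-congˡ (conv-*ˡ z (a ∘ suc) b m))
    (solve 4 (λ z a b c → z :* a :* b :+ z :* c := z :* (a :* b :+ c)) refl _ _ _ _)

  conv-*ʳ : ∀ w a b m → conv a (λ k → w * b k) m ≈ w * conv a b m
  conv-*ʳ w a b zero    = solve 3 (λ w a b → a :* (w :* b) := w :* (a :* b)) refl _ _ _
  conv-*ʳ w a b (suc m) = trans (+-congˡ (conv-*ʳ w (a ∘ suc) b m))
    (solve 4 (λ w a b c → a :* (w :* b) :+ w :* c := w :* (a :* b :+ c)) refl _ _ _ _)

  -- The coefficients of the derivative of the power series ∑ a_k x^k.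
  ∂ : (ℕ → Carrier) → ℕ → Carrier
  ∂ a k = ν (suc k) * a (suc k)

  -- Write the first series as a(0) + x a⁺ with a⁺ its shift. The derivative of x a⁺ b is a⁺ b + x
  -- (a⁺ b)′, which is the split of the factor m + 2 into 1 and m + 1; the induction hypothesis
  -- applies to (a⁺ b)′.
  leibniz : ∀ a b m → ∂ (conv a b) m ≈ conv (∂ a) b m + conv a (∂ b) m
  leibniz a b zero = solve 5 (λ n a₀ a₁ b₀ b₁ →
    n :* (a₀ :* b₁ :+ a₁ :* b₀) := n :* a₁ :* b₀ :+ a₀ :* (n :* b₁)) refl (ν 1) (a 0) (a 1) (b 0) (b 1)
  leibniz a b (suc m) = begin
    ν (suc (suc m)) * (a 0 * b (suc (suc m)) + conv (a ∘ suc) b (suc m))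
      ≈⟨ solve 4 (λ n a b c → (:1 :+ n) :* (a :* b :+ c) := a :* ((:1 :+ n) :* b) :+ c :+ n :* c)
         refl (ν (suc m)) (a 0) (b (suc (suc m))) (conv (a ∘ suc) b (suc m)) ⟩
    a 0 * ∂ b (suc m) + conv (a ∘ suc) b (suc m) + ∂ (conv (a ∘ suc) b) m
      ≈⟨ +-congˡ (leibniz (a ∘ suc) b m) ⟩
    a 0 * ∂ b (suc m) + (a 1 * b (suc m) + conv (λ k → a (suc (suc k))) b m)
      + (conv (∂ (a ∘ suc)) b m + conv (a ∘ suc) (∂ b) m)
      ≈⟨ solve 6 (λ x a b c d e → x :+ (a :* b :+ c) :+ (d :+ e) := ((:1 :+ :0) :* a :* b :+ (c :+ d)) :+ (x :+ e))
         refl (a 0 * ∂ b (suc m)) (a 1) (b (suc m)) (conv (λ k → a (suc (suc k))) b m) (conv (∂ (a ∘ suc)) b m) (conv (a ∘ suc) (∂ b) m) ⟩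
    (∂ a 0 * b (suc m) + (conv (λ k → a (suc (suc k))) b m + conv (∂ (a ∘ suc)) b m)) + conv a (∂ b) (suc m)
      ≈⟨ +-congʳ (+-congˡ (trans (sym (conv-+ˡ (λ k → a (suc (suc k))) (∂ (a ∘ suc)) b m))
           (conv-cong (λ k → solve 2 (λ n a → a :+ n :* a := (:1 :+ n) :* a)
                refl (ν (suc k)) (a (suc (suc k)))) (λ k → refl) m))) ⟩
    conv (∂ a) b (suc m) + conv a (∂ b) (suc m) ∎
    where open Eq

  -- a_k = z^k / k!, characterised without division.
  IsExponential : Carrier → (ℕ → Carrier) → Set
  IsExponential z a = a 0 ≈ 1# × (∀ k → ∂ a k ≈ z * a k)

  -- The functional equation of the exponential on coefficients: by the product rule, a product of
  -- solutions of y′ = z y and y′ = w y solves y′ = (z + w) y, with initial value 1 · 1.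
  conv-exponential : ∀ {z w a b} → IsExponential z a → IsExponential w b → IsExponential (z + w) (conv a b)
  conv-exponential {z} {w} {a} {b} (a₀ , ∂a) (b₀ , ∂b) =
    trans (*-cong a₀ b₀) (*-identityˡ 1#) , λ m → begin
      ∂ (conv a b) m                                    ≈⟨ leibniz a b m ⟩
      conv (∂ a) b m + conv a (∂ b) m                   ≈⟨ +-cong (conv-cong ∂a (λ _ → refl) m) (conv-cong (λ _ → refl) ∂b m) ⟩
      conv (λ k → z * a k) b m + conv a (λ k → w * b k) m ≈⟨ +-cong (conv-*ˡ z a b m) (conv-*ʳ w a b m) ⟩
      z * conv a b m + w * conv a b m                   ≈⟨ distribʳ _ _ _ ⟨
      (z + w) * conv a b m                              ∎
    where open Eq

  -- The sum of a_j b_k over the triangle j + k < N.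
  ∑△ : (ℕ → Carrier) → (ℕ → Carrier) → ℕ → Carrier
  ∑△ a b zero    = 0#
  ∑△ a b (suc N) = a 0 * ∑< b (suc N) + ∑△ (a ∘ suc) b N

  -- `∑△` is built row by row, whereas enlarging the triangle adds its diagonal j + k = N; the
  -- induction reconciles the two.
  ∑△-suc : ∀ a b N → ∑△ a b (suc N) ≈ ∑△ a b N + conv a b N
  ∑△-suc a b zero = solve 2 (λ a b → a :* (b :+ :0) :+ :0 := :0 :+ a :* b) refl _ _
  ∑△-suc a b (suc N) = begin
    a 0 * ∑< b (suc (suc N)) + ∑△ (a ∘ suc) b (suc N)
      ≈⟨ +-cong (*-congˡ (∑<-suc b (suc N))) (∑△-suc (a ∘ suc) b N) ⟩
    a 0 * (∑< b (suc N) + b (suc N)) + (∑△ (a ∘ suc) b N + conv (a ∘ suc) b N)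
      ≈⟨ solve 5 (λ a s b t c → a :* (s :+ b) :+ (t :+ c) := (a :* s :+ t) :+ (a :* b :+ c)) refl _ _ _ _ _ ⟩
    ∑△ a b (suc N) + conv a b (suc N) ∎
    where open Eq

  ∑△≈∑<conv : ∀ a b N → ∑△ a b N ≈ ∑< (conv a b) N
  ∑△≈∑<conv a b zero    = refl
  ∑△≈∑<conv a b (suc N) = trans (∑△-suc a b N) (trans (+-congʳ (∑△≈∑<conv a b N)) (sym (∑<-suc (conv a b) N)))

-- Order, absolute value and finite sums over the reals

module RealLine (em : ExcludedMiddle 0ℓ) (𝓡 : CompleteOrderedField) where

  open CompleteOrderedField 𝓡 hiding (zero)
  open RingTools commutativeRing hiding (sum)
  open IsTotalOrder isTotalOrder public using (total; antisym)
    renaming (reflexive to ≤-reflexive; trans to ≤-trans)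

  poset : Poset 0ℓ 0ℓ 0ℓ
  poset = record { isPartialOrder = IsTotalOrder.isPartialOrder isTotalOrder }

  open Poset poset public using () renaming (refl to ≤-refl)
  module ≤R = Relation.Binary.Reasoning.PartialOrder poset

  <⇒≤ : ∀ {x y} → x < y → x ≤ y
  <⇒≤ = proj₁

  <-≤-trans : ∀ {x y z} → x < y → y ≤ z → x < z
  <-≤-trans x<y y≤z = begin-strict _ <⟨ x<y ⟩ _ ≤⟨ y≤z ⟩ _ ∎
    where open ≤R

  ≤-<-trans : ∀ {x y z} → x ≤ y → y < z → x < z
  ≤-<-trans x≤y y<z = begin-strict _ ≤⟨ x≤y ⟩ _ <⟨ y<z ⟩ _ ∎
    where open ≤R

  <⇒≱ : ∀ {x y} → x < y → ¬ (y ≤ x)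
  <⇒≱ (x≤y , x≉y) y≤x = x≉y (antisym x≤y y≤x)

  ≤∨> : ∀ x y → x ≤ y ⊎ y < x
  ≤∨> x y with total x y | em {y ≈ x}
  ... | inj₁ x≤y | _        = inj₁ x≤y
  ... | inj₂ y≤x | yes y≈x = inj₁ (≤-reflexive (sym y≈x))
  ... | inj₂ y≤x | no  y≉x = inj₂ (y≤x , y≉x)

  ≮⇒≥ : ∀ {x y} → ¬ (x < y) → y ≤ x
  ≮⇒≥ {x} {y} x≮y with ≤∨> y x
  ... | inj₁ y≤x = y≤x
  ... | inj₂ x<y = contradiction x<y x≮y

  ¬¬-elim : {A : Set} → ¬ ¬ A → A
  ¬¬-elim {A} ¬¬a with em {A}
  ... | yes a  = a
  ... | no  ¬a = contradiction ¬a ¬¬a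

  decide : (A : Set) → A ⊎ ¬ A
  decide A with em {A}
  ... | yes a  = inj₁ a
  ... | no  ¬a = inj₂ ¬a

  +-mono : ∀ {a b c d} → a ≤ b → c ≤ d → a + c ≤ b + d
  +-mono {a} {b} {c} {d} a≤b c≤d = begin
    a + c ≤⟨ +-mono-≤ c a≤b ⟩
    b + c ≈⟨ +-comm b c ⟩
    c + b ≤⟨ +-mono-≤ b c≤d ⟩
    d + b ≈⟨ +-comm d b ⟩
    b + d ∎
    where open ≤R

  0≤x-y : ∀ {x y} → y ≤ x → 0# ≤ x - y
  0≤x-y {x} {y} y≤x = ≤-trans (≤-reflexive (sym (-‿inverseʳ y))) (+-mono-≤ (- y) y≤x)

  -- Hands inequalities to the ring solver: it remains to exhibit y - x as an expression that is
  -- visibly nonnegative.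
  difference-nonneg⇒≤ : ∀ {x y d} → 0# ≤ d → y - x ≈ d → x ≤ y
  difference-nonneg⇒≤ {x} {y} {d} 0≤d y-x≈d = begin
    x           ≈⟨ +-identityˡ x ⟨
    0# + x      ≤⟨ +-mono-≤ x 0≤d ⟩
    d + x       ≈⟨ +-congʳ y-x≈d ⟨
    y - x + x   ≈⟨ solve 2 (λ x y → y :- x :+ x := y) refl x y ⟩
    y           ∎
    where open ≤R

  neg-mono : ∀ {x y} → x ≤ y → - y ≤ - x
  neg-mono {x} {y} x≤y = difference-nonneg⇒≤ (0≤x-y x≤y)
    (solve 2 (λ x y → :- x :- :- y := y :- x) refl x y)

  ≤0⇒0≤- : ∀ {x} → x ≤ 0# → 0# ≤ - x
  ≤0⇒0≤- x≤0 = ≤-trans (≤-reflexive (sym -0#≈0#)) (neg-mono x≤0)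

  +-nonneg : ∀ {x y} → 0# ≤ x → 0# ≤ y → 0# ≤ x + y
  +-nonneg 0≤x 0≤y = ≤-trans (≤-reflexive (sym (+-identityˡ 0#))) (+-mono 0≤x 0≤y)

  x≤x+y : ∀ {x y} → 0# ≤ y → x ≤ x + y
  x≤x+y {x} {y} 0≤y = difference-nonneg⇒≤ 0≤y (solve 2 (λ x y → x :+ y :- x := y) refl x y)

  x≤y+x : ∀ {x y} → 0# ≤ y → x ≤ y + x
  x≤y+x {x} {y} 0≤y = difference-nonneg⇒≤ 0≤y (solve 2 (λ x y → y :+ x :- x := y) refl x y)

  *-monoˡ : ∀ {x y z} → 0# ≤ z → x ≤ y → z * x ≤ z * y
  *-monoˡ {x} {y} {z} 0≤z x≤y = difference-nonneg⇒≤ (*-nonneg 0≤z (0≤x-y x≤y))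
    (solve 3 (λ x y z → z :* y :- z :* x := z :* (y :- x)) refl x y z)

  *-monoʳ : ∀ {x y z} → 0# ≤ z → x ≤ y → x * z ≤ y * z
  *-monoʳ {x} {y} {z} 0≤z x≤y = difference-nonneg⇒≤ (*-nonneg 0≤z (0≤x-y x≤y))
    (solve 3 (λ x y z → y :* z :- x :* z := z :* (y :- x)) refl x y z)

  *-mono : ∀ {x y z w} → 0# ≤ x → 0# ≤ w → x ≤ y → z ≤ w → x * z ≤ y * w
  *-mono 0≤x 0≤w x≤y z≤w = ≤-trans (*-monoˡ 0≤x z≤w) (*-monoʳ 0≤w x≤y)

  square-nonneg : ∀ x → 0# ≤ x * x
  square-nonneg x with total 0# x
  ... | inj₁ 0≤x = *-nonneg 0≤x 0≤x
  ... | inj₂ x≤0 = ≤-trans (*-nonneg (≤0⇒0≤- x≤0) (≤0⇒0≤- x≤0))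
    (≤-reflexive (solve 1 (λ x → (:- x) :* (:- x) := x :* x) refl x))

  0≤1 : 0# ≤ 1#
  0≤1 = ≤-trans (square-nonneg 1#) (≤-reflexive (*-identityˡ 1#))

  0<1 : 0# < 1#
  0<1 = 0≤1 , 0≉1

  <⇒≉ : ∀ {x} → 0# < x → ¬ (x ≈ 0#)
  <⇒≉ (_ , 0≉x) x≈0 = 0≉x (sym x≈0)

  no-zero-divisors : ∀ {x y} → ¬ (x ≈ 0#) → x * y ≈ 0# → y ≈ 0#
  no-zero-divisors {x} {y} x≉0 xy≈0 = begin
    y              ≈⟨ *-identityˡ y ⟨
    1# * y         ≈⟨ *-congʳ (⁻¹-inverse x≉0) ⟨
    x * x ⁻¹ * y   ≈⟨ solve 3 (λ x i y → x :* i :* y := i :* (x :* y)) refl x (x ⁻¹) y ⟩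
    x ⁻¹ * (x * y) ≈⟨ *-congˡ xy≈0 ⟩
    x ⁻¹ * 0#      ≈⟨ zeroʳ _ ⟩
    0#             ∎
    where open Eq

  *-cancelˡ : ∀ {x y z} → ¬ (x ≈ 0#) → x * y ≈ x * z → y ≈ z
  *-cancelˡ {x} {y} {z} x≉0 xy≈xz = begin
    y           ≈⟨ solve 2 (λ y z → y := (y :- z) :+ z) refl y z ⟩
    y - z + z   ≈⟨ +-congʳ (no-zero-divisors x≉0 (begin
      x * (y - z)    ≈⟨ solve 3 (λ x y z → x :* (y :- z) := x :* y :- x :* z) refl x y z ⟩
      x * y - x * z  ≈⟨ +-congʳ xy≈xz ⟩
      x * z - x * z  ≈⟨ -‿inverseʳ _ ⟩
      0#             ∎)) ⟩
    0# + z      ≈⟨ +-identityˡ z ⟩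
    z           ∎
    where open Eq

  square≈0 : ∀ {x} → x * x ≈ 0# → x ≈ 0#
  square≈0 {x} xx≈0 with em {x ≈ 0#}
  ... | yes x≈0 = x≈0
  ... | no  x≉0 = no-zero-divisors x≉0 xx≈0

  *-pos : ∀ {x y} → 0# < x → 0# < y → 0# < x * y
  *-pos 0<x 0<y = *-nonneg (<⇒≤ 0<x) (<⇒≤ 0<y) ,
    λ 0≈xy → <⇒≉ 0<y (no-zero-divisors (<⇒≉ 0<x) (sym 0≈xy))

  *-cancelˡ-≤ : ∀ {x y z} → 0# < x → x * y ≤ x * z → y ≤ z
  *-cancelˡ-≤ {x} {y} {z} 0<x xy≤xz with total y z
  ... | inj₁ y≤z = y≤z
  ... | inj₂ z≤y = ≤-reflexive (*-cancelˡ (<⇒≉ 0<x) (antisym xy≤xz (*-monoˡ (<⇒≤ 0<x) z≤y)))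

  ⁻¹-pos : ∀ {x} → 0# < x → 0# < x ⁻¹
  ⁻¹-pos {x} 0<x = *-cancelˡ-≤ 0<x (begin
      x * 0#    ≈⟨ zeroʳ x ⟩
      0#        ≤⟨ 0≤1 ⟩
      1#        ≈⟨ ⁻¹-inverse (<⇒≉ 0<x) ⟨
      x * x ⁻¹  ∎) ,
    λ 0≈x⁻¹ → 0≉1 (trans (sym (zeroʳ x)) (trans (*-congˡ 0≈x⁻¹) (⁻¹-inverse (<⇒≉ 0<x))))
    where open ≤R

  +-pos-nonneg : ∀ {x y} → 0# < x → 0# ≤ y → 0# < x + y
  +-pos-nonneg 0<x 0≤y = <-≤-trans 0<x (x≤x+y 0≤y)

  2# : Carrier
  2# = 1# + 1#

  0<2 : 0# < 2#
  0<2 = +-pos-nonneg 0<1 0≤1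

  half : Carrier → Carrier
  half ε = 2# ⁻¹ * ε

  half-pos : ∀ {ε} → 0# < ε → 0# < half ε
  half-pos = *-pos (⁻¹-pos 0<2)

  half+half : ∀ ε → half ε + half ε ≈ ε
  half+half ε = begin
    half ε + half ε    ≈⟨ solve 2 (λ i ε → i :* ε :+ i :* ε := (:1 :+ :1) :* i :* ε) refl (2# ⁻¹) ε ⟩
    2# * 2# ⁻¹ * ε     ≈⟨ *-congʳ (⁻¹-inverse (<⇒≉ 0<2)) ⟩
    1# * ε             ≈⟨ *-identityˡ ε ⟩
    ε                  ∎
    where open Eq

  x≈x+y⇒y≈0 : ∀ {x y} → x ≈ x + y → y ≈ 0#
  x≈x+y⇒y≈0 {x} {y} x≈x+y = begin
    y             ≈⟨ solve 2 (λ x y → y := (x :+ y) :- x) refl x y ⟩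
    x + y - x     ≈⟨ +-congʳ x≈x+y ⟨
    x - x         ≈⟨ -‿inverseʳ x ⟩
    0#            ∎
    where open Eq

  x+y≰x : ∀ {x y} → 0# < y → ¬ (x + y ≤ x)
  x+y≰x 0<y x+y≤x = <⇒≉ 0<y (x≈x+y⇒y≈0 (antisym (x≤x+y (<⇒≤ 0<y)) x+y≤x))

  ≤-from-ε : ∀ {x y} → (∀ ε → 0# < ε → x ≤ y + ε) → x ≤ y
  ≤-from-ε {x} {y} h with ≤∨> x y
  ... | inj₁ x≤y = x≤y
  ... | inj₂ y<x = contradiction (begin
      y + ε + ε   ≈⟨ +-assoc _ _ _ ⟩
      y + (ε + ε) ≈⟨ +-congˡ (half+half _) ⟩
      y + (x - y) ≈⟨ solve 2 (λ x y → y :+ (x :- y) := x) refl x y ⟩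
      x           ≤⟨ h ε ε-pos ⟩
      y + ε       ∎) (x+y≰x ε-pos)
    where
    open ≤R
    ε : Carrier
    ε = half (x - y)
    ε-pos : 0# < ε
    ε-pos = half-pos (0≤x-y (<⇒≤ y<x) , λ 0≈x-y → proj₂ y<x
      (trans (sym (+-identityˡ y)) (trans (+-congʳ 0≈x-y) (solve 2 (λ x y → x :- y :+ y := x) refl x y))))

  abstract
    -- Sealed together with its five basic properties, so that later goals contain `abs x` and not
    -- the case distinction on `total 0# x`.
    abs : Carrier → Carrier
    abs x with total 0# x
    ... | inj₁ _ = x
    ... | inj₂ _ = - x

    x≤abs : ∀ x → x ≤ abs x
    x≤abs x with total 0# x
    ... | inj₁ _   = ≤-refl
    ... | inj₂ x≤0 = ≤-trans x≤0 (≤0⇒0≤- x≤0)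

    -x≤abs : ∀ x → - x ≤ abs x
    -x≤abs x with total 0# x
    ... | inj₁ 0≤x = ≤-trans (≤-trans (neg-mono 0≤x) (≤-reflexive -0#≈0#)) 0≤x
    ... | inj₂ _   = ≤-refl

    abs-least : ∀ {x b} → x ≤ b → - x ≤ b → abs x ≤ b
    abs-least {x} x≤b -x≤b with total 0# x
    ... | inj₁ _ = x≤b
    ... | inj₂ _ = -x≤b

    abs-nonneg : ∀ x → 0# ≤ abs x
    abs-nonneg x with total 0# x
    ... | inj₁ 0≤x = 0≤x
    ... | inj₂ x≤0 = ≤0⇒0≤- x≤0

    abs-square : ∀ x → abs x * abs x ≈ x * x
    abs-square x with total 0# x
    ... | inj₁ _ = refl
    ... | inj₂ _ = solve 1 (λ x → (:- x) :* (:- x) := x :* x) refl x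

  abs-of-nonneg : ∀ {x} → 0# ≤ x → abs x ≤ x
  abs-of-nonneg 0≤x = abs-least ≤-refl (≤-trans (≤-trans (neg-mono 0≤x) (≤-reflexive -0#≈0#)) 0≤x)

  abs-cong-≤ : ∀ {x y} → x ≈ y → abs x ≤ abs y
  abs-cong-≤ {x} {y} x≈y = abs-least (≤-trans (≤-reflexive x≈y) (x≤abs y))
                                     (≤-trans (≤-reflexive (-‿cong x≈y)) (-x≤abs y))

  abs-+ : ∀ x y → abs (x + y) ≤ abs x + abs y
  abs-+ x y = abs-least (+-mono (x≤abs x) (x≤abs y))
    (≤-trans (≤-reflexive (sym (-‿+-comm x y))) (+-mono (-x≤abs x) (-x≤abs y)))

  abs-neg : ∀ x → abs (- x) ≤ abs x
  abs-neg x = abs-least (-x≤abs x) (≤-trans (≤-reflexive (-‿involutive x)) (x≤abs x))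

  doubled-nonneg : ∀ {x} → 0# ≤ x + x → 0# ≤ x
  doubled-nonneg {x} 0≤2x = *-cancelˡ-≤ 0<2 (begin
    2# * 0#  ≈⟨ zeroʳ _ ⟩
    0#       ≤⟨ 0≤2x ⟩
    x + x    ≈⟨ solve 1 (λ x → x :+ x := (:1 :+ :1) :* x) refl x ⟩
    2# * x   ∎)
    where open ≤R

  -- With X = |x| and Y = |y|, all of X ± x and Y ± y are nonnegative, hence so is (X - x)(Y + y) +
  -- (X + x)(Y - y) = 2(XY - xy). Exchanging X - x and X + x gives 2(XY + xy).
  abs-* : ∀ x y → abs (x * y) ≤ abs x * abs y
  abs-* x y = abs-least
      (difference-nonneg⇒≤ (doubled-nonneg (≤-trans (+-nonneg (*-nonneg a b) (*-nonneg c d))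
        (≤-reflexive (solve 4 (λ X Y x y → (X :- x) :* (Y :+ y) :+ (X :+ x) :* (Y :- y)
                                      := (X :* Y :- x :* y) :+ (X :* Y :- x :* y)) refl X Y x y)))) refl)
      (difference-nonneg⇒≤ (doubled-nonneg (≤-trans (+-nonneg (*-nonneg c b) (*-nonneg a d))
        (≤-reflexive (solve 4 (λ X Y x y → (X :+ x) :* (Y :+ y) :+ (X :- x) :* (Y :- y)
                                      := (X :* Y :- :- (x :* y)) :+ (X :* Y :- :- (x :* y))) refl X Y x y)))) refl)
    where
    X Y : Carrier
    X = abs x
    Y = abs y
    0≤x+y : ∀ {x y} → - y ≤ x → 0# ≤ x + y
    0≤x+y {x} {y} h = ≤-trans (0≤x-y h) (≤-reflexive (+-congˡ (-‿involutive y)))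
    a : 0# ≤ X - x
    a = 0≤x-y (x≤abs x)
    b : 0# ≤ Y + y
    b = 0≤x+y (-x≤abs y)
    c : 0# ≤ X + x
    c = 0≤x+y (-x≤abs x)
    d : 0# ≤ Y - y
    d = 0≤x-y (x≤abs y)

  sum-mono : ∀ {n} {f g : Fin n → Carrier} → (∀ j → f j ≤ g j) → sum f ≤ sum g
  sum-mono {zero}  f≤g = ≤-refl
  sum-mono {suc n} f≤g = +-mono (f≤g zero) (sum-mono (λ j → f≤g (suc j)))

  sum-nonneg : ∀ {n} {f : Fin n → Carrier} → (∀ j → 0# ≤ f j) → 0# ≤ sum f
  sum-nonneg {zero}  0≤f = ≤-refl
  sum-nonneg {suc n} 0≤f = +-nonneg (0≤f zero) (sum-nonneg (λ j → 0≤f (suc j)))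

  abs-sum : ∀ {n} (f : Fin n → Carrier) → abs (sum f) ≤ sum (λ j → abs (f j))
  abs-sum {zero}  f = abs-of-nonneg ≤-refl
  abs-sum {suc n} f = ≤-trans (abs-+ _ _) (+-mono ≤-refl (abs-sum (λ j → f (suc j))))

  term≤sum : ∀ {n} {f : Fin n → Carrier} → (∀ j → 0# ≤ f j) → ∀ j → f j ≤ sum f
  term≤sum 0≤f zero    = x≤x+y (sum-nonneg (λ j → 0≤f (suc j)))
  term≤sum 0≤f (suc j) = ≤-trans (term≤sum (λ j → 0≤f (suc j)) j) (x≤y+x (0≤f zero))

  sum-nonneg≈0 : ∀ {n} {f : Fin n → Carrier} → (∀ j → 0# ≤ f j) → sum f ≈ 0# → ∀ j → f j ≈ 0#
  sum-nonneg≈0 0≤f sum≈0 j = antisym (≤-trans (term≤sum 0≤f j) (≤-reflexive sum≈0)) (0≤f j)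

  -- The cross terms are nonnegative. This bounds the Euclidean norm by the sum of the sizes of the
  -- entries.
  sum-squares≤square-sum : ∀ {n} {f : Fin n → Carrier} → (∀ j → 0# ≤ f j) →
                           sum (λ j → f j * f j) ≤ sum f * sum f
  sum-squares≤square-sum {zero}  0≤f = ≤-reflexive (sym (zeroˡ 0#))
  sum-squares≤square-sum {suc n} {f} 0≤f = begin
    a * a + sum (λ j → f (suc j) * f (suc j)) ≤⟨ +-mono ≤-refl (sum-squares≤square-sum (λ j → 0≤f (suc j))) ⟩
    a * a + s * s
      ≤⟨ x≤x+y (+-nonneg as as) ⟩
    a * a + s * s + (a * s + a * s)
      ≈⟨ solve 2 (λ a s → a :* a :+ s :* s :+ (a :* s :+ a :* s) := (a :+ s) :* (a :+ s)) refl a s ⟩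
    (a + s) * (a + s) ∎
    where
    open ≤R
    a s : Carrier
    a = f zero
    s = sum (λ j → f (suc j))
    as : 0# ≤ a * s
    as = *-nonneg (0≤f zero) (sum-nonneg (λ j → 0≤f (suc j)))

  square-cancel-≤ : ∀ {x y} → 0# ≤ y → x * x ≤ y * y → x ≤ y
  square-cancel-≤ {x} {y} 0≤y xx≤yy with ≤∨> x y
  ... | inj₁ x≤y = x≤y
  ... | inj₂ y<x = contradiction xx≤yy (<⇒≱ (≤-<-trans (*-monoˡ 0≤y (<⇒≤ y<x))
        (*-monoʳ (≤-trans 0≤y (<⇒≤ y<x)) (<⇒≤ y<x) ,
         λ yx≈xx → proj₂ y<x (*-cancelˡ (<⇒≉ (≤-<-trans 0≤y y<x)) (trans (*-comm x y) yx≈xx)))))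

-- Real limits, suprema and compactness

module RealLimits (em : ExcludedMiddle 0ℓ) (𝓡 : CompleteOrderedField) where

  open CompleteOrderedField 𝓡 hiding (zero)
  open RingTools commutativeRing hiding (sum)
  open RealLine em 𝓡

  -- The final bound is weak, so that monotone estimates compose without tracking strictness. The
  -- strict bound demanded by `_⟶_` and `_⟶ᵛ_` is recovered by passing to half of ε.
  Null : (ℕ → Carrier) → Set
  Null s = ∀ ε → 0# < ε → ∃ λ N → ∀ m → N ℕ.≤ m → abs (s m) ≤ ε

  Lim : (ℕ → Carrier) → Carrier → Set
  Lim s l = Null (λ m → s m - l)

  null-dominated : ∀ {s t} → (∀ m → abs (s m) ≤ abs (t m)) → Null t → Null s
  null-dominated s≤t t→0 ε 0<ε =
    let N , small = t→0 ε 0<ε in N , λ m N≤m → ≤-trans (s≤t m) (small m N≤m)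

  null-cong : ∀ {s t} → (∀ m → s m ≈ t m) → Null t → Null s
  null-cong s≈t = null-dominated (λ m → abs-cong-≤ (s≈t m))

  null-+ : ∀ {s t} → Null s → Null t → Null (λ m → s m + t m)
  null-+ s→0 t→0 ε 0<ε =
    let N , small-s = s→0 (half ε) (half-pos 0<ε)
        N′ , small-t = t→0 (half ε) (half-pos 0<ε)
    in N ℕ.⊔ N′ , λ m N≤m → ≤-trans (abs-+ _ _)
      (≤-trans (+-mono (small-s m (ℕ.m⊔n≤o⇒m≤o N N′ N≤m)) (small-t m (ℕ.m⊔n≤o⇒n≤o N N′ N≤m)))
               (≤-reflexive (half+half ε)))

  null-* : ∀ {s t} → Null s → Null t → Null (λ m → s m * t m)
  null-* s→0 t→0 ε 0<ε =
    let N , small-s = s→0 ε 0<ε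
        N′ , small-t = t→0 1# 0<1
    in N ℕ.⊔ N′ , λ m N≤m → ≤-trans (abs-* _ _)
      (≤-trans (*-mono (abs-nonneg _) 0≤1 (small-s m (ℕ.m⊔n≤o⇒m≤o N N′ N≤m)) (small-t m (ℕ.m⊔n≤o⇒n≤o N N′ N≤m)))
               (≤-reflexive (*-identityʳ ε)))

  null-scale : ∀ c {s} → Null s → Null (λ m → c * s m)
  null-scale c s→0 ε 0<ε =
    let N , small = s→0 (d ⁻¹ * ε) 0<ε′ in N , λ m N≤m → begin
      abs (c * _)               ≤⟨ abs-* _ _ ⟩
      abs c * abs _             ≤⟨ *-mono (abs-nonneg c) (<⇒≤ 0<ε′) (x≤y+x 0≤1) (small m N≤m) ⟩
      d * (d ⁻¹ * ε)            ≈⟨ *-assoc _ _ _ ⟨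
      d * d ⁻¹ * ε              ≈⟨ *-congʳ (⁻¹-inverse (<⇒≉ 0<d)) ⟩
      1# * ε                    ≈⟨ *-identityˡ ε ⟩
      ε                         ∎
    where
    open ≤R
    -- Adding 1 keeps the divisor positive when c = 0.
    d : Carrier
    d = 1# + abs c
    0<d : 0# < d
    0<d = +-pos-nonneg 0<1 (abs-nonneg c)
    0<ε′ : 0# < d ⁻¹ * ε
    0<ε′ = *-pos (⁻¹-pos 0<d) 0<ε

  null-zero : Null (λ _ → 0#)
  null-zero ε 0<ε = 0 , λ _ _ → ≤-trans (abs-of-nonneg ≤-refl) (<⇒≤ 0<ε)

  lim-cong : ∀ {s t l k} → (∀ m → s m ≈ t m) → l ≈ k → Lim s l → Lim t k
  lim-cong s≈t l≈k = null-cong (λ m → sym (+-cong (s≈t m) (-‿cong l≈k)))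

  lim-const : ∀ c → Lim (λ _ → c) c
  lim-const c = null-cong (λ _ → -‿inverseʳ c) null-zero

  lim-+ : ∀ {s t l k} → Lim s l → Lim t k → Lim (λ m → s m + t m) (l + k)
  lim-+ {s} {t} {l} {k} s→l t→k = null-cong
    (λ m → solve 4 (λ s t l k → (s :+ t) :- (l :+ k) := (s :- l) :+ (t :- k)) refl (s m) (t m) l k) (null-+ s→l t→k)

  lim-* : ∀ {s t l k} → Lim s l → Lim t k → Lim (λ m → s m * t m) (l * k)
  lim-* {s} {t} {l} {k} s→l t→k = null-cong
    (λ m → solve 4 (λ s t l k → s :* t :- l :* k := (s :- l) :* (t :- k) :+ (l :* (t :- k) :+ k :* (s :- l)))
         refl (s m) (t m) l k)
    (null-+ (null-* s→l t→k) (null-+ (null-scale l t→k) (null-scale k s→l)))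

  lim-scale : ∀ c {s l} → Lim s l → Lim (λ m → c * s m) (c * l)
  lim-scale c s→l = lim-* (lim-const c) s→l

  lim-neg : ∀ {s l} → Lim s l → Lim (λ m → - s m) (- l)
  lim-neg {s} {l} s→l = null-dominated (λ m → ≤-trans
    (abs-cong-≤ (solve 2 (λ s l → :- s :- :- l := :- (s :- l)) refl (s m) l)) (abs-neg (s m - l))) s→l

  lim-- : ∀ {s t l k} → Lim s l → Lim t k → Lim (λ m → s m - t m) (l - k)
  lim-- s→l t→k = lim-+ s→l (lim-neg t→k)

  lim-sum : ∀ {n} {s : Fin n → ℕ → Carrier} {l} → (∀ j → Lim (s j) (l j)) → Lim (λ m → sum (λ j → s j m)) (sum l)
  lim-sum {zero}  s→l = lim-const 0#
  lim-sum {suc n} s→l = lim-+ (s→l zero) (lim-sum (λ j → s→l (suc j)))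

  lim-subsequence : ∀ {s l φ} → (∀ m → m ℕ.≤ φ m) → Lim s l → Lim (s ∘ φ) l
  lim-subsequence m≤φm s→l ε 0<ε =
    let N , close = s→l ε 0<ε in N , λ m N≤m → close _ (ℕ.≤-trans N≤m (m≤φm m))

  lim-nonneg : ∀ {s l} → (∀ m → 0# ≤ s m) → Lim s l → 0# ≤ l
  lim-nonneg {s} {l} 0≤s s→l = ≤-from-ε (λ ε 0<ε →
    let N , close = s→l ε 0<ε in begin
      0#                ≤⟨ 0≤s N ⟩
      s N               ≈⟨ solve 2 (λ s l → s := l :+ (s :- l)) refl (s N) l ⟩
      l + (s N - l)     ≤⟨ +-mono ≤-refl (≤-trans (x≤abs _) (close N ℕ.≤-refl)) ⟩
      l + ε             ∎)
    where open ≤R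

  lim-mono : ∀ {s t l k} → (∀ m → s m ≤ t m) → Lim s l → Lim t k → l ≤ k
  lim-mono s≤t s→l t→k = difference-nonneg⇒≤ (lim-nonneg (λ m → 0≤x-y (s≤t m)) (lim-- t→k s→l)) refl

  lim-unique : ∀ {s l k} → Lim s l → Lim s k → l ≈ k
  lim-unique s→l s→k = antisym (lim-mono (λ _ → ≤-refl) s→l s→k) (lim-mono (λ _ → ≤-refl) s→k s→l)

  fromℕ-nonneg : ∀ n → 0# ≤ fromℕ n
  fromℕ-nonneg zero    = ≤-refl
  fromℕ-nonneg (suc n) = +-nonneg 0≤1 (fromℕ-nonneg n)

  fromℕ-suc-pos : ∀ n → 0# < fromℕ (suc n)
  fromℕ-suc-pos n = +-pos-nonneg 0<1 (fromℕ-nonneg n)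

  fromℕ-pos : ∀ {n} → Fin n → 0# < fromℕ n
  fromℕ-pos {suc n} _ = fromℕ-suc-pos n

  fromℕ-mono : ∀ {m n} → m ℕ.≤ n → fromℕ m ≤ fromℕ n
  fromℕ-mono {n = n} z≤n = fromℕ-nonneg n
  fromℕ-mono (s≤s m≤n) = +-mono ≤-refl (fromℕ-mono m≤n)

  approximate-supremum : (S : Pred Carrier 0ℓ) → ∀ {s} → (∀ {b} → UpperBound S b → s ≤ b) →
                         ∀ {ε} → 0# < ε → ∃ λ x → S x × s ≤ x + ε
  approximate-supremum S {s} least {ε} 0<ε = ¬¬-elim λ none →
    let upper : UpperBound S (s - ε)
        upper {x} x∈S = ≮⇒≥ λ s-ε<x → none (x , x∈S , ≤-trans
          (≤-reflexive (solve 2 (λ s ε → s := s :- ε :+ ε) refl s ε)) (+-mono-≤ ε (<⇒≤ s-ε<x)))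
    in <⇒≉ 0<ε (antisym (difference-nonneg⇒≤ (0≤x-y (least upper))
         (solve 2 (λ s ε → :0 :- ε := s :- ε :- s) refl s ε)) (<⇒≤ 0<ε))

  archimedean : ∀ x → ∃ λ n → x ≤ fromℕ n
  archimedean x = ¬¬-elim λ none →
    let bound : UpperBound (λ y → ∃ λ n → y ≈ fromℕ n) x
        bound (n , y≈n) = ≤-trans (≤-reflexive y≈n) (≮⇒≥ λ x<n → none (n , <⇒≤ x<n))
        s , upper , least = supremum (λ y → ∃ λ n → y ≈ fromℕ n) (0# , 0 , refl) (x , bound)
        y , (n , y≈n) , s≤y+h = approximate-supremum (λ y → ∃ λ n → y ≈ fromℕ n) least (half-pos 0<1)
        h = half 1#
        s+h≤s : s + h ≤ s
        s+h≤s = ≤-trans (+-mono-≤ h s≤y+h) (≤-trans (≤-reflexive (trans (+-assoc y h h)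
                  (trans (+-cong y≈n (half+half 1#)) (+-comm _ _)))) (upper (suc n , refl)))
    in x+y≰x (half-pos 0<1) s+h≤s

  1/suc : ℕ → Carrier
  1/suc m = fromℕ (suc m) ⁻¹

  1/suc-pos : ∀ m → 0# < 1/suc m
  1/suc-pos m = ⁻¹-pos (fromℕ-suc-pos m)

  1/suc-null : Null 1/suc
  1/suc-null ε 0<ε = let N , ε⁻¹≤N = archimedean (ε ⁻¹) in N , λ m N≤m → ≤-trans (abs-of-nonneg (<⇒≤ (1/suc-pos m)))
    (*-cancelˡ-≤ (fromℕ-suc-pos m) (begin
      fromℕ (suc m) * 1/suc m ≈⟨ ⁻¹-inverse (<⇒≉ (fromℕ-suc-pos m)) ⟩
      1#                      ≈⟨ ⁻¹-inverse (<⇒≉ 0<ε) ⟨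
      ε * ε ⁻¹                ≈⟨ *-comm _ _ ⟩
      ε ⁻¹ * ε                ≤⟨ *-monoʳ (<⇒≤ 0<ε) (≤-trans ε⁻¹≤N (fromℕ-mono (ℕ.m≤n⇒m≤1+n N≤m))) ⟩
      fromℕ (suc m) * ε       ∎))
    where open ≤R

  lim-from-rate : ∀ {s l} → (∀ m → abs (s m - l) ≤ 1/suc m) → Lim s l
  lim-from-rate rate = null-dominated (λ m → ≤-trans (rate m) (x≤abs _)) 1/suc-null

  supremum-sequence : (S : Pred Carrier 0ℓ) → ∀ {s} → UpperBound S s → (∀ {b} → UpperBound S b → s ≤ b) →
                      ∃ λ x → (∀ m → S (x m)) × Lim x s
  supremum-sequence S {s} upper least =
      (λ m → proj₁ (point m)) , (λ m → proj₁ (proj₂ (point m))) , lim-from-rate λ m →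
        let x , x∈S , s≤x+ε = point m in
        abs-least (≤-trans (+-mono-≤ (- s) (upper x∈S)) (≤-trans (≤-reflexive (-‿inverseʳ s)) (<⇒≤ (1/suc-pos m))))
                  (difference-nonneg⇒≤ (0≤x-y s≤x+ε) (solve 3 (λ x s ε → ε :- :- (x :- s) := x :+ ε :- s)
                       refl x s (1/suc m)))
    where
    point : ∀ m → ∃ λ x → S x × s ≤ x + 1/suc m
    point m = approximate-supremum S least (1/suc-pos m)

  monotone-≤ : ∀ {s : ℕ → Carrier} → (∀ m → s m ≤ s (suc m)) → ∀ {m n} → m ℕ.≤ n → s m ≤ s n
  monotone-≤ {s} step m≤n = go (ℕ.≤⇒≤′ m≤n)
    where
    go : ∀ {m n} → m ℕ.≤′ n → s m ≤ s n
    go ℕ.≤′-refl       = ≤-refl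
    go (ℕ.≤′-step m≤n) = ≤-trans (go m≤n) (step _)

  monotone-convergence : ∀ {s : ℕ → Carrier} {B} → (∀ m → s m ≤ s (suc m)) → (∀ m → s m ≤ B) → ∃ (Lim s)
  monotone-convergence {s} {B} step s≤B = l , s→l
    where
    open ≤R
    Values : Pred Carrier 0ℓ
    Values x = ∃ λ m → x ≈ s m
    sup : ∃ λ l → UpperBound Values l × (∀ {b} → UpperBound Values b → l ≤ b)
    sup = supremum Values (s 0 , 0 , refl) (B , λ (m , x≈sm) → ≤-trans (≤-reflexive x≈sm) (s≤B m))
    l : Carrier
    l = proj₁ sup
    s→l : Lim s l
    s→l ε 0<ε = let x , (N , x≈sN) , l≤x+ε = approximate-supremum Values (proj₂ (proj₂ sup)) 0<ε in N , λ m N≤m → abs-least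
      (≤-trans (+-mono-≤ (- l) (proj₁ (proj₂ sup) (m , refl))) (≤-trans (≤-reflexive (-‿inverseʳ l)) (<⇒≤ 0<ε)))
      (difference-nonneg⇒≤ (0≤x-y (begin
         l            ≤⟨ l≤x+ε ⟩
         x + ε        ≈⟨ +-congʳ x≈sN ⟩
         s N + ε      ≤⟨ +-mono-≤ ε (monotone-≤ step N≤m) ⟩
         s m + ε      ∎)) (solve 3 (λ x l ε → ε :- :- (x :- l) := x :+ ε :- l) refl (s m) l ε))

  -- The root is the supremum s of all y with y² ≤ x. Such y tend to s, so s² ≤ x; the numbers s +
  -- 1/(m + 1) exceed s, so their squares are at least x, and so is the limit s². The set is bounded
  -- by 1 + x because (1 + x)² ≥ x.
  sqrt-exists : ∀ {x} → 0# ≤ x → ∃ λ y → 0# ≤ y × y * y ≈ x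
  sqrt-exists {x} 0≤x = s , upper 0∈S , antisym
      (lim-mono (proj₁ (proj₂ y)) (lim-* y→s y→s) (lim-const x))
      (lim-mono above (lim-const x) (lim-* s+1/m→s s+1/m→s))
    where
    open ≤R
    S : Pred Carrier 0ℓ
    S y = y * y ≤ x
    0∈S : S 0#
    0∈S = ≤-trans (≤-reflexive (zeroˡ 0#)) 0≤x
    bound : UpperBound S (1# + x)
    bound {y} yy≤x = square-cancel-≤ (+-nonneg 0≤1 0≤x) (begin
      y * y                       ≤⟨ yy≤x ⟩
      x                           ≤⟨ x≤x+y (+-nonneg 0≤1 (+-nonneg 0≤x (square-nonneg x))) ⟩
      x + (1# + (x + x * x))      ≈⟨ solve 1 (λ x → x :+ (:1 :+ (x :+ x :* x)) := (:1 :+ x) :* (:1 :+ x)) refl x ⟩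
      (1# + x) * (1# + x)         ∎)
    sup : ∃ λ s → UpperBound S s × (∀ {b} → UpperBound S b → s ≤ b)
    sup = supremum S (0# , 0∈S) (1# + x , λ {y} → bound {y})
    s : Carrier
    s = proj₁ sup
    upper : UpperBound S s
    upper = proj₁ (proj₂ sup)
    y : ∃ λ y → (∀ m → S (y m)) × Lim y s
    y = supremum-sequence S (λ {x} → upper {x}) (proj₂ (proj₂ sup))
    y→s : Lim (proj₁ y) s
    y→s = proj₂ (proj₂ y)
    above : ∀ m → x ≤ (s + 1/suc m) * (s + 1/suc m)
    above m = ≮⇒≥ λ <x →
      x+y≰x (1/suc-pos m) (upper (<⇒≤ <x))
    s+1/m→s : Lim (λ m → s + 1/suc m) s
    s+1/m→s = null-cong (λ m → solve 2 (λ s e → s :+ e :- s := e) refl s (1/suc m)) 1/suc-null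

  ClusterPoint : (ℕ → Carrier) → Carrier → Set
  ClusterPoint x l = ∀ ε → 0# < ε → ∀ N → ∃ λ m → N ℕ.≤ m × abs (x m - l) ≤ ε

  -- The cluster point is the limit superior.
  cluster-point : ∀ {x B} → (∀ m → abs (x m) ≤ B) → ∃ (ClusterPoint x)
  cluster-point {x} {B} bounded = l , cluster
    where
    Frequent : Pred Carrier 0ℓ
    Frequent y = ∀ N → ∃ λ m → N ℕ.≤ m × y ≤ x m
    lower : ∀ m → - B ≤ x m
    lower m = ≤-trans (neg-mono (≤-trans (-x≤abs (x m)) (bounded m))) (≤-reflexive (-‿involutive _))
    below : UpperBound Frequent B
    below y∈ = let m , _ , y≤xm = y∈ 0 in ≤-trans y≤xm (≤-trans (x≤abs _) (bounded m))
    sup : ∃ λ l → UpperBound Frequent l × (∀ {b} → UpperBound Frequent b → l ≤ b)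
    sup = supremum Frequent (- B , λ N → N , ℕ.≤-refl , lower N) (B , λ {y} → below {y})
    l : Carrier
    l = proj₁ sup
    -- Suppose no term from N on lies within ε of l. Some y ≥ l - ε is exceeded infinitely often,
    -- and the terms from N on that exceed it cannot be below l + ε without being within ε of l. So
    -- l + ε is itself exceeded infinitely often, although l is an upper bound of such numbers.
    module _ {ε : Carrier} (0<ε : 0# < ε) {N : ℕ} (none : ¬ ∃ λ m → N ℕ.≤ m × abs (x m - l) ≤ ε) where
      near : ∀ {y m} → l ≤ y + ε → y ≤ x m → x m < l + ε → abs (x m - l) ≤ ε
      near {y} {m} l≤y+ε y≤xm xm<l+ε = abs-least
        (difference-nonneg⇒≤ (0≤x-y (<⇒≤ xm<l+ε)) (solve 3 (λ x l e → e :- (x :- l) := (l :+ e) :- x) refl (x m) l ε))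
        (difference-nonneg⇒≤ (0≤x-y (≤-trans l≤y+ε (+-mono-≤ ε y≤xm)))
          (solve 3 (λ x l e → e :- :- (x :- l) := x :+ e :- l) refl (x m) l ε))
      frequent : Frequent (l + ε)
      frequent N′ =
        let y , y∈ , l≤y+ε = approximate-supremum Frequent (proj₂ (proj₂ sup)) 0<ε
            m , N≤m , y≤xm = y∈ (N ℕ.⊔ N′)
        in m , ℕ.m⊔n≤o⇒n≤o N N′ N≤m ,
           ≮⇒≥ λ xm<l+ε → none (m , ℕ.m⊔n≤o⇒m≤o N N′ N≤m , near l≤y+ε y≤xm xm<l+ε)
    upper : UpperBound Frequent l
    upper = proj₁ (proj₂ sup)
    cluster : ClusterPoint x l
    cluster ε 0<ε N = ¬¬-elim λ none → x+y≰x 0<ε (upper {l + ε} (frequent 0<ε {N} none))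

  -- The index maps need not be increasing: m ≤ φ m is all that limits require.
  bolzano-weierstrass₁ : ∀ {x B} → (∀ m → abs (x m) ≤ B) → ∃ λ φ → (∀ m → m ℕ.≤ φ m) × ∃ (Lim (x ∘ φ))
  bolzano-weierstrass₁ {x} bounded =
      (λ m → proj₁ (close m)) , (λ m → proj₁ (proj₂ (close m))) ,
      proj₁ point , lim-from-rate (λ m → proj₂ (proj₂ (close m)))
    where
    point : ∃ (ClusterPoint x)
    point = cluster-point bounded
    close : ∀ m → ∃ λ k → m ℕ.≤ k × abs (x k - proj₁ point) ≤ 1/suc m
    close m = proj₂ point (1/suc m) (1/suc-pos m) m

  bolzano-weierstrass : ∀ {n} {x : Fin n → ℕ → Carrier} {B} → (∀ j m → abs (x j m) ≤ B) →
    ∃ λ φ → (∀ m → m ℕ.≤ φ m) × ∃ λ (l : Fin n → Carrier) → ∀ j → Lim (x j ∘ φ) (l j)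
  bolzano-weierstrass {zero} bounded = (λ m → m) , (λ m → ℕ.≤-refl) , (λ ()) , (λ ())
  bolzano-weierstrass {suc n} {x} bounded =
    let φ , m≤φm , l₀ , x₀→l₀ = bolzano-weierstrass₁ (bounded zero)
        ψ , m≤ψm , l , x→l = bolzano-weierstrass {n} {λ j → x (suc j) ∘ φ} (λ j m → bounded (suc j) (φ m))
    in φ ∘ ψ , (λ m → ℕ.≤-trans (m≤ψm m) (m≤φm (ψ m))) , (λ { zero → l₀ ; (suc j) → l j }) ,
       (λ { zero → lim-subsequence m≤ψm x₀→l₀ ; (suc j) → x→l j })

  -- The double index serves for the entries of a matrix and, with k = 2, for the real and imaginary
  -- parts of a vector.
  bolzano-weierstrass₂ : ∀ {k n} {x : Fin k → Fin n → ℕ → Carrier} {B} → (∀ i j m → abs (x i j m) ≤ B) →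
    ∃ λ φ → (∀ m → m ℕ.≤ φ m) × ∃ λ (l : Fin k → Fin n → Carrier) → ∀ i j → Lim (x i j ∘ φ) (l i j)
  bolzano-weierstrass₂ {k} {n} {x} bounded =
    let φ , m≤φm , l , x→l = bolzano-weierstrass {k ℕ.* n} {λ r → x (proj₁ (remQuot {k} n r)) (proj₂ (remQuot {k} n r))}
                               (λ r m → bounded (proj₁ (remQuot {k} n r)) (proj₂ (remQuot {k} n r)) m)
    in φ , m≤φm , (λ i j → l (combine i j)) , λ i j →
       ≡.subst (λ p → Lim (x (proj₁ p) (proj₂ p) ∘ φ) (l (combine i j))) (remQuot-combine i j) (x→l (combine i j))

-- Convergence of exponential series and of their products

module RealSeries (em : ExcludedMiddle 0ℓ) (𝓡 : CompleteOrderedField) where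

  open CompleteOrderedField 𝓡 hiding (zero)
  open RingTools commutativeRing hiding (sum)
  open RealLine em 𝓡
  open RealLimits em 𝓡
  open CauchyProduct commutativeRing

  ∑<-mono : ∀ {f : ℕ → Carrier} → (∀ k → 0# ≤ f k) → ∀ N → ∑< f N ≤ ∑< f (suc N)
  ∑<-mono {f} 0≤f N = ≤-trans (x≤x+y (0≤f N)) (≤-reflexive (sym (∑<-suc f N)))

  exponential-nonneg : ∀ {x α} → 0# ≤ x → IsExponential x α → ∀ k → 0# ≤ α k
  exponential-nonneg 0≤x (α₀ , ∂α) zero    = ≤-trans 0≤1 (≤-reflexive (sym α₀))
  exponential-nonneg {x} {α} 0≤x (α₀ , ∂α) (suc k) = *-cancelˡ-≤ (fromℕ-suc-pos k) (begin
      fromℕ (suc k) * 0#         ≈⟨ zeroʳ _ ⟩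
      0#                         ≤⟨ *-nonneg 0≤x (exponential-nonneg 0≤x (α₀ , ∂α) k) ⟩
      x * α k                    ≈⟨ ∂α k ⟨
      fromℕ (suc k) * α (suc k)  ∎)
    where open ≤R

  -- As soon as k ≥ 2x, the sum of the first k terms plus twice the k-th term
  -- decreases.
  exponential-bounded : ∀ {x α} → 0# ≤ x → IsExponential x α → ∃ λ B → ∀ N → ∑< α N ≤ B
  exponential-bounded {x} {α} 0≤x (α₀ , ∂α) = T K , λ N →
      ≤-trans (monotone-≤ (∑<-mono 0≤α) (ℕ.m≤m+n N K)) (≤-trans (x≤x+y (+-nonneg (0≤α (N ℕ.+ K)) (0≤α (N ℕ.+ K)))) (decreasing N))
    where
    open ≤R
    K : ℕ
    K = proj₁ (archimedean (x + x))
    2x≤K : x + x ≤ fromℕ K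
    2x≤K = proj₂ (archimedean (x + x))
    0≤α : ∀ k → 0# ≤ α k
    0≤α = exponential-nonneg 0≤x (α₀ , ∂α)
    T : ℕ → Carrier
    T k = ∑< α k + (α k + α k)
    halving : ∀ k → K ℕ.≤ k → α (suc k) + α (suc k) ≤ α k
    halving k K≤k = *-cancelˡ-≤ (fromℕ-suc-pos k) (begin
      fromℕ (suc k) * (α (suc k) + α (suc k))                       ≈⟨ distribˡ _ _ _ ⟩
      fromℕ (suc k) * α (suc k) + fromℕ (suc k) * α (suc k)         ≈⟨ +-cong (∂α k) (∂α k) ⟩
      x * α k + x * α k                                             ≈⟨ distribʳ _ _ _ ⟨
      (x + x) * α k                                                 ≤⟨ *-monoʳ (0≤α k) (≤-trans 2x≤K (fromℕ-mono (ℕ.m≤n⇒m≤1+n K≤k))) ⟩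
      fromℕ (suc k) * α k                                           ∎)
    decreasing : ∀ j → T (j ℕ.+ K) ≤ T K
    decreasing zero    = ≤-refl
    decreasing (suc j) = begin
      ∑< α (suc k) + (α (suc k) + α (suc k))   ≤⟨ +-mono ≤-refl (halving k (ℕ.m≤n+m K j)) ⟩
      ∑< α (suc k) + α k                       ≈⟨ +-congʳ (∑<-suc α k) ⟩
      ∑< α k + α k + α k                       ≈⟨ +-assoc _ _ _ ⟩
      T k                                      ≤⟨ decreasing j ⟩
      T K                                      ∎
      where
      k : ℕ
      k = j ℕ.+ K

  exponential-converges : ∀ {x α} → 0# ≤ x → IsExponential x α → ∃ (Lim (∑< α))
  exponential-converges 0≤x α-exp =
    monotone-convergence (∑<-mono (exponential-nonneg 0≤x α-exp)) (proj₂ (exponential-bounded 0≤x α-exp))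

  -- The terms a + α are nonnegative and their sums are bounded by twice those of α, so monotone
  -- convergence applies to a + α; subtracting the convergent series of α leaves that of a.
  dominated-converges : ∀ {x α a} → 0# ≤ x → IsExponential x α → (∀ k → abs (a k) ≤ α k) → ∃ (Lim (∑< a))
  dominated-converges {x} {α} {a} 0≤x α-exp a≤α =
    let B , ∑α≤B = exponential-bounded 0≤x α-exp
        l , α→l = exponential-converges 0≤x α-exp
        k , a+α→k = monotone-convergence {∑< (λ k → a k + α k)} {B + B}
          (∑<-mono (λ k → ≤-trans (0≤x-y (≤-trans (-x≤abs (a k)) (a≤α k)))
                            (≤-reflexive (solve 2 (λ a α → α :- :- a := a :+ α) refl (a k) (α k)))))
          (λ N → ≤-trans (≤-reflexive (split N)) (+-mono (≤-trans (a≤α-sum N) (∑α≤B N)) (∑α≤B N)))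
    in k - l , lim-cong (λ N → trans (+-congʳ (split N)) (solve 2 (λ a α → a :+ α :- α := a) refl (∑< a N) (∑< α N)))
                        refl (lim-- a+α→k α→l)
    where
    split : ∀ N → ∑< (λ k → a k + α k) N ≈ ∑< a N + ∑< α N
    split N = ∑-distrib-+ {N} (λ k → a (toℕ k)) (λ k → α (toℕ k))
    a≤α-sum : ∀ N → ∑< a N ≤ ∑< α N
    a≤α-sum N = sum-mono {N} (λ k → ≤-trans (x≤abs (a (toℕ k))) (a≤α (toℕ k)))

  ∑△-nonneg : ∀ {α β : ℕ → Carrier} → (∀ k → 0# ≤ α k) → (∀ k → 0# ≤ β k) → ∀ N → 0# ≤ ∑△ α β N
  ∑△-nonneg 0≤α 0≤β zero    = ≤-refl
  ∑△-nonneg 0≤α 0≤β (suc N) = +-nonneg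
    (*-nonneg (0≤α 0) (sum-nonneg {suc N} (λ k → 0≤β (toℕ k)))) (∑△-nonneg (0≤α ∘ suc) 0≤β N)

  -- The rectangle j < N, k < K lies in the triangle j + k < N + K.
  square≤triangle : ∀ {α β : ℕ → Carrier} → (∀ k → 0# ≤ α k) → (∀ k → 0# ≤ β k) →
                    ∀ N K → ∑< α N * ∑< β K ≤ ∑△ α β (N ℕ.+ K)
  square≤triangle 0≤α 0≤β zero    K = ≤-trans (≤-reflexive (zeroˡ _)) (∑△-nonneg 0≤α 0≤β K)
  square≤triangle {α} {β} 0≤α 0≤β (suc N) K = begin
      (α 0 + ∑< (α ∘ suc) N) * ∑< β K            ≈⟨ distribʳ _ _ _ ⟩
      α 0 * ∑< β K + ∑< (α ∘ suc) N * ∑< β K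
        ≤⟨ +-mono (*-monoˡ (0≤α 0) (monotone-≤ (∑<-mono 0≤β) (ℕ.m≤n+m K (suc N)))) (square≤triangle (0≤α ∘ suc) 0≤β N K) ⟩
      ∑△ α β (suc N ℕ.+ K)                       ∎
    where open ≤R

  -- The square of side N lies between the triangles of sides N and 2N. The triangle sums are the
  -- partial sums of the exponential series for 2x, which converges, so the two triangles differ by
  -- a null sequence.
  triangle-gap-null : ∀ {x α} → 0# ≤ x → IsExponential x α → Null (λ N → ∑< α N * ∑< α N - ∑△ α α N)
  triangle-gap-null {x} {α} 0≤x α-exp =
    let l , △→l = exponential-converges (+-nonneg 0≤x 0≤x) (conv-exponential α-exp α-exp)
        △→l′ = lim-cong (λ N → sym (∑△≈∑<conv α α N)) refl △→l
        gap→0 = lim-- (lim-subsequence {φ = λ N → N ℕ.+ N} (λ N → ℕ.m≤m+n N N) △→l′) △→l′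
    in null-dominated (λ N → ≤-trans (abs-of-nonneg (lower N)) (≤-trans (upper N) (x≤abs _)))
         (null-cong (λ N → solve 2 (λ d l → d := d :- (l :- l)) refl (∑△ α α (N ℕ.+ N) - ∑△ α α N) l) gap→0)
    where
    0≤α : ∀ k → 0# ≤ α k
    0≤α = exponential-nonneg 0≤x α-exp
    -- K is allowed to exceed N because the recursion lowers the number of rows but not their
    -- length.
    △≤□ : ∀ {α β : ℕ → Carrier} → (∀ k → 0# ≤ α k) → (∀ k → 0# ≤ β k) → ∀ N K → N ℕ.≤ K → ∑△ α β N ≤ ∑< α N * ∑< β K
    △≤□ 0≤α 0≤β zero    K N≤K = ≤-reflexive (sym (zeroˡ _))
    △≤□ {α} {β} 0≤α 0≤β (suc N) K N≤K = ≤-trans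
      (+-mono (*-monoˡ (0≤α 0) (monotone-≤ (∑<-mono 0≤β) N≤K)) (△≤□ (0≤α ∘ suc) 0≤β N K (ℕ.<⇒≤ N≤K)))
      (≤-reflexive (sym (distribʳ _ _ _)))
    lower : ∀ N → 0# ≤ ∑< α N * ∑< α N - ∑△ α α N
    lower N = 0≤x-y (△≤□ 0≤α 0≤α N N ℕ.≤-refl)
    upper : ∀ N → ∑< α N * ∑< α N - ∑△ α α N ≤ ∑△ α α (N ℕ.+ N) - ∑△ α α N
    upper N = +-mono-≤ _ (square≤triangle 0≤α 0≤α N N)

-- The spectral theorem for real symmetric matrices

module SpectralTheorem (em : ExcludedMiddle 0ℓ) (𝓡 : CompleteOrderedField) where

  open CompleteOrderedField 𝓡 hiding (zero)
  open RingTools commutativeRing hiding (sum)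
  open RealLine em 𝓡
  open RealLimits em 𝓡

  fromℕ-<⇒≉ : ∀ {m n} → m ℕ.< n → ¬ (fromℕ m ≈ fromℕ n)
  fromℕ-<⇒≉ {m} m<n eq = x+y≰x 0<1 (≤-trans (≤-reflexive (+-comm (fromℕ m) 1#))
    (≤-trans (fromℕ-mono m<n) (≤-reflexive (sym eq))))

  fromℕ-injective : ∀ {m n} → fromℕ m ≈ fromℕ n → m ≡.≡ n
  fromℕ-injective {m} {n} eq with ℕ.<-cmp m n
  ... | tri< m<n _ _ = contradiction eq (fromℕ-<⇒≉ m<n)
  ... | tri≈ _ m≡n _ = m≡n
  ... | tri> _ _ n<m = contradiction (sym eq) (fromℕ-<⇒≉ n<m)

  -- The rows are unit vectors. This is the boundedness that makes the orthogonal matrices compact.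
  orthogonal-entry : ∀ {n} {Q : Matrix n} → Orthogonal Q → ∀ j r → abs (Q j r) ≤ 1#
  orthogonal-entry {n} {Q} (_ , QQᵀ) j r = square-cancel-≤ 0≤1 (begin
      abs (Q j r) * abs (Q j r)      ≈⟨ abs-square (Q j r) ⟩
      Q j r * Q j r                  ≤⟨ term≤sum {n} {λ s → Q j s * Q j s} (λ s → square-nonneg (Q j s)) r ⟩
      sum (λ s → Q j s * Q j s)      ≈⟨ QQᵀ j j ⟩
      δ j j                          ≈⟨ δ-refl j ⟩
      1#                             ≈⟨ *-identityˡ 1# ⟨
      1# * 1#                        ∎)
    where open ≤R

  module _ {n : ℕ} (R : Matrix n) (R-sym : ∀ j k → R j k ≈ R k j) where

    conjugate : Matrix n → Matrix n
    conjugate Q = Q ᵀ ⊗ (R ⊗ Q)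

    w : Fin n → Carrier
    w r = fromℕ (toℕ r)

    -- The weights are pairwise different, so a maximiser of this trace over
    -- the orthogonal matrices has to diagonalise R.
    weightedTrace : Matrix n → Carrier
    weightedTrace Q = sum (λ r → w r * conjugate Q r r)

    conjugate-sym : ∀ Q r s → conjugate Q r s ≈ conjugate Q s r
    conjugate-sym Q r s = begin
      sum (λ j → Q j r * sum (λ k → R j k * Q k s))
        ≈⟨ sum-cong {n} (λ j → *-distribˡ-sum (Q j r) (λ k → R j k * Q k s)) ⟩
      sum (λ j → sum (λ k → Q j r * (R j k * Q k s)))
        ≈⟨ ∑-comm (λ j k → Q j r * (R j k * Q k s)) ⟩
      sum (λ k → sum (λ j → Q j r * (R j k * Q k s)))
        ≈⟨ sum-cong {n} (λ k → sum-cong {n} (λ j → trans (*-congˡ (*-congʳ (R-sym j k)))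
             (solve 3 (λ a b c → a :* (b :* c) := c :* (b :* a)) refl (Q j r) (R k j) (Q k s)))) ⟩
      sum (λ k → sum (λ j → Q k s * (R k j * Q j r)))
        ≈⟨ sum-cong {n} (λ k → sym (*-distribˡ-sum (Q k s) (λ j → R k j * Q j r))) ⟩
      sum (λ k → Q k s * sum (λ j → R k j * Q j r)) ∎
      where open Eq

    bound : Carrier
    bound = sum (λ r → w r * sum (λ j → sum (λ k → abs (R j k))))

    weightedTrace-bounded : ∀ Q → Orthogonal Q → weightedTrace Q ≤ bound
    weightedTrace-bounded Q orth = sum-mono {n} λ r → *-monoˡ (fromℕ-nonneg (toℕ r))
      (sum-mono {n} λ j → begin
        Q j r * sum (λ k → R j k * Q k r)
          ≤⟨ x≤abs _ ⟩
        abs (Q j r * sum (λ k → R j k * Q k r))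
          ≤⟨ abs-* _ _ ⟩
        abs (Q j r) * abs (sum (λ k → R j k * Q k r))
          ≤⟨ *-mono (abs-nonneg _) (sum-nonneg {n} (λ k → abs-nonneg (R j k))) (orthogonal-entry orth j r)
               (≤-trans (abs-sum {n} _) (sum-mono {n} λ k → ≤-trans (abs-* (R j k) (Q k r))
                 (≤-trans (*-monoˡ (abs-nonneg (R j k)) (orthogonal-entry orth k r)) (≤-reflexive (*-identityʳ _))))) ⟩
        1# * sum (λ k → abs (R j k))
          ≈⟨ *-identityˡ _ ⟩
        sum (λ k → abs (R j k)) ∎)
      where open ≤R

    Values : Pred Carrier 0ℓ
    Values x = ∃ λ Q → Orthogonal Q × x ≈ weightedTrace Q

    -- A sequence of orthogonal matrices whose weighted traces tend to the supremum has an entrywise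
    -- convergent subsequence. Orthogonality and the weighted trace are polynomial in the entries,
    -- so the limit is orthogonal and attains the supremum.
    maximiser : ∃ λ Q → Orthogonal Q × (∀ G → Orthogonal G → weightedTrace G ≤ weightedTrace Q)
    maximiser =
      let s , upper , least = supremum Values (weightedTrace δ , δ , Orthogonal-δ , refl)
                                (bound , λ (Q , orth , x≈) → ≤-trans (≤-reflexive x≈) (weightedTrace-bounded Q orth))
          x , x∈ , x→s = supremum-sequence Values (λ {y} → upper {y}) least
          P m = proj₁ (x∈ m)
          orthP m = proj₁ (proj₂ (x∈ m))
          φ , m≤φm , Q , P→Q = bolzano-weierstrass₂ {n} {n} {λ i j m → P m i j} {1#} (λ i j m → orthogonal-entry (orthP m) i j)
          f→fQ = lim-sum {n} (λ r → lim-scale (w r) (lim-sum {n} (λ j → lim-* (P→Q j r)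
                   (lim-sum {n} (λ k → lim-* (lim-const (R j k)) (P→Q k r))))))
          s≈fQ = lim-unique (lim-cong (λ m → proj₂ (proj₂ (x∈ (φ m)))) refl (lim-subsequence m≤φm x→s)) f→fQ
      in Q ,
         ((λ r s → lim-unique (lim-sum {n} (λ j → lim-* (P→Q j r) (P→Q j s)))
                     (lim-cong (λ m → sym (proj₁ (orthP (φ m)) r s)) refl (lim-const (δ r s)))) ,
          (λ r s → lim-unique (lim-sum {n} (λ j → lim-* (P→Q r j) (P→Q s j)))
                     (lim-cong (λ m → sym (proj₂ (orthP (φ m)) r s)) refl (lim-const (δ r s))))) ,
         λ G orthG → ≤-trans (upper (G , orthG , refl)) (≤-reflexive s≈fQ)

    module _ (Q : Matrix n) (orthQ : Orthogonal Q)
             (maximal : ∀ G → Orthogonal G → weightedTrace G ≤ weightedTrace Q) where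

      -- Reflecting in K e_p + β e_q changes the trace by 4 K P β² / N², and K is
      -- chosen large enough for P to be positive.
      off-diagonal : ∀ {p q} → p ≡.≢ q → conjugate Q p q ≈ 0#
      off-diagonal {p} {q} p≢q = no-zero-divisors Δ≉0 (square≈0 (antisym ββ≤0 (square-nonneg β)))
        where
        Δ b β e K N κ P : Carrier
        Δ = w p - w q
        b = conjugate Q p q
        -- By `sum-diagonal-conjugate`, the increment is a positive multiple of Δ K β ((K² - β²) b -
        -- K β D), where D is the difference of the diagonal entries. Taking β = Δ b turns it into K
        -- β² (K² - β² - K e) with e = Δ D, so the signs of Δ and b no longer matter.
        β = Δ * b
        e = Δ * (conjugate Q p p - conjugate Q q q)
        -- Now K - e ≥ 1 + β² and K ≥ 1, so P = K (K - e) - β² ≥ 1.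
        K = 1# + β * β + abs e
        N = K * K + β * β
        κ = N ⁻¹ * 2#
        P = K * K - β * β - K * e

        Δ≉0 : ¬ (Δ ≈ 0#)
        Δ≉0 Δ≈0 = p≢q (toℕ-injective (fromℕ-injective (begin
          w p               ≈⟨ solve 2 (λ x y → x := x :- y :+ y) refl (w p) (w q) ⟩
          w p - w q + w q   ≈⟨ +-congʳ Δ≈0 ⟩
          0# + w q          ≈⟨ +-identityˡ _ ⟩
          w q               ∎)))
          where open Eq

        0<K : 0# < K
        0<K = +-pos-nonneg (+-pos-nonneg 0<1 (square-nonneg β)) (abs-nonneg e)

        0<N : 0# < N
        0<N = +-pos-nonneg (*-pos 0<K 0<K) (square-nonneg β)

        0<P : 0# < P
        0<P = <-≤-trans 0<1 (difference-nonneg⇒≤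
          (+-nonneg (+-nonneg (+-nonneg 0≤s (*-nonneg 0≤s 0≤s)) (*-nonneg 0≤h (<⇒≤ 0<K)))
                    (*-nonneg (abs-nonneg e) (+-nonneg 0≤1 0≤s)))
          (solve 3 (λ s a e → let K = :1 :+ s :+ a in
             K :* K :- s :- K :* e :- :1 := s :+ s :* s :+ (a :- e) :* K :+ a :* (:1 :+ s)) refl (β * β) (abs e) e))
          where
          0≤s : 0# ≤ β * β
          0≤s = square-nonneg β
          0≤h : 0# ≤ abs e - e
          0≤h = 0≤x-y (x≤abs e)

        κ-norm : κ * N ≈ 1# + 1#
        κ-norm = begin
          N ⁻¹ * 2# * N    ≈⟨ solve 3 (λ i t N → i :* t :* N := N :* i :* t) refl (N ⁻¹) 2# N ⟩
          N * N ⁻¹ * 2#    ≈⟨ *-congʳ (⁻¹-inverse (<⇒≉ 0<N)) ⟩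
          1# * 2#          ≈⟨ *-identityˡ 2# ⟩
          2#               ∎
          where open Eq

        open Reflection p≢q K β κ κ-norm

        conjugate-⊗ : conjugate (Q ⊗ reflection) ≈ₘ reflection ⊗ conjugate Q ⊗ reflection
        conjugate-⊗ =
          ≈ₘ-trans (⊗-congˡ ((Q ⊗ G) ᵀ) (≈ₘ-sym (⊗-assoc R Q G)))
          (≈ₘ-trans (≈ₘ-sym (⊗-assoc ((Q ⊗ G) ᵀ) (R ⊗ Q) G))
          (⊗-congʳ G (≈ₘ-trans (⊗-congʳ (R ⊗ Q) (≈ₘ-trans (ᵀ-⊗ Q G) (⊗-congʳ (Q ᵀ) (λ j k → reflection-sym k j))))
                              (⊗-assoc G (Q ᵀ) (R ⊗ Q)))))
          where
          G : Matrix n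
          G = reflection

        increment : N * N * (weightedTrace (Q ⊗ reflection) - weightedTrace Q) ≈ 2# * 2# * K * P * (β * β)
        increment = begin
          N * N * (weightedTrace (Q ⊗ reflection) - weightedTrace Q)
            ≈⟨ *-congˡ (+-congʳ (sum-cong {n} (λ r → *-congˡ (conjugate-⊗ r r)))) ⟩
          N * N * (sum (λ r → w r * (reflection ⊗ conjugate Q ⊗ reflection) r r) - weightedTrace Q)
            ≈⟨ sum-diagonal-conjugate w (conjugate Q) (conjugate-sym Q) ⟩
          2# * 2# * Δ * (K * β) * ((K * K - β * β) * b - K * β * D)
            ≈⟨ solve 6 (λ t Δ K β b D → t :* t :* Δ :* (K :* β) :* ((K :* K :- β :* β) :* b :- K :* β :* D)
                 := t :* t :* (K :* β) :* ((K :* K :- β :* β) :* (Δ :* b) :- K :* β :* (Δ :* D))) refl 2# Δ K β b D ⟩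
          2# * 2# * (K * β) * ((K * K - β * β) * β - K * β * e)
            ≈⟨ solve 4 (λ t K β e → t :* t :* (K :* β) :* ((K :* K :- β :* β) :* β :- K :* β :* e)
                 := t :* t :* K :* (K :* K :- β :* β :- K :* e) :* (β :* β)) refl 2# K β e ⟩
          2# * 2# * K * P * (β * β) ∎
          where
          open Eq
          D : Carrier
          D = conjugate Q p p - conjugate Q q q

        ββ≤0 : β * β ≤ 0#
        ββ≤0 = *-cancelˡ-≤ (*-pos (*-pos (*-pos 0<2 0<2) 0<K) 0<P) (begin
          2# * 2# * K * P * (β * β)
            ≈⟨ increment ⟨
          N * N * (weightedTrace (Q ⊗ reflection) - weightedTrace Q)
            ≤⟨ *-monoˡ (square-nonneg N)
               (+-mono-≤ (- weightedTrace Q) (maximal _ (Orthogonal-⊗ {n} {Q} {reflection} orthQ Orthogonal-reflection))) ⟩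
          N * N * (weightedTrace Q - weightedTrace Q)
            ≈⟨ solve 3 (λ N f c → N :* N :* (f :- f) := c :* :0) refl N (weightedTrace Q) (2# * 2# * K * P) ⟩
          2# * 2# * K * P * 0# ∎)
          where open ≤R

      -- R Q = Q (QᵀRQ) because Q Qᵀ is the identity, and the matrix in parentheses is diagonal.
      eigencolumns : ∀ j r → (R ⊗ Q) j r ≈ conjugate Q r r * Q j r
      eigencolumns j r = begin
        (R ⊗ Q) j r                      ≈⟨ ⊗-identityˡ (R ⊗ Q) j r ⟨
        (δ ⊗ (R ⊗ Q)) j r                ≈⟨ ⊗-congʳ (R ⊗ Q) (≈ₘ-sym (proj₂ orthQ)) j r ⟩
        (Q ⊗ Q ᵀ ⊗ (R ⊗ Q)) j r          ≈⟨ ⊗-assoc Q (Q ᵀ) (R ⊗ Q) j r ⟩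
        sum (λ s → Q j s * conjugate Q s r)
          ≈⟨ sum-cong {n} (λ s → trans (*-congˡ (diagonal s))
               (solve 3 (λ a b d → a :* (b :* d) := b :* a :* d) refl (Q j s) (conjugate Q r r) (δ s r))) ⟩
        sum (λ s → conjugate Q r r * Q j s * δ s r)
          ≈⟨ sum-δʳ r (λ s → conjugate Q r r * Q j s) ⟩
        conjugate Q r r * Q j r ∎
        where
        open Eq
        diagonal : ∀ s → conjugate Q s r ≈ conjugate Q r r * δ s r
        diagonal s with s ≟ r
        ... | yes ≡.refl = sym (trans (*-congˡ (δ-refl r)) (*-identityʳ _))
        ... | no  s≢r    = trans (off-diagonal s≢r) (sym (trans (*-congˡ (δ-≢ s≢r)) (zeroʳ _)))

    spectral-theorem : ∃₂ λ (Q : Matrix n) (θ : Fin n → Carrier) → Orthogonal Q × (∀ j r → (R ⊗ Q) j r ≈ θ r * Q j r)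
    spectral-theorem =
      let Q , orthQ , maximal = maximiser
      in Q , (λ r → conjugate Q r r) , orthQ , eigencolumns Q orthQ maximal

-- Complex numbers, norms and componentwise limits

module ComplexNumbers (em : ExcludedMiddle 0ℓ) (𝓡 : CompleteOrderedField) where

  open Mixing em 𝓡
  open RealLine em 𝓡
  open RealLimits em 𝓡
  module ℝ′ = RingTools ℝ.commutativeRing
  open ℝ′ using (solve; _:=_; _:+_; _:*_; _:-_; :-_; :0; :1)

  ℂ-commutativeRing : CommutativeRing 0ℓ 0ℓ
  ℂ-commutativeRing = record
    { Carrier = ℂ ; _≈_ = _≈_ ; _+_ = _+_ ; _*_ = _*_ ; -_ = -_ ; 0# = 0ᶜ ; 1# = 1ᶜ
    ; isCommutativeRing = record
      { isRing = record
        { +-isAbelianGroup = record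
          { isGroup = record
            { isMonoid = record
              { isSemigroup = record
                { isMagma = record
                  { isEquivalence = record
                    { refl  = ℝ.refl , ℝ.refl
                    ; sym   = λ (p , q) → ℝ.sym p , ℝ.sym q
                    ; trans = λ (p , q) (p′ , q′) → ℝ.trans p p′ , ℝ.trans q q′ }
                  ; ∙-cong = λ (p , q) (p′ , q′) → ℝ.+-cong p p′ , ℝ.+-cong q q′ }
                ; assoc = λ _ _ _ → ℝ.+-assoc _ _ _ , ℝ.+-assoc _ _ _ }
              ; identity = (λ _ → ℝ.+-identityˡ _ , ℝ.+-identityˡ _) , (λ _ → ℝ.+-identityʳ _ , ℝ.+-identityʳ _) }
            ; inverse = (λ _ → ℝ.-‿inverseˡ _ , ℝ.-‿inverseˡ _) , (λ _ → ℝ.-‿inverseʳ _ , ℝ.-‿inverseʳ _)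
            ; ⁻¹-cong = λ (p , q) → ℝ.-‿cong p , ℝ.-‿cong q }
          ; comm = λ _ _ → ℝ.+-comm _ _ , ℝ.+-comm _ _ }
        ; *-cong = λ (p , q) (p′ , q′) → ℝ.+-cong (ℝ.*-cong p p′) (ℝ.-‿cong (ℝ.*-cong q q′)) ,
                                        ℝ.+-cong (ℝ.*-cong p q′) (ℝ.*-cong q p′)
        ; *-assoc = λ (a +i b) (c +i d) (e +i f) →
            solve 6 (λ a b c d e f → (a :* c :- b :* d) :* e :- (a :* d :+ b :* c) :* f
                                  := a :* (c :* e :- d :* f) :- b :* (c :* f :+ d :* e)) ℝ.refl a b c d e f ,
            solve 6 (λ a b c d e f → (a :* c :- b :* d) :* f :+ (a :* d :+ b :* c) :* e
                                  := a :* (c :* f :+ d :* e) :+ b :* (c :* e :- d :* f)) ℝ.refl a b c d e f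
        ; *-identity =
            (λ (a +i b) → solve 2 (λ a b → :1 :* a :- :0 :* b := a) ℝ.refl a b ,
                          solve 2 (λ a b → :1 :* b :+ :0 :* a := b) ℝ.refl a b) ,
            (λ (a +i b) → solve 2 (λ a b → a :* :1 :- b :* :0 := a) ℝ.refl a b ,
                          solve 2 (λ a b → a :* :0 :+ b :* :1 := b) ℝ.refl a b)
        ; distrib =
            (λ (a +i b) (c +i d) (e +i f) →
              solve 6 (λ a b c d e f → a :* (c :+ e) :- b :* (d :+ f) := (a :* c :- b :* d) :+ (a :* e :- b :* f))
                   ℝ.refl a b c d e f ,
              solve 6 (λ a b c d e f → a :* (d :+ f) :+ b :* (c :+ e) := (a :* d :+ b :* c) :+ (a :* f :+ b :* e))
                   ℝ.refl a b c d e f) ,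
            (λ (a +i b) (c +i d) (e +i f) →
              solve 6 (λ a b c d e f → (c :+ e) :* a :- (d :+ f) :* b := (c :* a :- d :* b) :+ (e :* a :- f :* b))
                   ℝ.refl a b c d e f ,
              solve 6 (λ a b c d e f → (c :+ e) :* b :+ (d :+ f) :* a := (c :* b :+ d :* a) :+ (e :* b :+ f :* a))
                   ℝ.refl a b c d e f) }
      ; *-comm = λ (a +i b) (c +i d) →
          solve 4 (λ a b c d → a :* c :- b :* d := c :* a :- d :* b) ℝ.refl a b c d ,
          solve 4 (λ a b c d → a :* d :+ b :* c := c :* b :+ d :* a) ℝ.refl a b c d } }

  module ℂR = CommutativeRing ℂ-commutativeRing
  module ℂ′ = RingTools ℂ-commutativeRing

  ⟦⟧-cong : ∀ {x y} → x ℝ.≈ y → ⟦ x ⟧ ≈ ⟦ y ⟧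
  ⟦⟧-cong x≈y = x≈y , ℝ.refl

  ⟦⟧-+ : ∀ x y → ⟦ x ℝ.+ y ⟧ ≈ ⟦ x ⟧ + ⟦ y ⟧
  ⟦⟧-+ x y = ℝ.refl , ℝ.sym (ℝ.+-identityˡ ℝ.0#)

  ⟦⟧-* : ∀ x y → ⟦ x ℝ.* y ⟧ ≈ ⟦ x ⟧ * ⟦ y ⟧
  ⟦⟧-* x y = solve 2 (λ x y → x :* y := x :* y :- :0 :* :0) ℝ.refl x y ,
             solve 2 (λ x y → :0 := x :* :0 :+ :0 :* y) ℝ.refl x y

  ⟦⟧-sum : ∀ {n} (f : Fin n → ℝ) → ⟦ ℝ.sum f ⟧ ≈ sum (λ j → ⟦ f j ⟧)
  ⟦⟧-sum {zero}  f = ℂR.refl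
  ⟦⟧-sum {suc n} f = ℂR.trans (⟦⟧-+ _ _) (ℂR.+-congˡ (⟦⟧-sum (λ j → f (suc j))))

  re-sum : ∀ {n} (f : Fin n → ℂ) → re (sum f) ℝ.≈ ℝ.sum (λ j → re (f j))
  re-sum {zero}  f = ℝ.refl
  re-sum {suc n} f = ℝ.+-congˡ (re-sum (λ j → f (suc j)))

  im-sum : ∀ {n} (f : Fin n → ℂ) → im (sum f) ℝ.≈ ℝ.sum (λ j → im (f j))
  im-sum {zero}  f = ℝ.refl
  im-sum {suc n} f = ℝ.+-congˡ (im-sum (λ j → f (suc j)))

  conj-cong : ∀ {z w} → z ≈ w → conj z ≈ conj w
  conj-cong (p , q) = p , ℝ.-‿cong q

  conj-⟦⟧ : ∀ x → conj ⟦ x ⟧ ≈ ⟦ x ⟧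
  conj-⟦⟧ x = ℝ.refl , ℝ′.-0#≈0#

  conj-+ : ∀ z w → conj (z + w) ≈ conj z + conj w
  conj-+ z w = ℝ.refl , ℝ.sym (ℝ′.-‿+-comm (im z) (im w))

  conj-* : ∀ z w → conj (z * w) ≈ conj z * conj w
  conj-* (a +i b) (c +i d) = solve 4 (λ a b c d → a :* c :- b :* d := a :* c :- (:- b) :* (:- d)) ℝ.refl a b c d ,
                             solve 4 (λ a b c d → :- (a :* d :+ b :* c) := a :* (:- d) :+ (:- b) :* c) ℝ.refl a b c d

  conj-sum : ∀ {n} (f : Fin n → ℂ) → conj (sum f) ≈ sum (λ j → conj (f j))
  conj-sum {zero}  f = conj-⟦⟧ ℝ.0#
  conj-sum {suc n} f = ℂR.trans (conj-+ _ _) (ℂR.+-congˡ (conj-sum (λ j → f (suc j))))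

  *-conj : ∀ z → z * conj z ≈ ⟦ ∣ z ∣² ⟧
  *-conj (a +i b) = solve 2 (λ a b → a :* a :- b :* (:- b) := a :* a :+ b :* b) ℝ.refl a b ,
                    solve 2 (λ a b → a :* (:- b) :+ b :* a := :0) ℝ.refl a b

  ∣∣²-cong : ∀ {z w} → z ≈ w → ∣ z ∣² ℝ.≈ ∣ w ∣²
  ∣∣²-cong (p , q) = ℝ.+-cong (ℝ.*-cong p p) (ℝ.*-cong q q)

  ∣∣²-* : ∀ z w → ∣ z * w ∣² ℝ.≈ ∣ z ∣² ℝ.* ∣ w ∣²
  ∣∣²-* (a +i b) (c +i d) = solve 4 (λ a b c d →
    (a :* c :- b :* d) :* (a :* c :- b :* d) :+ (a :* d :+ b :* c) :* (a :* d :+ b :* c)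
    := (a :* a :+ b :* b) :* (c :* c :+ d :* d)) ℝ.refl a b c d

  ∣⟦⟧∣² : ∀ x → ∣ ⟦ x ⟧ ∣² ℝ.≈ x ℝ.* x
  ∣⟦⟧∣² x = solve 1 (λ x → x :* x :+ :0 :* :0 := x :* x) ℝ.refl x

  ∣∣²-nonneg : ∀ z → ℝ.0# ≤ ∣ z ∣²
  ∣∣²-nonneg z = +-nonneg (square-nonneg (re z)) (square-nonneg (im z))

  ∣∣²≈0 : ∀ {z} → ∣ z ∣² ℝ.≈ ℝ.0# → z ≈ 0ᶜ
  ∣∣²≈0 {z} ∣z∣²≈0 =
    square≈0 (antisym (≤-trans (x≤x+y (square-nonneg (im z))) (≤-reflexive ∣z∣²≈0)) (square-nonneg (re z))) ,
    square≈0 (antisym (≤-trans (x≤y+x (square-nonneg (re z))) (≤-reflexive ∣z∣²≈0)) (square-nonneg (im z)))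

  inverseᶜ : ℂ → ℂ
  inverseᶜ z = ⟦ ∣ z ∣² ℝ.⁻¹ ⟧ * conj z

  inverseᶜ-inverse : ∀ {z} → ¬ (z ≈ 0ᶜ) → z * inverseᶜ z ≈ 1ᶜ
  inverseᶜ-inverse {z} z≉0 = begin
    z * (⟦ x ℝ.⁻¹ ⟧ * conj z)  ≈⟨ ℂ′.solve 3 (λ z i c → z ℂ′.:* (i ℂ′.:* c) ℂ′.:= z ℂ′.:* c ℂ′.:* i)
         ℂR.refl z ⟦ x ℝ.⁻¹ ⟧ (conj z) ⟩
    z * conj z * ⟦ x ℝ.⁻¹ ⟧    ≈⟨ ℂR.*-congʳ (*-conj z) ⟩
    ⟦ x ⟧ * ⟦ x ℝ.⁻¹ ⟧         ≈⟨ ⟦⟧-* x (x ℝ.⁻¹) ⟨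
    ⟦ x ℝ.* x ℝ.⁻¹ ⟧           ≈⟨ ⟦⟧-cong (ℝ.⁻¹-inverse (λ x≈0 → z≉0 (∣∣²≈0 x≈0))) ⟩
    1ᶜ                         ∎
    where
    open ℂ′.Eq
    x : ℝ
    x = ∣ z ∣²

  no-zero-divisorsᶜ : ∀ {z w} → ¬ (z ≈ 0ᶜ) → z * w ≈ 0ᶜ → w ≈ 0ᶜ
  no-zero-divisorsᶜ {z} {w} z≉0 zw≈0 = ∣∣²≈0 (no-zero-divisors (λ ∣z∣²≈0 → z≉0 (∣∣²≈0 ∣z∣²≈0))
    (ℝ.trans (ℝ.sym (∣∣²-* z w)) (ℝ.trans (∣∣²-cong zw≈0) (solve 0 (:0 :* :0 :+ :0 :* :0 := :0) ℝ.refl))))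

  -- The taxicab norm: submultiplicative, free of square roots, and equivalent to the modulus. It
  -- carries all estimates for complex series.
  ∣_∣₁ : ℂ → ℝ
  ∣ z ∣₁ = abs (re z) ℝ.+ abs (im z)

  ∣∣₁-nonneg : ∀ z → ℝ.0# ≤ ∣ z ∣₁
  ∣∣₁-nonneg z = +-nonneg (abs-nonneg (re z)) (abs-nonneg (im z))

  ∣∣₁-cong-≤ : ∀ {z w} → z ≈ w → ∣ z ∣₁ ≤ ∣ w ∣₁
  ∣∣₁-cong-≤ (p , q) = +-mono (abs-cong-≤ p) (abs-cong-≤ q)

  ∣∣₁-+ : ∀ z w → ∣ z + w ∣₁ ≤ ∣ z ∣₁ ℝ.+ ∣ w ∣₁
  ∣∣₁-+ z w = ≤-trans (+-mono (abs-+ (re z) (re w)) (abs-+ (im z) (im w)))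
    (≤-reflexive (solve 4 (λ a c b d → (a :+ c) :+ (b :+ d) := (a :+ b) :+ (c :+ d)) ℝ.refl _ _ _ _))

  ∣∣₁-* : ∀ z w → ∣ z * w ∣₁ ≤ ∣ z ∣₁ ℝ.* ∣ w ∣₁
  ∣∣₁-* z w = ≤-trans
    (+-mono (≤-trans (abs-+ _ _) (+-mono (abs-* a c) (≤-trans (abs-neg _) (abs-* b d))))
            (≤-trans (abs-+ _ _) (+-mono (abs-* a d) (abs-* b c))))
    (≤-reflexive (solve 4 (λ a b c d → (a :* c :+ b :* d) :+ (a :* d :+ b :* c) := (a :+ b) :* (c :+ d))
         ℝ.refl (abs a) (abs b) (abs c) (abs d)))
    where
    a b c d : ℝ
    a = re z
    b = im z
    c = re w
    d = im w

  -- The only access to `√`, `lim` and `E`: once some witness is known, the chosen element satisfies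
  -- the predicate, whichever witness excluded middle returned.
  choose-satisfies : {A : Set} (d : A) {P : A → Set} → ∃ P → P (choose d P)
  choose-satisfies d {P} ∃P with em {∃ P}
  ... | yes (_ , p) = p
  ... | no  ∄P      = contradiction ∃P ∄P

  √-spec : ∀ {x} → ℝ.0# ≤ x → ℝ.0# ≤ √ x × √ x ℝ.* √ x ℝ.≈ x
  √-spec 0≤x = choose-satisfies ℝ.0# (sqrt-exists 0≤x)

  √-≤ : ∀ {x b} → ℝ.0# ≤ x → ℝ.0# ≤ b → x ≤ b ℝ.* b → √ x ≤ b
  √-≤ 0≤x 0≤b x≤bb = square-cancel-≤ 0≤b (≤-trans (≤-reflexive (proj₂ (√-spec 0≤x))) x≤bb)

  ≤-√ : ∀ {x a} → ℝ.0# ≤ x → a ℝ.* a ≤ x → abs a ≤ √ x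
  ≤-√ {x} {a} 0≤x aa≤x = square-cancel-≤ (proj₁ (√-spec 0≤x))
    (≤-trans (≤-reflexive (abs-square a)) (≤-trans aa≤x (≤-reflexive (ℝ.sym (proj₂ (√-spec 0≤x))))))

  ∣∣≤∣∣₁ : ∀ z → ∣ z ∣² ≤ ∣ z ∣₁ ℝ.* ∣ z ∣₁
  ∣∣≤∣∣₁ z = begin
    re z ℝ.* re z ℝ.+ im z ℝ.* im z   ≈⟨ ℝ.+-cong (abs-square (re z)) (abs-square (im z)) ⟨
    a ℝ.* a ℝ.+ b ℝ.* b               ≤⟨ x≤x+y (+-nonneg ab ab) ⟩
    a ℝ.* a ℝ.+ b ℝ.* b ℝ.+ (a ℝ.* b ℝ.+ a ℝ.* b)
      ≈⟨ solve 2 (λ a b → a :* a :+ b :* b :+ (a :* b :+ a :* b) := (a :+ b) :* (a :+ b)) ℝ.refl a b ⟩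
    (a ℝ.+ b) ℝ.* (a ℝ.+ b)           ∎
    where
    open ≤R
    a b : ℝ
    a = abs (re z)
    b = abs (im z)
    ab : ℝ.0# ≤ a ℝ.* b
    ab = ℝ.*-nonneg (abs-nonneg _) (abs-nonneg _)

  ∣∣≈1⇒∣∣²≈1 : ∀ {z} → ∣ z ∣ ℝ.≈ ℝ.1# → ∣ z ∣² ℝ.≈ ℝ.1#
  ∣∣≈1⇒∣∣²≈1 {z} ∣z∣≈1 = ℝ.trans (ℝ.sym (proj₂ (√-spec (∣∣²-nonneg z))))
    (ℝ.trans (ℝ.*-cong ∣z∣≈1 ∣z∣≈1) (ℝ.*-identityˡ ℝ.1#))

  ∣∣²≈1⇒∣∣≈1 : ∀ {z} → ∣ z ∣² ℝ.≈ ℝ.1# → ∣ z ∣ ℝ.≈ ℝ.1#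
  ∣∣²≈1⇒∣∣≈1 {z} ∣z∣²≈1 = antisym
    (√-≤ (∣∣²-nonneg z) 0≤1 (≤-reflexive (ℝ.trans ∣z∣²≈1 (ℝ.sym (ℝ.*-identityˡ ℝ.1#)))))
    (≤-trans (x≤abs ℝ.1#) (≤-√ (∣∣²-nonneg z) (≤-reflexive (ℝ.trans (ℝ.*-identityˡ ℝ.1#) (ℝ.sym ∣z∣²≈1)))))

  infix 4 _⇝_

  -- Componentwise convergence, to which the real limit laws apply directly. It is equivalent to
  -- convergence in modulus by `⟶⇒⇝` and `⇝⇒⟶`.
  _⇝_ : (ℕ → ℂ) → ℂ → Set
  s ⇝ l = Lim (λ m → re (s m)) (re l) × Lim (λ m → im (s m)) (im l)

  ⇝-cong : ∀ {s t l k} → (∀ m → s m ≈ t m) → l ≈ k → s ⇝ l → t ⇝ k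
  ⇝-cong s≈t (p , q) (s→l , s→l′) =
    lim-cong (λ m → proj₁ (s≈t m)) p s→l , lim-cong (λ m → proj₂ (s≈t m)) q s→l′

  ⇝-const : ∀ z → (λ _ → z) ⇝ z
  ⇝-const z = lim-const (re z) , lim-const (im z)

  ⇝-* : ∀ {s t l k} → s ⇝ l → t ⇝ k → (λ m → s m * t m) ⇝ (l * k)
  ⇝-* (a , b) (c , d) = lim-- (lim-* a c) (lim-* b d) , lim-+ (lim-* a d) (lim-* b c)

  ⇝-sum : ∀ {n} {s : Fin n → ℕ → ℂ} {l : Fin n → ℂ} → (∀ j → s j ⇝ l j) → (λ m → sum (λ j → s j m)) ⇝ sum l
  ⇝-sum {n} {s} {l} s→l =
    lim-cong (λ m → ℝ.sym (re-sum (λ j → s j m))) (ℝ.sym (re-sum l)) (lim-sum {n} (λ j → proj₁ (s→l j))) ,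
    lim-cong (λ m → ℝ.sym (im-sum (λ j → s j m))) (ℝ.sym (im-sum l)) (lim-sum {n} (λ j → proj₂ (s→l j)))

  ⇝-unique : ∀ {s l k} → s ⇝ l → s ⇝ k → l ≈ k
  ⇝-unique (a , b) (c , d) = lim-unique a c , lim-unique b d

  ⇝-∣∣² : ∀ {s l} → s ⇝ l → Lim (λ m → ∣ s m ∣²) ∣ l ∣²
  ⇝-∣∣² (a , b) = lim-+ (lim-* a a) (lim-* b b)

  null-abs : ∀ {s} → Null s → Null (λ m → abs (s m))
  null-abs = null-dominated (λ m → abs-of-nonneg (abs-nonneg _))

  x-0≈x : ∀ x → x ℝ.- ℝ.0# ℝ.≈ x
  x-0≈x = solve 1 (λ x → x :- :0 := x) ℝ.refl

  lim0⇒null : ∀ {s} → Lim s ℝ.0# → Null s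
  lim0⇒null {s} = null-cong (λ m → ℝ.sym (x-0≈x (s m)))

  null⇒lim0 : ∀ {s} → Null s → Lim s ℝ.0#
  null⇒lim0 {s} = null-cong (λ m → x-0≈x (s m))

  null-∣∣₁ : ∀ {s} → s ⇝ 0ᶜ → Null (λ m → ∣ s m ∣₁)
  null-∣∣₁ (a , b) = null-+ (null-abs (lim0⇒null a)) (null-abs (lim0⇒null b))

  ⇝-null : ∀ {s l} → s ⇝ l → (λ m → s m - l) ⇝ 0ᶜ
  ⇝-null (a , b) = null⇒lim0 a , null⇒lim0 b

  half< : ∀ {ε} → ℝ.0# < ε → half ε < ε
  half< {ε} 0<ε = ≤-trans (x≤x+y (<⇒≤ (half-pos 0<ε))) (≤-reflexive (half+half ε)) ,
    λ h≈ε → <⇒≉ (half-pos 0<ε) (x≈x+y⇒y≈0 (ℝ.trans h≈ε (ℝ.sym (half+half ε))))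

  module _ {n : ℕ} where

    ‖‖²-nonneg : ∀ (v : Vec n) → ℝ.0# ≤ ℝ.sum (λ j → ∣ v j ∣²)
    ‖‖²-nonneg v = sum-nonneg {n} (λ j → ∣∣²-nonneg (v j))

    ‖‖≤sum : ∀ (v : Vec n) → ‖ v ‖ ≤ ℝ.sum (λ j → ∣ v j ∣₁)
    ‖‖≤sum v = √-≤ (‖‖²-nonneg v) (sum-nonneg {n} (λ j → ∣∣₁-nonneg (v j)))
      (≤-trans (sum-mono {n} (λ j → ∣∣≤∣∣₁ (v j))) (sum-squares≤square-sum {n} (λ j → ∣∣₁-nonneg (v j))))

    re≤‖‖ : ∀ (v : Vec n) j → abs (re (v j)) ≤ ‖ v ‖
    re≤‖‖ v j = ≤-√ (‖‖²-nonneg v) (≤-trans (x≤x+y (square-nonneg (im (v j)))) (term≤sum {n} (λ j → ∣∣²-nonneg (v j)) j))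

    im≤‖‖ : ∀ (v : Vec n) j → abs (im (v j)) ≤ ‖ v ‖
    im≤‖‖ v j = ≤-√ (‖‖²-nonneg v) (≤-trans (x≤y+x (square-nonneg (re (v j)))) (term≤sum {n} (λ j → ∣∣²-nonneg (v j)) j))

    ‖‖-small : {v : ℕ → Vec n} → (∀ j → (λ m → v m j) ⇝ 0ᶜ) →
               ∀ ε → ℝ.0# < ε → ∃ λ N → ∀ m → N ℕ.≤ m → ‖ v m ‖ < ε
    ‖‖-small {v} v→0 ε 0<ε =
      let N , small = lim0⇒null (lim-cong (λ m → ℝ.refl) (ℝ′.sum-zero {n} λ j → ℝ.refl)
                        (lim-sum {n} {λ j m → ∣ v m j ∣₁} {λ _ → ℝ.0#} (λ j → null⇒lim0 (null-∣∣₁ (v→0 j)))))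
                        (half ε) (half-pos 0<ε)
      in N , λ m N≤m → ≤-<-trans (≤-trans (‖‖≤sum (v m)) (≤-trans (x≤abs _) (small m N≤m))) (half< 0<ε)

    ⟶ᵛ⇒⇝ : {s : ℕ → Vec n} {l : Vec n} → s ⟶ᵛ l → ∀ j → (λ m → s m j) ⇝ l j
    ⟶ᵛ⇒⇝ {s} {l} s→l j =
      (λ ε 0<ε → let N , close = s→l ε 0<ε in N , λ m N≤m → ≤-trans (re≤‖‖ (s m -ᵛ l) j) (<⇒≤ (close m N≤m))) ,
      (λ ε 0<ε → let N , close = s→l ε 0<ε in N , λ m N≤m → ≤-trans (im≤‖‖ (s m -ᵛ l) j) (<⇒≤ (close m N≤m)))

    ⇝⇒⟶ᵛ : {s : ℕ → Vec n} {l : Vec n} → (∀ j → (λ m → s m j) ⇝ l j) → s ⟶ᵛ l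
    ⇝⇒⟶ᵛ s→l = ‖‖-small (λ j → ⇝-null (s→l j))

  ⟶⇒⇝ : ∀ {s l} → s ⟶ l → s ⇝ l
  ⟶⇒⇝ {s} {l} s→l =
    (λ ε 0<ε → let N , close = s→l ε 0<ε in N , λ m N≤m →
       ≤-trans (≤-√ (∣∣²-nonneg (s m - l)) (x≤x+y (square-nonneg (im (s m - l))))) (<⇒≤ (close m N≤m))) ,
    (λ ε 0<ε → let N , close = s→l ε 0<ε in N , λ m N≤m →
       ≤-trans (≤-√ (∣∣²-nonneg (s m - l)) (x≤y+x (square-nonneg (re (s m - l))))) (<⇒≤ (close m N≤m)))

  ⇝⇒⟶ : ∀ {s l} → s ⇝ l → s ⟶ l
  ⇝⇒⟶ {s} {l} s→l ε 0<ε =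
    let N , small = null-∣∣₁ (⇝-null s→l) (half ε) (half-pos 0<ε)
    in N , λ m N≤m → ≤-<-trans
         (≤-trans (√-≤ (∣∣²-nonneg (s m - l)) (∣∣₁-nonneg (s m - l)) (∣∣≤∣∣₁ (s m - l))) (≤-trans (x≤abs _) (small m N≤m)))
         (half< 0<ε)

  ⇝-lim : ∀ s → ∃ (s ⇝_) → s ⇝ lim s
  ⇝-lim s (l , s→l) = ⟶⇒⇝ (choose-satisfies 0ᶜ {s ⟶_} (l , ⇝⇒⟶ s→l))

  lim-correct : ∀ {s l} → s ⇝ l → lim s ≈ l
  lim-correct {s} {l} s→l = ⇝-unique (⇝-lim s (l , s→l)) s→l

-- The complex exponential and its modulus on the imaginary axis

module ComplexExponential (em : ExcludedMiddle 0ℓ) (𝓡 : CompleteOrderedField) where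

  open Mixing em 𝓡
  open RealLine em 𝓡
  open RealLimits em 𝓡
  open RealSeries em 𝓡
  open ComplexNumbers em 𝓡
  open ℝ′ using (solve; _:=_; _:+_; _:*_; _:-_; :-_; :0; :1)
  module ℝΣ = CauchyProduct ℝ.commutativeRing
  open CauchyProduct ℂ-commutativeRing

  ν≈⟦fromℕ⟧ : ∀ n → ν n ≈ ⟦ ℝ.fromℕ n ⟧
  ν≈⟦fromℕ⟧ zero    = ℂR.refl
  ν≈⟦fromℕ⟧ (suc n) = ℂR.trans (ℂR.+-congˡ (ν≈⟦fromℕ⟧ n)) (ℂR.sym (⟦⟧-+ ℝ.1# (ℝ.fromℕ n)))

  fromℕ-* : ∀ m n → ℝ.fromℕ (m ℕ.* n) ℝ.≈ ℝ.fromℕ m ℝ.* ℝ.fromℕ n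
  fromℕ-* = Algebra.Properties.Semiring.Mult.×1-homo-* ℝ.semiring

  factorial-pos : ∀ k → ℝ.0# < ℝ.fromℕ (k !)
  factorial-pos zero    = fromℕ-suc-pos 0
  factorial-pos (suc k) = <-≤-trans (*-pos (fromℕ-suc-pos k) (factorial-pos k))
    (≤-reflexive (ℝ.sym (fromℕ-* (suc k) (k !))))

  expTerm : ℂ → ℕ → ℂ
  expTerm z k = 1/ k ! * z ^ k

  expTerm-cong : ∀ {z w} → z ≈ w → ∀ k → expTerm z k ≈ expTerm w k
  expTerm-cong {z} {w} z≈w k = ℂR.*-congˡ (power k)
    where
    power : ∀ k → z ^ k ≈ w ^ k
    power zero    = ℂR.refl
    power (suc k) = ℂR.*-cong z≈w (power k)

  expTerm-suc : ∀ z k → expTerm z (suc k) ≈ ⟦ 1/suc k ⟧ * (z * expTerm z k)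
  expTerm-suc z k = begin
    ⟦ ℝ.fromℕ (suc k !) ℝ.⁻¹ ⟧ * (z * z ^ k)
      ≈⟨ ℂR.*-congʳ (ℂR.trans (⟦⟧-cong inverse) (⟦⟧-* (1/suc k) (ℝ.fromℕ (k !) ℝ.⁻¹))) ⟩
    ⟦ 1/suc k ⟧ * 1/ k ! * (z * z ^ k)
      ≈⟨ ℂ′.solve 4 (λ a b z p → a ℂ′.:* b ℂ′.:* (z ℂ′.:* p) ℂ′.:= a ℂ′.:* (z ℂ′.:* (b ℂ′.:* p)))
           ℂR.refl ⟦ 1/suc k ⟧ (1/ k !) z (z ^ k) ⟩
    ⟦ 1/suc k ⟧ * (z * expTerm z k) ∎
    where
    open ℂ′.Eq
    inverse : ℝ.fromℕ (suc k !) ℝ.⁻¹ ℝ.≈ 1/suc k ℝ.* ℝ.fromℕ (k !) ℝ.⁻¹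
    inverse = *-cancelˡ (<⇒≉ (factorial-pos (suc k))) (R.begin
      x ℝ.* x ℝ.⁻¹                      R.≈⟨ ℝ.⁻¹-inverse (<⇒≉ (factorial-pos (suc k))) ⟩
      ℝ.1#                              R.≈⟨ ℝ.*-identityˡ ℝ.1# ⟨
      ℝ.1# ℝ.* ℝ.1#                     R.≈⟨ ℝ.*-cong (ℝ.⁻¹-inverse (<⇒≉ (fromℕ-suc-pos k))) (ℝ.⁻¹-inverse (<⇒≉ (factorial-pos k))) ⟨
      p ℝ.* p ℝ.⁻¹ ℝ.* (q ℝ.* q ℝ.⁻¹)   R.≈⟨ solve 4 (λ p i q j → p :* i :* (q :* j) := p :* q :* (i :* j))
           ℝ.refl p (p ℝ.⁻¹) q (q ℝ.⁻¹) ⟩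
      p ℝ.* q ℝ.* (p ℝ.⁻¹ ℝ.* q ℝ.⁻¹)   R.≈⟨ ℝ.*-congʳ (fromℕ-* (suc k) (k !)) ⟨
      x ℝ.* (p ℝ.⁻¹ ℝ.* q ℝ.⁻¹)         R.∎)
      where
      module R = ℝ′.Eq
      x p q : ℝ
      x = ℝ.fromℕ (suc k !)
      p = ℝ.fromℕ (suc k)
      q = ℝ.fromℕ (k !)

  expTerm-exponential : ∀ z → IsExponential z (expTerm z)
  expTerm-exponential z =
    ℂR.trans (ℂR.*-identityʳ _) (⟦⟧-cong (*-cancelˡ (<⇒≉ (fromℕ-suc-pos 0)) (ℝ.trans (ℝ.⁻¹-inverse (<⇒≉ (fromℕ-suc-pos 0)))
      (solve 0 (:1 := (:1 :+ :0) :* :1) ℝ.refl)))) ,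
    λ k → begin
      ν (suc k) * expTerm z (suc k)
        ≈⟨ ℂR.*-cong (ν≈⟦fromℕ⟧ (suc k)) (expTerm-suc z k) ⟩
      ⟦ ℝ.fromℕ (suc k) ⟧ * (⟦ 1/suc k ⟧ * (z * expTerm z k))
        ≈⟨ ℂR.*-assoc _ _ _ ⟨
      ⟦ ℝ.fromℕ (suc k) ⟧ * ⟦ 1/suc k ⟧ * (z * expTerm z k)
        ≈⟨ ℂR.*-congʳ (ℂR.trans (ℂR.sym (⟦⟧-* _ _)) (⟦⟧-cong (ℝ.⁻¹-inverse (<⇒≉ (fromℕ-suc-pos k))))) ⟩
      1ᶜ * (z * expTerm z k)
        ≈⟨ ℂR.*-identityˡ _ ⟩
      z * expTerm z k ∎
    where open ℂ′.Eq

  -- These are the numbers x^k / k!, written by the recursion that `expTerm-suc` establishes for the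
  -- complex terms, so that the comparison of the two is an induction.
  majorant : ℝ → ℕ → ℝ
  majorant x zero    = ℝ.1#
  majorant x (suc k) = 1/suc k ℝ.* (x ℝ.* majorant x k)

  majorant-exponential : ∀ x → ℝΣ.IsExponential x (majorant x)
  majorant-exponential x = ℝ.refl , λ k → ℝ.trans (ℝ.sym (ℝ.*-assoc _ _ _))
    (ℝ.trans (ℝ.*-congʳ (ℝ.⁻¹-inverse (<⇒≉ (fromℕ-suc-pos k)))) (ℝ.*-identityˡ _))

  ∣⟦⟧∣₁ : ∀ {x} → ℝ.0# ≤ x → ∣ ⟦ x ⟧ ∣₁ ≤ x
  ∣⟦⟧∣₁ 0≤x = ≤-trans (+-mono (abs-of-nonneg 0≤x) (abs-of-nonneg ≤-refl)) (≤-reflexive (ℝ.+-identityʳ _))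

  ∣expTerm∣≤majorant : ∀ z k → ∣ expTerm z k ∣₁ ≤ majorant ∣ z ∣₁ k
  ∣expTerm∣≤majorant z zero    = ≤-trans (∣∣₁-cong-≤ (proj₁ (expTerm-exponential z))) (∣⟦⟧∣₁ 0≤1)
  ∣expTerm∣≤majorant z (suc k) = ≤-trans (∣∣₁-cong-≤ (expTerm-suc z k)) (≤-trans (∣∣₁-* ⟦ 1/suc k ⟧ _)
    (*-mono (∣∣₁-nonneg ⟦ 1/suc k ⟧) 0≤ (∣⟦⟧∣₁ (<⇒≤ (1/suc-pos k)))
      (≤-trans (∣∣₁-* z _) (*-monoˡ (∣∣₁-nonneg z) (∣expTerm∣≤majorant z k)))))
    where
    0≤ : ℝ.0# ≤ ∣ z ∣₁ ℝ.* majorant ∣ z ∣₁ k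
    0≤ = ℝ.*-nonneg (∣∣₁-nonneg z) (exponential-nonneg (∣∣₁-nonneg z) (majorant-exponential ∣ z ∣₁) k)

  re≤∣∣₁ : ∀ z → abs (re z) ≤ ∣ z ∣₁
  re≤∣∣₁ z = x≤x+y (abs-nonneg (im z))

  im≤∣∣₁ : ∀ z → abs (im z) ≤ ∣ z ∣₁
  im≤∣∣₁ z = x≤y+x (abs-nonneg (re z))

  expSum : ℂ → ℕ → ℂ
  expSum z = ∑< (expTerm z)

  expSum-converges : ∀ z → ∃ (expSum z ⇝_)
  expSum-converges z =
    let l , re→l = dominated-converges {a = λ k → re (expTerm z k)} (∣∣₁-nonneg z) (majorant-exponential ∣ z ∣₁)
                     (λ k → ≤-trans (re≤∣∣₁ (expTerm z k)) (∣expTerm∣≤majorant z k))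
        k , im→k = dominated-converges {a = λ k → im (expTerm z k)} (∣∣₁-nonneg z) (majorant-exponential ∣ z ∣₁)
                     (λ k → ≤-trans (im≤∣∣₁ (expTerm z k)) (∣expTerm∣≤majorant z k))
    in (l +i k) , lim-cong (λ N → ℝ.sym (re-sum {N} (λ k → expTerm z (toℕ k)))) ℝ.refl re→l ,
                  lim-cong (λ N → ℝ.sym (im-sum {N} (λ k → expTerm z (toℕ k)))) ℝ.refl im→k

  expSum⇝exp : ∀ z → expSum z ⇝ exp z
  expSum⇝exp z = ⇝-lim (expSum z) (expSum-converges z)

  exp-cong : ∀ {z w} → z ≈ w → exp z ≈ exp w
  exp-cong {z} {w} z≈w = ⇝-unique (expSum⇝exp z)
    (⇝-cong (λ N → ∑<-cong (λ k → ℂR.sym (expTerm-cong z≈w k)) N) ℂR.refl (expSum⇝exp w))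

  difference-bound : ∀ {b : ℕ → ℂ} {β} → (∀ k → ∣ b k ∣₁ ≤ β k) → ∀ {M K} → M ℕ.≤ K →
                     ∣ ∑< b K - ∑< b M ∣₁ ≤ ℝΣ.∑< β K ℝ.- ℝΣ.∑< β M
  difference-bound {b} {β} b≤β {M} M≤K = go (ℕ.≤⇒≤′ M≤K)
    where
    go : ∀ {K} → M ℕ.≤′ K → ∣ ∑< b K - ∑< b M ∣₁ ≤ ℝΣ.∑< β K ℝ.- ℝΣ.∑< β M
    go ℕ.≤′-refl = ≤-trans (∣∣₁-cong-≤ (ℂR.-‿inverseʳ (∑< b M))) (≤-trans (∣⟦⟧∣₁ ≤-refl) (≤-reflexive (ℝ.sym (ℝ.-‿inverseʳ _))))
    go {suc K} (ℕ.≤′-step M≤K) = begin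
      ∣ ∑< b (suc K) - ∑< b M ∣₁
        ≤⟨ ∣∣₁-cong-≤ (ℂR.trans (ℂR.+-congʳ (∑<-suc b K))
             (ℂ′.solve 3 (λ s t m → (s ℂ′.:+ t) ℂ′.:- m ℂ′.:= (s ℂ′.:- m) ℂ′.:+ t) ℂR.refl (∑< b K) (b K) (∑< b M))) ⟩
      ∣ (∑< b K - ∑< b M) + b K ∣₁
        ≤⟨ ∣∣₁-+ (∑< b K - ∑< b M) (b K) ⟩
      ∣ ∑< b K - ∑< b M ∣₁ ℝ.+ ∣ b K ∣₁
        ≤⟨ +-mono (go M≤K) (b≤β K) ⟩
      (ℝΣ.∑< β K ℝ.- ℝΣ.∑< β M) ℝ.+ β K
        ≈⟨ solve 3 (λ s t m → (s :- m) :+ t := (s :+ t) :- m) ℝ.refl (ℝΣ.∑< β K) (β K) (ℝΣ.∑< β M) ⟩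
      (ℝΣ.∑< β K ℝ.+ β K) ℝ.- ℝΣ.∑< β M
        ≈⟨ ℝ.+-congʳ (ℝΣ.∑<-suc β K) ⟨
      ℝΣ.∑< β (suc K) ℝ.- ℝΣ.∑< β M ∎
      where open ≤R

  -- The difference on the left is the sum of a_j b_k over the pairs of the rectangle outside the
  -- triangle, and there each product is dominated by α_j β_k. The induction removes one row at a
  -- time; the rest of a row beyond the triangle is estimated by `difference-bound`.
  gap-bound : ∀ {a b : ℕ → ℂ} {α β} → (∀ k → ∣ a k ∣₁ ≤ α k) → (∀ k → ∣ b k ∣₁ ≤ β k) → ∀ {N K} → N ℕ.≤ K →
              ∣ ∑< a N * ∑< b K - ∑△ a b N ∣₁ ≤ ℝΣ.∑< α N ℝ.* ℝΣ.∑< β K ℝ.- ℝΣ.∑△ α β N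
  gap-bound {b = b} {β = β} a≤α b≤β {zero} {K} N≤K =
    ≤-trans (∣∣₁-cong-≤ (ℂ′.solve 1 (λ x → ℂ′.:0 ℂ′.:* x ℂ′.:- ℂ′.:0 ℂ′.:= ℂ′.:0) ℂR.refl (∑< b K)))
    (≤-trans (∣⟦⟧∣₁ ≤-refl) (≤-reflexive (solve 1 (λ x → :0 := :0 :* x :- :0) ℝ.refl (ℝΣ.∑< β K))))
  gap-bound {a} {b} {α} {β} a≤α b≤β {suc N} {K} N<K = begin
      ∣ (a 0 + ∑< (a ∘ suc) N) * ∑< b K - (a 0 * ∑< b (suc N) + ∑△ (a ∘ suc) b N) ∣₁
        ≤⟨ ∣∣₁-cong-≤ (ℂ′.solve 5 (λ x s B t y → (x ℂ′.:+ s) ℂ′.:* B ℂ′.:- (x ℂ′.:* t ℂ′.:+ y)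
                                    ℂ′.:= x ℂ′.:* (B ℂ′.:- t) ℂ′.:+ (s ℂ′.:* B ℂ′.:- y)) ℂR.refl
             (a 0) (∑< (a ∘ suc) N) (∑< b K) (∑< b (suc N)) (∑△ (a ∘ suc) b N)) ⟩
      ∣ a 0 * (∑< b K - ∑< b (suc N)) + (∑< (a ∘ suc) N * ∑< b K - ∑△ (a ∘ suc) b N) ∣₁
        ≤⟨ ∣∣₁-+ (a 0 * (∑< b K - ∑< b (suc N))) (∑< (a ∘ suc) N * ∑< b K - ∑△ (a ∘ suc) b N) ⟩
      ∣ a 0 * (∑< b K - ∑< b (suc N)) ∣₁ ℝ.+ ∣ ∑< (a ∘ suc) N * ∑< b K - ∑△ (a ∘ suc) b N ∣₁
        ≤⟨ +-mono (≤-trans (∣∣₁-* (a 0) (∑< b K - ∑< b (suc N)))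
                     (*-mono (∣∣₁-nonneg (a 0)) (≤-trans (∣∣₁-nonneg _) (difference-bound b≤β N<K)) (a≤α 0) (difference-bound b≤β N<K)))
                  (gap-bound (a≤α ∘ suc) b≤β (ℕ.<⇒≤ N<K)) ⟩
      α 0 ℝ.* (ℝΣ.∑< β K ℝ.- ℝΣ.∑< β (suc N)) ℝ.+ (ℝΣ.∑< (α ∘ suc) N ℝ.* ℝΣ.∑< β K ℝ.- ℝΣ.∑△ (α ∘ suc) β N)
        ≈⟨ solve 5 (λ x s B t y → x :* (B :- t) :+ (s :* B :- y) := (x :+ s) :* B :- (x :* t :+ y)) ℝ.refl
             (α 0) (ℝΣ.∑< (α ∘ suc) N) (ℝΣ.∑< β K) (ℝΣ.∑< β (suc N)) (ℝΣ.∑△ (α ∘ suc) β N) ⟩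
      (α 0 ℝ.+ ℝΣ.∑< (α ∘ suc) N) ℝ.* ℝΣ.∑< β K ℝ.- (α 0 ℝ.* ℝΣ.∑< β (suc N) ℝ.+ ℝΣ.∑△ (α ∘ suc) β N) ∎
    where open ≤R

  conj-exponential : ∀ {z a} → IsExponential z a → IsExponential (conj z) (conj ∘ a)
  conj-exponential {z} {a} (a₀ , ∂a) = ℂR.trans (conj-cong a₀) (conj-⟦⟧ ℝ.1#) , λ k → begin
      ν (suc k) * conj (a (suc k))         ≈⟨ ℂR.*-congʳ (real (suc k)) ⟨
      conj (ν (suc k)) * conj (a (suc k))  ≈⟨ conj-* _ _ ⟨
      conj (ν (suc k) * a (suc k))         ≈⟨ conj-cong (∂a k) ⟩
      conj (z * a k)                       ≈⟨ conj-* _ _ ⟩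
      conj z * conj (a k)                  ∎
    where
    open ℂ′.Eq
    real : ∀ k → conj (ν k) ≈ ν k
    real k = ℂR.trans (conj-cong (ν≈⟦fromℕ⟧ k)) (ℂR.trans (conj-⟦⟧ _) (ℂR.sym (ν≈⟦fromℕ⟧ k)))

  ∣conj∣₁ : ∀ z → ∣ conj z ∣₁ ≤ ∣ z ∣₁
  ∣conj∣₁ z = +-mono ≤-refl (abs-neg (im z))

  -- For z = 0 the recursion (k + 1) c_(k+1) = z c_k kills every term after the constant one. The
  -- partial sum has to be nonempty, hence `suc N`.
  exponential-of-zero : ∀ {z c} → z ≈ 0ᶜ → IsExponential z c → ∀ N → ∑< c (suc N) ≈ 1ᶜ
  exponential-of-zero {z} {c} z≈0 (c₀ , ∂c) N =
      ℂR.trans (ℂR.+-cong c₀ (ℂ′.sum-zero {N} (λ k → c-suc (toℕ k)))) (ℂR.+-identityʳ 1ᶜ)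
    where
    c-suc : ∀ k → c (suc k) ≈ 0ᶜ
    c-suc k = no-zero-divisorsᶜ
      (λ ν≈0 → <⇒≉ (fromℕ-suc-pos k) (proj₁ (ℂR.trans (ℂR.sym (ν≈⟦fromℕ⟧ (suc k))) ν≈0)))
      (ℂR.trans (∂c k) (ℂR.trans (ℂR.*-congʳ z≈0) (ℂR.zeroˡ _)))

  ∣exp∣²≈1 : ∀ z → re z ℝ.≈ ℝ.0# → ∣ exp z ∣² ℝ.≈ ℝ.1#
  -- The sequence is shifted by one because the empty partial sum of the product series is 0 and not
  -- 1.
  ∣exp∣²≈1 z re≈0 = lim-unique (lim-subsequence {φ = suc} ℕ.n≤1+n (⇝-∣∣² (expSum⇝exp z))) squares→1
    where
    a b : ℕ → ℂ
    a = expTerm z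
    b = conj ∘ a
    z+z̄≈0 : z + conj z ≈ 0ᶜ
    z+z̄≈0 = ℝ.trans (ℝ.+-cong re≈0 re≈0) (ℝ.+-identityˡ ℝ.0#) , ℝ.-‿inverseʳ (im z)
    product : ∀ N → ∑△ a b (suc N) ≈ 1ᶜ
    product N = ℂR.trans (∑△≈∑<conv a b (suc N))
      (exponential-of-zero z+z̄≈0 (conv-exponential (expTerm-exponential z) (conj-exponential (expTerm-exponential z))) N)
    square : ∀ N → ∣ expSum z N ∣² ℝ.≈ re (∑< a N * ∑< b N)
    square N = proj₁ (ℂR.trans (ℂR.sym (*-conj (expSum z N))) (ℂR.*-congˡ {∑< a N} (conj-sum {N} (λ k → a (toℕ k)))))
    gap : ∀ N → abs (∣ expSum z (suc N) ∣² ℝ.- ℝ.1#) ≤ ∣ ∑< a (suc N) * ∑< b (suc N) - ∑△ a b (suc N) ∣₁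
    gap N = ≤-trans (abs-cong-≤ (ℝ.+-cong (square (suc N)) (ℝ.-‿cong (ℝ.sym (proj₁ (product N))))))
                    (re≤∣∣₁ (∑< a (suc N) * ∑< b (suc N) - ∑△ a b (suc N)))
    squares→1 : Lim (λ N → ∣ expSum z (suc N) ∣²) ℝ.1#
    squares→1 = null-dominated
      (λ N → ≤-trans (gap N) (≤-trans
        (gap-bound (∣expTerm∣≤majorant z) (λ k → ≤-trans (∣conj∣₁ (a k)) (∣expTerm∣≤majorant z k)) {suc N} ℕ.≤-refl) (x≤abs _)))
      (λ ε 0<ε → let M , small = triangle-gap-null (∣∣₁-nonneg z) (majorant-exponential ∣ z ∣₁) ε 0<ε
                 in M , λ m M≤m → small (suc m) (ℕ.m≤n⇒m≤1+n M≤m))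

-- Coordinates in an eigenbasis

module SpectralDecomposition (em : ExcludedMiddle 0ℓ) (𝓡 : CompleteOrderedField) where

  open Mixing em 𝓡
  open RealLine em 𝓡
  open RealLimits em 𝓡
  open ComplexNumbers em 𝓡
  open ComplexExponential em 𝓡
  open ℂR using (refl; sym; trans; +-cong; +-congʳ; *-congˡ; *-congʳ; *-comm; *-assoc; *-identityˡ; zeroˡ; zeroʳ)
  open ℂ′ using (solve; _:=_; _:+_; _:*_; _:-_; :1; δ; sum-cong)

  δ≈⟦δ⟧ : ∀ {n} (j k : Fin n) → δ j k ≈ ⟦ ℝ′.δ j k ⟧
  δ≈⟦δ⟧ zero    zero    = refl
  δ≈⟦δ⟧ zero    (suc k) = refl
  δ≈⟦δ⟧ (suc j) zero    = refl
  δ≈⟦δ⟧ (suc j) (suc k) = δ≈⟦δ⟧ j k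

  𝐞≈δ : ∀ {n} (u j : Fin n) → 𝐞 u j ≈ δ u j
  𝐞≈δ u j with u ≟ j
  ... | yes ≡.refl = sym (ℂ′.δ-refl u)
  ... | no  u≢j    = sym (ℂ′.δ-≢ u≢j)

  sum-𝐞 : ∀ {n} (x : Vec n) u → sum (λ k → x k * 𝐞 u k) ≈ x u
  sum-𝐞 {n} x u = trans (sum-cong {n} (λ k → trans (*-congˡ (𝐞≈δ u k)) (*-comm _ _))) (ℂ′.sum-δˡ u x)

  sum-assoc : ∀ {m n} (a : Fin m → ℂ) (B : Fin m → Fin n → ℂ) (x : Fin n → ℂ) →
              sum (λ j → a j * sum (λ k → B j k * x k)) ≈ sum (λ k → sum (λ j → a j * B j k) * x k)
  sum-assoc {m} {n} a B x = begin
    sum (λ j → a j * sum (λ k → B j k * x k))      ≈⟨ sum-cong {m} (λ j → ℂ′.*-distribˡ-sum (a j) (λ k → B j k * x k)) ⟩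
    sum (λ j → sum (λ k → a j * (B j k * x k)))    ≈⟨ ℂ′.∑-comm (λ j k → a j * (B j k * x k)) ⟩
    sum (λ k → sum (λ j → a j * (B j k * x k)))    ≈⟨ sum-cong {n} (λ k → sum-cong {m} (λ j → sym (*-assoc _ _ _))) ⟩
    sum (λ k → sum (λ j → a j * B j k * x k))      ≈⟨ sum-cong {n} (λ k → sym (ℂ′.*-distribʳ-sum (x k) (λ j → a j * B j k))) ⟩
    sum (λ k → sum (λ j → a j * B j k) * x k)      ∎
    where open ℂ′.Eq

  -- The orthonormal eigenbasis, stored as the columns of Q, is a parameter: nothing below depends
  -- on how it was found.
  module Coordinates {n : ℕ} (M : Mat n) (R : Fin n → Fin n → ℝ)
    (M≈R : ∀ j k → M j k ≈ ⟦ R j k ⟧) (R-sym : ∀ j k → R j k ℝ.≈ R k j)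
    (Q : Fin n → Fin n → ℝ) (θ : Fin n → ℝ)
    (columns : ∀ r s → ℝ.sum (λ j → Q j r ℝ.* Q j s) ℝ.≈ ℝ′.δ r s)
    (rows : ∀ j k → ℝ.sum (λ r → Q j r ℝ.* Q k r) ℝ.≈ ℝ′.δ j k)
    (eigencolumns : ∀ j r → ℝ.sum (λ k → R j k ℝ.* Q k r) ℝ.≈ θ r ℝ.* Q j r) where

    q : Fin n → Vec n
    q r j = ⟦ Q j r ⟧

    -- Since `q r` is real, the bilinear product agrees with the Hermitian inner product by `q r`.
    c : Fin n → Vec n → ℂ
    c r x = q r ᵀ· x

    c-cong : ∀ r {x y} → x ≈ᵛ y → c r x ≈ c r y
    c-cong r x≈y = sum-cong {n} (λ j → *-congˡ (x≈y j))

    c-scale : ∀ r a x → c r (a · x) ≈ a * c r x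
    c-scale r a x = trans
      (sum-cong {n} (λ j → solve 3 (λ q a x → q :* (a :* x) := a :* (q :* x)) refl (q r j) a (x j)))
      (sym (ℂ′.*-distribˡ-sum a (λ j → q r j * x j)))

    c-conj : ∀ r x → c r (λ j → conj (x j)) ≈ conj (c r x)
    c-conj r x = sym (trans (conj-sum {n} (λ j → q r j * x j))
      (sum-cong {n} (λ j → trans (conj-* (q r j) (x j)) (*-congʳ (conj-⟦⟧ (Q j r))))))

    orthonormal : ∀ r s → c r (q s) ≈ δ r s
    orthonormal r s = trans (sum-cong {n} (λ j → sym (⟦⟧-* (Q j r) (Q j s))))
      (trans (sym (⟦⟧-sum (λ j → Q j r ℝ.* Q j s))) (trans (⟦⟧-cong (columns r s)) (sym (δ≈⟦δ⟧ r s))))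

    resolution : ∀ j k → sum (λ r → q r j * q r k) ≈ δ j k
    resolution j k = trans (sum-cong {n} (λ r → sym (⟦⟧-* (Q j r) (Q k r))))
      (trans (sym (⟦⟧-sum (λ r → Q j r ℝ.* Q k r))) (trans (⟦⟧-cong (rows j k)) (sym (δ≈⟦δ⟧ j k))))

    M-q : ∀ r → InEigenspace M ⟦ θ r ⟧ (q r)
    M-q r j = trans (sum-cong {n} (λ k → trans (*-congʳ (M≈R j k)) (sym (⟦⟧-* (R j k) (Q k r)))))
      (trans (sym (⟦⟧-sum (λ k → R j k ℝ.* Q k r))) (trans (⟦⟧-cong (eigencolumns j r)) (⟦⟧-* (θ r) (Q j r))))

    expansion : ∀ x j → x j ≈ sum (λ r → q r j * c r x)
    expansion x j = sym (trans (sum-assoc (λ r → q r j) (λ r k → q r k) x)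
      (trans (sum-cong {n} (λ k → *-congʳ (resolution j k))) (ℂ′.sum-δˡ j x)))

    ≈ᵛ-from-coordinates : ∀ {x y} → (∀ r → c r x ≈ c r y) → x ≈ᵛ y
    ≈ᵛ-from-coordinates {x} {y} cx≈cy j =
      trans (expansion x j) (trans (sum-cong {n} (λ r → *-congˡ (cx≈cy r))) (sym (expansion y j)))

    -- In bilinear form the identity covers both the products vᵀμ with eigenvectors and, with v
    -- conjugated, the norm.
    parseval : ∀ v x → v ᵀ· x ≈ sum (λ r → c r v * c r x)
    parseval v x = trans (sum-cong {n} (λ j → *-congˡ (expansion x j)))
      (trans (sum-assoc v (λ j r → q r j) (λ r → c r x))
             (sum-cong {n} (λ r → *-congʳ (sum-cong {n} (λ j → *-comm _ _)))))

    c-M : ∀ r x → c r (M *ᵛ x) ≈ ⟦ θ r ⟧ * c r x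
    c-M r x = trans (sum-assoc (q r) M x) (trans
      (sum-cong {n} (λ k → trans
        (*-congʳ (trans (sum-cong {n} (λ j → trans (*-comm _ _)
          (*-congʳ (trans (M≈R j k) (trans (⟦⟧-cong (R-sym j k)) (sym (M≈R k j))))))) (M-q r k)))
        (*-assoc _ _ _)))
      (sym (ℂ′.*-distribˡ-sum ⟦ θ r ⟧ (λ k → q r k * x k))))

    -- Symmetry of M gives two values for the r-th coordinate of M v, namely λ′ and θ_r times that
    -- of v. Here λ′ may be any complex number.
    eigenspace-coordinate : ∀ {λ′ v r} → InEigenspace M λ′ v → ¬ (λ′ ≈ ⟦ θ r ⟧) → c r v ≈ 0ᶜ
    eigenspace-coordinate {λ′} {v} {r} Mv≈λv λ≉θ = no-zero-divisorsᶜ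
      (λ λ-θ≈0 → λ≉θ (trans (solve 2 (λ a b → a := a :- b :+ b)
           refl λ′ ⟦ θ r ⟧) (trans (+-congʳ λ-θ≈0) (ℂR.+-identityˡ _))))
      (begin
        (λ′ - ⟦ θ r ⟧) * c r v          ≈⟨ solve 3 (λ a b c → (a :- b) :* c := a :* c :- b :* c)
             refl λ′ ⟦ θ r ⟧ (c r v) ⟩
        λ′ * c r v - ⟦ θ r ⟧ * c r v    ≈⟨ +-cong (sym (trans (c-cong r Mv≈λv) (c-scale r λ′ v))) (ℂR.-‿cong (sym (c-M r v))) ⟩
        c r (M *ᵛ v) - c r (M *ᵛ v)     ≈⟨ ℂR.-‿inverseʳ _ ⟩
        0ᶜ                              ∎)
      where open ℂ′.Eq

    nonzero-coordinate : ∀ {v} → ¬ (v ≈ᵛ 0ᵛ) → ∃ λ r → ¬ (c r v ≈ 0ᶜ)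
    nonzero-coordinate {v} v≉0 = ¬¬-elim λ none → v≉0 λ j →
      trans (expansion v j) (ℂ′.sum-zero {n} λ r → trans (*-congˡ (¬¬-elim λ cv≉0 → none (r , cv≉0))) (zeroʳ _))

    eigenspace-cong : ∀ {a b v} → a ≈ b → InEigenspace M a v → InEigenspace M b v
    eigenspace-cong a≈b Mv≈av j = trans (Mv≈av j) (*-congʳ a≈b)

    module _ (λ′ : ℂ) where

      indicator : Fin n → ℂ
      indicator r with em {λ′ ≈ ⟦ θ r ⟧}
      ... | yes _ = 1ᶜ
      ... | no  _ = 0ᶜ

      indicator-θ : ∀ r → indicator r * ⟦ θ r ⟧ ≈ indicator r * λ′
      indicator-θ r with em {λ′ ≈ ⟦ θ r ⟧}
      ... | yes λ≈θ = *-congˡ (sym λ≈θ)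
      ... | no  _   = trans (zeroˡ _) (sym (zeroˡ _))

      indicator-coordinate : ∀ {w} → InEigenspace M λ′ w → ∀ r → conj (c r w) * (1ᶜ - indicator r) ≈ 0ᶜ
      indicator-coordinate {w} Mw≈λw r with em {λ′ ≈ ⟦ θ r ⟧}
      ... | yes _   = trans (*-congˡ (ℂR.-‿inverseʳ 1ᶜ)) (zeroʳ _)
      ... | no  λ≉θ = trans (*-congʳ (trans (conj-cong (eigenspace-coordinate {λ′} {w} Mw≈λw λ≉θ)) (conj-⟦⟧ ℝ.0#))) (zeroˡ _)

      -- The sum of q_r q_rᵀ over all r with θ_r = λ′, exhibited so that the choice in `E` does not
      -- fall back on its default. It exists for every λ′ and is zero away from the spectrum.
      projection : Mat n
      projection j k = sum (λ r → indicator r * q r j * q r k)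

      projection-expansion : ∀ x j → (projection *ᵛ x) j ≈ sum (λ r → q r j * (indicator r * c r x))
      projection-expansion x j = trans (sym (sum-assoc (λ r → indicator r * q r j) (λ r k → q r k) x))
        (sum-cong {n} (λ r → solve 3 (λ d q c → d :* q :* c := q :* (d :* c)) refl (indicator r) (q r j) (c r x)))

      projection-isOrthogonalProjection : IsOrthogonalProjection M λ′ projection
      projection-isOrthogonalProjection x = inEigenspace , orthogonal
        where
        open ℂ′.Eq
        inEigenspace : InEigenspace M λ′ (projection *ᵛ x)
        inEigenspace j = begin
          sum (λ k → M j k * (projection *ᵛ x) k)
            ≈⟨ sum-cong {n} (λ k → *-congˡ (projection-expansion x k)) ⟩
          sum (λ k → M j k * sum (λ r → q r k * (indicator r * c r x)))
            ≈⟨ sum-assoc (M j) (λ k r → q r k) (λ r → indicator r * c r x) ⟩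
          sum (λ r → (M *ᵛ q r) j * (indicator r * c r x))
            ≈⟨ sum-cong {n} (λ r → trans (*-congʳ (M-q r j))
                 (trans (solve 4 (λ t q d c → t :* q :* (d :* c) := d :* t :* (q :* c))
                      refl ⟦ θ r ⟧ (q r j) (indicator r) (c r x))
                 (trans (*-congʳ (indicator-θ r))
                        (solve 4 (λ t q d c → d :* t :* (q :* c) := t :* (q :* (d :* c)))
                             refl λ′ (q r j) (indicator r) (c r x))))) ⟩
          sum (λ r → λ′ * (q r j * (indicator r * c r x)))
            ≈⟨ ℂ′.*-distribˡ-sum λ′ (λ r → q r j * (indicator r * c r x)) ⟨
          λ′ * sum (λ r → q r j * (indicator r * c r x))
            ≈⟨ *-congˡ (projection-expansion x j) ⟨
          λ′ * (projection *ᵛ x) j ∎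
        residual : ∀ j → (x -ᵛ (projection *ᵛ x)) j ≈ sum (λ r → q r j * ((1ᶜ - indicator r) * c r x))
        residual j = begin
          x j - (projection *ᵛ x) j
            ≈⟨ +-cong (expansion x j) (ℂR.-‿cong (projection-expansion x j)) ⟩
          sum (λ r → q r j * c r x) - sum (λ r → q r j * (indicator r * c r x))
            ≈⟨ ℂ′.sum-- (λ r → q r j * c r x) (λ r → q r j * (indicator r * c r x)) ⟨
          sum (λ r → q r j * c r x - q r j * (indicator r * c r x))
            ≈⟨ sum-cong {n} (λ r → solve 3 (λ q d c → q :* c :- q :* (d :* c) := q :* ((:1 :- d) :* c))
                 refl (q r j) (indicator r) (c r x)) ⟩
          sum (λ r → q r j * ((1ᶜ - indicator r) * c r x)) ∎
        orthogonal : ∀ w → InEigenspace M λ′ w → ⟨ w , x -ᵛ (projection *ᵛ x) ⟩ ≈ 0ᶜ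
        orthogonal w Mw≈λw = begin
          sum (λ j → conj (w j) * (x -ᵛ (projection *ᵛ x)) j)
            ≈⟨ sum-cong {n} (λ j → *-congˡ (residual j)) ⟩
          sum (λ j → conj (w j) * sum (λ r → q r j * ((1ᶜ - indicator r) * c r x)))
            ≈⟨ sum-assoc (λ j → conj (w j)) (λ j r → q r j) (λ r → (1ᶜ - indicator r) * c r x) ⟩
          sum (λ r → sum (λ j → conj (w j) * q r j) * ((1ᶜ - indicator r) * c r x))
            ≈⟨ ℂ′.sum-zero {n} (λ r → trans (sym (*-assoc _ _ _)) (trans
                 (*-congʳ (trans (*-congʳ (trans (sum-cong {n} (λ j → *-comm _ _)) (c-conj r w))) (indicator-coordinate {w} Mw≈λw r))) (zeroˡ _))) ⟩
          0ᶜ ∎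

      E-isOrthogonalProjection : IsOrthogonalProjection M λ′ (E M λ′)
      E-isOrthogonalProjection = choose-satisfies 0ᴹ {IsOrthogonalProjection M λ′} (projection , projection-isOrthogonalProjection)

      -- `q r` lies in the eigenspace of λ′, so the residual x - E x is orthogonal to it.
      E-coordinate : ∀ x r → λ′ ≈ ⟦ θ r ⟧ → c r (E M λ′ *ᵛ x) ≈ c r x
      E-coordinate x r λ≈θ = sym (begin
        c r x                                ≈⟨ solve 2 (λ a b → a := (a :- b) :+ b) refl (c r x) (c r Ex) ⟩
        c r x - c r Ex + c r Ex              ≈⟨ +-congʳ (trans (sym c--)
            (proj₂ (E-isOrthogonalProjection x) (q r) (eigenspace-cong {v = q r} (sym λ≈θ) (M-q r)))) ⟩
        0ᶜ + c r Ex                          ≈⟨ ℂR.+-identityˡ _ ⟩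
        c r Ex                               ∎)
        where
        open ℂ′.Eq
        Ex : Vec n
        Ex = E M λ′ *ᵛ x
        c-- : ⟨ q r , x -ᵛ Ex ⟩ ≈ c r x - c r Ex
        c-- = trans (sum-cong {n} (λ j → trans (*-congʳ (conj-⟦⟧ (Q j r)))
                (solve 3 (λ q x y → q :* (x :- y) := q :* x :- q :* y) refl (q r j) (x j) (Ex j))))
              (ℂ′.sum-- (λ j → q r j * x j) (λ j → q r j * Ex j))

      E-coordinate-≉ : ∀ x r → ¬ (λ′ ≈ ⟦ θ r ⟧) → c r (E M λ′ *ᵛ x) ≈ 0ᶜ
      E-coordinate-≉ x r = eigenspace-coordinate {λ′} {E M λ′ *ᵛ x} {r} (proj₁ (E-isOrthogonalProjection x))

    q≉0 : ∀ r → ¬ (q r ≈ᵛ 0ᵛ)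
    q≉0 r q≈0 = ℝ.0≉1 (ℝ.sym (proj₁ (trans (sym (ℂ′.δ-refl r)) (trans (sym (orthonormal r r))
                  (ℂ′.sum-zero {n} (λ j → trans (*-congˡ (q≈0 j)) (zeroʳ _)))))))

    -- Together with `θ∈Φ`, this identifies the support of x with the θ_r for which the r-th
    -- coordinate of x is nonzero. In particular the elements of Φ, a priori complex, are real.
    Φ-coordinate : ∀ {x λ′} → Φ M x λ′ → ∃ λ r → λ′ ≈ ⟦ θ r ⟧ × ¬ (c r x ≈ 0ᶜ)
    Φ-coordinate {x} {λ′} (_ , Ex≉0) =
      let r , cEx≉0 = nonzero-coordinate Ex≉0
          λ≈θ = ¬¬-elim (λ λ≉θ → cEx≉0 (E-coordinate-≉ λ′ x r λ≉θ))
      in r , λ≈θ , λ cx≈0 → cEx≉0 (trans (E-coordinate λ′ x r λ≈θ) cx≈0)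

    θ∈Φ : ∀ {x r} → ¬ (c r x ≈ 0ᶜ) → Φ M x ⟦ θ r ⟧
    θ∈Φ {x} {r} cx≉0 = (q r , q≉0 r , M-q r) , λ Ex≈0 → cx≉0
      (trans (sym (E-coordinate ⟦ θ r ⟧ x r refl)) (ℂ′.sum-zero {n} (λ j → trans (*-congˡ (Ex≈0 j)) (zeroʳ _))))

    phase : ℝ → ℂ → ℂ
    phase t λ′ = i * ⟦ t ⟧ * λ′

    power-expansion : ∀ t k j l → ((λ j l → i * ⟦ t ⟧ * M j l) ^ᴹ k) j l ≈ sum (λ r → q r j * (phase t ⟦ θ r ⟧ ^ k * q r l))
    power-expansion t zero j l = sym (trans (sum-cong {n} (λ r → *-congˡ (*-identityˡ _)))
      (trans (resolution j l) (sym (𝐞≈δ j l))))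
    power-expansion t (suc k) j l = begin
      sum (λ m → i * ⟦ t ⟧ * M j m * ((λ j l → i * ⟦ t ⟧ * M j l) ^ᴹ k) m l)
        ≈⟨ sum-cong {n} (λ m → *-congˡ (power-expansion t k m l)) ⟩
      sum (λ m → i * ⟦ t ⟧ * M j m * sum (λ r → q r m * (phase t ⟦ θ r ⟧ ^ k * q r l)))
        ≈⟨ sum-assoc (λ m → i * ⟦ t ⟧ * M j m) (λ m r → q r m) (λ r → phase t ⟦ θ r ⟧ ^ k * q r l) ⟩
      sum (λ r → sum (λ m → i * ⟦ t ⟧ * M j m * q r m) * (phase t ⟦ θ r ⟧ ^ k * q r l))
        ≈⟨ sum-cong {n} (λ r → trans (*-congʳ (column r))
             (solve 4 (λ z q p s → z :* q :* (p :* s) := q :* (z :* p :* s))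
                  refl (phase t ⟦ θ r ⟧) (q r j) (phase t ⟦ θ r ⟧ ^ k) (q r l))) ⟩
      sum (λ r → q r j * (phase t ⟦ θ r ⟧ ^ suc k * q r l)) ∎
      where
      open ℂ′.Eq
      column : ∀ r → sum (λ m → i * ⟦ t ⟧ * M j m * q r m) ≈ phase t ⟦ θ r ⟧ * q r j
      column r = trans (sum-cong {n} (λ m → *-assoc _ _ _))
        (trans (sym (ℂ′.*-distribˡ-sum (i * ⟦ t ⟧) (λ m → M j m * q r m)))
        (trans (*-congˡ (M-q r j)) (sym (*-assoc _ _ _))))

    -- The powers of itM are diagonal in the eigenbasis, so each partial sum of the matrix series is
    -- a finite combination of partial sums of scalar exponentials; the finite sum over r commutes
    -- with the limit.
    U-expansion : ∀ t j l → U M t j l ≈ sum (λ r → q r j * (exp (phase t ⟦ θ r ⟧) * q r l))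
    U-expansion t j l = lim-correct (⇝-cong (λ N → sym (partial-sum N)) refl
        (⇝-sum {n} {λ r N → q r j * (expSum (z r) N * q r l)} {λ r → q r j * (exp (z r) * q r l)}
          (λ r → ⇝-* {λ _ → q r j} {λ N → expSum (z r) N * q r l} (⇝-const (q r j))
                     (⇝-* {expSum (z r)} {λ _ → q r l} (expSum⇝exp (z r)) (⇝-const (q r l))))))
      where
      open ℂ′.Eq
      z : Fin n → ℂ
      z r = phase t ⟦ θ r ⟧
      B : ℕ → ℂ
      B k = ((λ j l → i * ⟦ t ⟧ * M j l) ^ᴹ k) j l
      partial-sum : ∀ N → sum {N} (λ k → 1/ toℕ k ! * B (toℕ k)) ≈ sum (λ r → q r j * (expSum (z r) N * q r l))
      partial-sum N = begin
        sum {N} (λ k → 1/ toℕ k ! * B (toℕ k))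
          ≈⟨ sum-cong {N} (λ k → trans (*-congˡ (power-expansion t (toℕ k) j l))
               (trans (ℂ′.*-distribˡ-sum (1/ toℕ k !) (λ r → q r j * (z r ^ toℕ k * q r l)))
                      (sum-cong {n} (λ r → solve 4 (λ f q p s → f :* (q :* (p :* s)) := q :* (f :* p :* s))
                           refl (1/ toℕ k !) (q r j) (z r ^ toℕ k) (q r l))))) ⟩
        sum {N} (λ k → sum (λ r → q r j * (expTerm (z r) (toℕ k) * q r l)))
          ≈⟨ ℂ′.∑-comm {N} {n} (λ k r → q r j * (expTerm (z r) (toℕ k) * q r l)) ⟩
        sum (λ r → sum {N} (λ k → q r j * (expTerm (z r) (toℕ k) * q r l)))
          ≈⟨ sum-cong {n} (λ r → trans (sym (ℂ′.*-distribˡ-sum {N} (q r j) (λ k → expTerm (z r) (toℕ k) * q r l)))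
               (*-congˡ (sym (ℂ′.*-distribʳ-sum {N} (q r l) (λ k → expTerm (z r) (toℕ k)))))) ⟩
        sum (λ r → q r j * (expSum (z r) N * q r l)) ∎

    U𝐞-expansion : ∀ t u j → (U M t *ᵛ 𝐞 u) j ≈ sum (λ r → q r j * (exp (phase t ⟦ θ r ⟧) * q r u))
    U𝐞-expansion t u j = trans (sum-𝐞 (U M t j) u) (U-expansion t j u)

    U𝐞-coordinate : ∀ t u r → c r (U M t *ᵛ 𝐞 u) ≈ exp (phase t ⟦ θ r ⟧) * q r u
    U𝐞-coordinate t u r = trans
      (c-cong r {U M t *ᵛ 𝐞 u} {λ j → sum (λ s → q s j * (exp (phase t ⟦ θ s ⟧) * q s u))} (U𝐞-expansion t u))
      (trans (sum-assoc (q r) (λ j s → q s j) (λ s → exp (phase t ⟦ θ s ⟧) * q s u))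
      (trans (sum-cong {n} (λ s → *-congʳ (orthonormal r s))) (ℂ′.sum-δˡ r (λ s → exp (phase t ⟦ θ s ⟧) * q s u))))

    energy : ∀ x → ℝ.sum (λ r → ∣ c r x ∣²) ℝ.≈ ℝ.sum (λ j → ∣ x j ∣²)
    energy x = proj₁ (begin
      ⟦ ℝ.sum (λ r → ∣ c r x ∣²) ⟧               ≈⟨ ⟦⟧-sum (λ r → ∣ c r x ∣²) ⟩
      sum (λ r → ⟦ ∣ c r x ∣² ⟧)                 ≈⟨ sum-cong {n} (λ r → sym (trans (*-congʳ (c-conj r x)) (trans (*-comm _ _) (*-conj (c r x))))) ⟩
      sum (λ r → c r (λ j → conj (x j)) * c r x) ≈⟨ parseval (λ j → conj (x j)) x ⟨
      sum (λ j → conj (x j) * x j)               ≈⟨ sum-cong {n} (λ j → trans (*-comm _ _) (*-conj (x j))) ⟩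
      sum (λ j → ⟦ ∣ x j ∣² ⟧)                   ≈⟨ ⟦⟧-sum (λ j → ∣ x j ∣²) ⟨
      ⟦ ℝ.sum (λ j → ∣ x j ∣²) ⟧                 ∎)
      where open ℂ′.Eq

    -- Conditions (2) and (3) read off in the eigenbasis

    sum-ones : ∀ k → ℝ.sum {k} (λ _ → ℝ.1#) ℝ.≈ ℝ.fromℕ k
    sum-ones zero    = ℝ.refl
    sum-ones (suc k) = ℝ.+-congˡ (sum-ones k)

    -- `e t λ′` stands for exp(itλ′), `W t` for U(t) e_u and `√n` for the root of n. Only the listed
    -- properties enter, so the exponential series stays out of this part.
    module Conditions (u : Fin n) (√n : ℝ) (√n-square : √n ℝ.* √n ℝ.≈ ℝ.fromℕ n)
      (e : ℝ → ℂ → ℂ) (e-cong : ∀ t {a b} → a ≈ b → e t a ≈ e t b) (∣e∣² : ∀ t x → ∣ e t ⟦ x ⟧ ∣² ℝ.≈ ℝ.1#)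
      (W : ℝ → Vec n) (W-coordinate : ∀ t r → c r (W t) ≈ e t ⟦ θ r ⟧ * q r u)
      (τ : ℕ → ℝ) (μ : Vec n) (unimodular : ∀ j → ∣ μ j ∣² ℝ.≈ ℝ.1#) where

      N : ℝ
      N = ℝ.fromℕ n

      s : ℂ
      s = ⟦ √n ⟧

      s≉0 : ¬ (s ≈ 0ᶜ)
      s≉0 (√n≈0 , _) = <⇒≉ (fromℕ-pos u) (ℝ.trans (ℝ.sym √n-square) (ℝ.trans (ℝ.*-congʳ √n≈0) (ℝ.zeroˡ √n)))

      Condition₂ Condition₃ Condition₃′ Condition₃″ : Set
      Condition₂ = (λ m → s · W (τ m)) ⟶ᵛ μ
      Condition₃ = ∀ λ′ → Φ M (𝐞 u) λ′ → ∃ λ l → ((λ m → e (τ m) λ′) ⟶ l) ×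
                   ((l * s) · (E M λ′ *ᵛ 𝐞 u) ≈ᵛ E M λ′ *ᵛ μ)
      Condition₃′ = ∀ v λ′ → IsEigenpair M v λ′ → Φ M (𝐞 u) λ′ → ∃ λ l → ((λ m → e (τ m) λ′) ⟶ l) ×
                    (l * s * (v ᵀ· 𝐞 u) ≈ v ᵀ· μ)
      -- (3) and its eigenvector form, read off in an orthonormal eigenbasis.
      Condition₃″ = ∀ λ′ → Φ M (𝐞 u) λ′ → ∃ λ l → ((λ m → e (τ m) λ′) ⟶ l) ×
                    (∀ r → λ′ ≈ ⟦ θ r ⟧ → l * s * q r u ≈ c r μ)

      c-𝐞 : ∀ r → c r (𝐞 u) ≈ q r u
      c-𝐞 r = sum-𝐞 (q r) u

      3⇒3″ : Condition₃ → Condition₃″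
      3⇒3″ cond λ′ λ∈Φ = let l , e→l , eq = cond λ′ λ∈Φ in l , e→l , λ r λ≈θ → begin
          l * s * q r u                        ≈⟨ *-congˡ (sym (trans (E-coordinate λ′ (𝐞 u) r λ≈θ) (c-𝐞 r))) ⟩
          l * s * c r (E M λ′ *ᵛ 𝐞 u)          ≈⟨ c-scale r (l * s) (E M λ′ *ᵛ 𝐞 u) ⟨
          c r ((l * s) · (E M λ′ *ᵛ 𝐞 u))      ≈⟨ c-cong r {(l * s) · (E M λ′ *ᵛ 𝐞 u)} {E M λ′ *ᵛ μ} eq ⟩
          c r (E M λ′ *ᵛ μ)                    ≈⟨ E-coordinate λ′ μ r λ≈θ ⟩
          c r μ                                ∎
        where open ℂ′.Eq

      -- Both sides lie in the eigenspace of λ′, so the coordinates with θ_r ≠ λ′ vanish on either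
      -- side; the remaining ones are those that the hypothesis controls.
      3″⇒3 : Condition₃″ → Condition₃
      3″⇒3 cond λ′ λ∈Φ = let l , e→l , eq = cond λ′ λ∈Φ in l , e→l ,
          ≈ᵛ-from-coordinates {(l * s) · (E M λ′ *ᵛ 𝐞 u)} {E M λ′ *ᵛ μ} (λ r → coordinate l eq r)
        where
        coordinate : ∀ l → (∀ r → λ′ ≈ ⟦ θ r ⟧ → l * s * q r u ≈ c r μ) →
                     ∀ r → c r ((l * s) · (E M λ′ *ᵛ 𝐞 u)) ≈ c r (E M λ′ *ᵛ μ)
        coordinate l eq r = trans (c-scale r (l * s) (E M λ′ *ᵛ 𝐞 u)) ([ inside , outside ]′ (decide (λ′ ≈ ⟦ θ r ⟧)))
          where
          inside : λ′ ≈ ⟦ θ r ⟧ → l * s * c r (E M λ′ *ᵛ 𝐞 u) ≈ c r (E M λ′ *ᵛ μ)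
          inside λ≈θ = trans (*-congˡ (trans (E-coordinate λ′ (𝐞 u) r λ≈θ) (c-𝐞 r)))
            (trans (eq r λ≈θ) (sym (E-coordinate λ′ μ r λ≈θ)))
          outside : ¬ (λ′ ≈ ⟦ θ r ⟧) → l * s * c r (E M λ′ *ᵛ 𝐞 u) ≈ c r (E M λ′ *ᵛ μ)
          outside λ≉θ = trans (*-congˡ (E-coordinate-≉ λ′ (𝐞 u) r λ≉θ))
            (trans (zeroʳ (l * s)) (sym (E-coordinate-≉ λ′ μ r λ≉θ)))

      -- An eigenvector for λ′ has nonzero coordinates only where θ_r = λ′, so the two products
      -- agree term by term.
      3″⇒3′ : Condition₃″ → Condition₃′
      3″⇒3′ cond v λ′ (_ , Mv≈λv) λ∈Φ = let l , e→l , eq = cond λ′ λ∈Φ in l , e→l , (begin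
          l * s * (v ᵀ· 𝐞 u)                          ≈⟨ *-congˡ (parseval v (𝐞 u)) ⟩
          l * s * sum (λ r → c r v * c r (𝐞 u))       ≈⟨ ℂ′.*-distribˡ-sum (l * s) (λ r → c r v * c r (𝐞 u)) ⟩
          sum (λ r → l * s * (c r v * c r (𝐞 u)))     ≈⟨ sum-cong {n} (term l eq) ⟩
          sum (λ r → c r v * c r μ)                   ≈⟨ parseval v μ ⟨
          v ᵀ· μ                                      ∎)
        where
        open ℂ′.Eq
        term : ∀ l → (∀ r → λ′ ≈ ⟦ θ r ⟧ → l * s * q r u ≈ c r μ) →
               ∀ r → l * s * (c r v * c r (𝐞 u)) ≈ c r v * c r μ
        term l eq r = trans (solve 3 (λ a v e → a :* (v :* e) := v :* (a :* e)) refl (l * s) (c r v) (c r (𝐞 u)))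
          ([ (λ λ≈θ → *-congˡ (trans (*-congˡ (c-𝐞 r)) (eq r λ≈θ))) ,
             (λ λ≉θ → trans (vanishes (eigenspace-coordinate {λ′} {v} {r} Mv≈λv λ≉θ) _)
                            (sym (vanishes (eigenspace-coordinate {λ′} {v} {r} Mv≈λv λ≉θ) _))) ]′ (decide (λ′ ≈ ⟦ θ r ⟧)))
          where
          vanishes : c r v ≈ 0ᶜ → ∀ z → c r v * z ≈ 0ᶜ
          vanishes cv≈0 z = trans (*-congʳ cv≈0) (zeroˡ z)

      3′⇒3″ : Condition₃′ → Condition₃″
      3′⇒3″ cond λ′ λ∈Φ =
        let r₀ , λ≈θ₀ , _ = Φ-coordinate {𝐞 u} λ∈Φ
            l , e→l , _ = at r₀ λ≈θ₀
        -- The hypothesis supplies a limit for each eigenvector separately, while one limit per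
        -- eigenvalue is wanted: that of `r₀` is taken, and uniqueness identifies the others with
        -- it.
        in l , e→l , λ r λ≈θ → let k , e→k , eq = at r λ≈θ in
           trans (*-congʳ (*-congʳ (⇝-unique {λ m → e (τ m) λ′} (⟶⇒⇝ e→l) (⟶⇒⇝ e→k)))) (trans (*-congˡ (sym (c-𝐞 r))) eq)
        where
        at : ∀ r → λ′ ≈ ⟦ θ r ⟧ → ∃ λ l → ((λ m → e (τ m) λ′) ⟶ l) × (l * s * c r (𝐞 u) ≈ c r μ)
        at r λ≈θ = cond (q r) λ′ (q≉0 r , eigenspace-cong {v = q r} (sym λ≈θ) (M-q r)) λ∈Φ

      c-sW : ∀ m r → c r (s · W (τ m)) ≈ s * q r u * e (τ m) ⟦ θ r ⟧
      c-sW m r = trans (c-scale r s (W (τ m))) (trans (*-congˡ (W-coordinate (τ m) r))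
        (solve 3 (λ s e q → s :* (e :* q) := s :* q :* e) refl s (e (τ m) ⟦ θ r ⟧) (q r u)))

      -- Some basis vector for λ′ has a nonzero entry at u. In its direction the coordinate of √n
      -- U(τ_m) e_u is a nonzero constant times exp(iτ_m λ′), so dividing by the constant gives
      -- convergence of the exponentials. The equations then follow in the limit for every r with
      -- θ_r = λ′.
      2⇒3″ : Condition₂ → Condition₃″
      2⇒3″ sW→μ λ′ λ∈Φ =
        let r₀ , λ≈θ₀ , c₀≉0 = Φ-coordinate {𝐞 u} λ∈Φ
            a≉0 = λ a≈0 → c₀≉0 (trans (c-𝐞 r₀) (no-zero-divisorsᶜ s≉0 a≈0))
            l , e→l = divided r₀ λ≈θ₀ a≉0
        in l , ⇝⇒⟶ e→l , λ r λ≈θ → trans (solve 3 (λ l s q → l :* s :* q := s :* q :* l) refl l s (q r u))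
             (⇝-unique {λ m → s * q r u * e (τ m) λ′} (⇝-* {λ _ → s * q r u} {λ m → e (τ m) λ′} (⇝-const (s * q r u)) e→l) (coordinate→ r λ≈θ))
        where
        coordinate→ : ∀ r → λ′ ≈ ⟦ θ r ⟧ → (λ m → s * q r u * e (τ m) λ′) ⇝ c r μ
        coordinate→ r λ≈θ = ⇝-cong (λ m → trans (c-sW m r) (*-congˡ (e-cong (τ m) (sym λ≈θ)))) refl
          (⇝-sum {n} {λ j m → q r j * (s · W (τ m)) j} {λ j → q r j * μ j}
            (λ j → ⇝-* {λ _ → q r j} {λ m → (s · W (τ m)) j} (⇝-const (q r j)) (⟶ᵛ⇒⇝ sW→μ j)))
        divided : ∀ r → λ′ ≈ ⟦ θ r ⟧ → ¬ (s * q r u ≈ 0ᶜ) → ∃ λ l → (λ m → e (τ m) λ′) ⇝ l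
        divided r λ≈θ a≉0 = inverseᶜ a * c r μ , ⇝-cong
            (λ m → trans (sym (*-assoc _ _ _)) (trans (*-congʳ (trans (*-comm _ _) (inverseᶜ-inverse a≉0))) (*-identityˡ _))) refl
            (⇝-* {λ _ → inverseᶜ a} {λ m → a * e (τ m) λ′} (⇝-const (inverseᶜ a)) (coordinate→ r λ≈θ))
          where
          a : ℂ
          a = s * q r u

      ∣sq∣² : ∀ r → ∣ s * q r u ∣² ℝ.≈ N ℝ.* ∣ q r u ∣²
      ∣sq∣² r = ℝ.trans (∣∣²-* s (q r u)) (ℝ.*-congʳ (ℝ.trans (∣⟦⟧∣² √n) √n-square))

      total-energy : ∀ {x : Fin n → ℂ} → (∀ r → ∣ x r ∣² ℝ.≈ N ℝ.* ∣ q r u ∣²) → ℝ.sum (λ r → ∣ x r ∣²) ℝ.≈ N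
      total-energy {x} ∣x∣² = begin
          ℝ.sum (λ r → ∣ x r ∣²)               ≈⟨ ℝ′.sum-cong {n} ∣x∣² ⟩
          ℝ.sum (λ r → N ℝ.* ∣ q r u ∣²)       ≈⟨ ℝ′.*-distribˡ-sum N (λ r → ∣ q r u ∣²) ⟨
          N ℝ.* ℝ.sum (λ r → ∣ q r u ∣²)       ≈⟨ ℝ.*-congˡ (ℝ′.sum-cong {n} (λ r → ∣⟦⟧∣² (Q u r))) ⟩
          N ℝ.* ℝ.sum (λ r → Q u r ℝ.* Q u r)  ≈⟨ ℝ.*-congˡ (ℝ.trans (rows u u) (ℝ′.δ-refl u)) ⟩
          N ℝ.* ℝ.1#                           ≈⟨ ℝ.*-identityʳ N ⟩
          N                                    ∎
        where open ℝ′.Eq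

      -- Each coordinate of √n U(τ_m) e_u either tends to that of μ or vanishes
      -- identically, and the squared moduli of both families of limits add up to n.
      3″⇒2 : Condition₃″ → Condition₂
      3″⇒2 cond = ⇝⇒⟶ᵛ (λ j → ⇝-cong (λ m → sym (trans (expansion (s · W (τ m)) j) (sum-cong {n} (λ r → *-congˡ (c-sW m r)))))
          (trans (sum-cong {n} (λ r → *-congˡ (b≈cμ r))) (sym (expansion μ j)))
          (⇝-sum {n} {λ r m → q r j * (s * q r u * e (τ m) ⟦ θ r ⟧)} {λ r → q r j * b r}
            (λ r → ⇝-* {λ _ → q r j} {λ m → s * q r u * e (τ m) ⟦ θ r ⟧} (⇝-const (q r j)) (→b r))))
        where
        limit : ∀ r → ∃ λ b → (λ m → s * q r u * e (τ m) ⟦ θ r ⟧) ⇝ b × (b ≈ c r μ ⊎ b ≈ 0ᶜ)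
        limit r = [ vanishing , converging ]′ (decide (q r u ≈ 0ᶜ))
          where
          vanishing : q r u ≈ 0ᶜ → ∃ λ b → (λ m → s * q r u * e (τ m) ⟦ θ r ⟧) ⇝ b × (b ≈ c r μ ⊎ b ≈ 0ᶜ)
          vanishing q≈0 = 0ᶜ ,
            ⇝-cong (λ m → sym (trans (*-congʳ (trans (*-congˡ q≈0) (zeroʳ s))) (zeroˡ _))) refl (⇝-const 0ᶜ) , inj₂ refl
          converging : ¬ (q r u ≈ 0ᶜ) → ∃ λ b → (λ m → s * q r u * e (τ m) ⟦ θ r ⟧) ⇝ b × (b ≈ c r μ ⊎ b ≈ 0ᶜ)
          converging q≉0 =
            let l , e→l , eq = cond ⟦ θ r ⟧ (θ∈Φ (λ c≈0 → q≉0 (trans (sym (c-𝐞 r)) c≈0)))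
            in s * q r u * l , ⇝-* {λ _ → s * q r u} {λ m → e (τ m) ⟦ θ r ⟧} (⇝-const (s * q r u)) (⟶⇒⇝ e→l) ,
               inj₁ (trans (solve 3 (λ l s q → s :* q :* l := l :* s :* q) refl l s (q r u)) (eq r refl))
        b : Fin n → ℂ
        b r = proj₁ (limit r)
        →b : ∀ r → (λ m → s * q r u * e (τ m) ⟦ θ r ⟧) ⇝ b r
        →b r = proj₁ (proj₂ (limit r))
        ∣b∣² : ∀ r → ∣ b r ∣² ℝ.≈ N ℝ.* ∣ q r u ∣²
        ∣b∣² r = lim-unique (⇝-∣∣² {λ m → s * q r u * e (τ m) ⟦ θ r ⟧} (→b r))
          (lim-cong (λ m → ℝ.sym (ℝ.trans (∣∣²-* (s * q r u) (e (τ m) ⟦ θ r ⟧)) (ℝ.trans (ℝ.*-congˡ (∣e∣² (τ m) (θ r))) (ℝ.*-identityʳ _))))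
            (∣sq∣² r) (lim-const ∣ s * q r u ∣²))
        ∣b∣²≤∣cμ∣² : ∀ r → ∣ b r ∣² ≤ ∣ c r μ ∣²
        ∣b∣²≤∣cμ∣² r = [ (λ b≈cμ → ≤-reflexive (∣∣²-cong b≈cμ)) ,
          (λ b≈0 → ≤-trans (≤-reflexive (ℝ.trans (∣∣²-cong b≈0) (ℝ.trans (∣⟦⟧∣² ℝ.0#) (ℝ.zeroˡ ℝ.0#))))
            (∣∣²-nonneg (c r μ))) ]′ (proj₂ (proj₂ (limit r)))
        -- The differences are nonnegative by the preceding bound, so a vanishing sum forces each of
        -- them to vanish.
        equal-energy : ℝ.sum (λ r → ∣ c r μ ∣² ℝ.- ∣ b r ∣²) ℝ.≈ ℝ.0#
        equal-energy = ℝ.trans (ℝ′.sum-- (λ r → ∣ c r μ ∣²) (λ r → ∣ b r ∣²)) (ℝ.trans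
          (ℝ.+-cong (ℝ.trans (energy μ) (ℝ.trans (ℝ′.sum-cong {n} unimodular) (sum-ones n))) (ℝ.-‿cong (total-energy ∣b∣²)))
          (ℝ.-‿inverseʳ N))
        ∣cμ∣²≈∣b∣² : ∀ r → ∣ c r μ ∣² ℝ.≈ ∣ b r ∣²
        ∣cμ∣²≈∣b∣² r = ℝ.trans (ℝ′.solve 2 (λ x y → x ℝ′.:= (x ℝ′.:- y) ℝ′.:+ y) ℝ.refl ∣ c r μ ∣² ∣ b r ∣²)
          (ℝ.trans (ℝ.+-congʳ (sum-nonneg≈0 {n} (λ r → 0≤x-y (∣b∣²≤∣cμ∣² r)) equal-energy r)) (ℝ.+-identityˡ _))
        b≈cμ : ∀ r → b r ≈ c r μ
        b≈cμ r = [ (λ b≈cμ → b≈cμ) ,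
          (λ b≈0 → trans b≈0 (sym (∣∣²≈0 (ℝ.trans (∣cμ∣²≈∣b∣² r)
            (ℝ.trans (∣∣²-cong b≈0) (ℝ.trans (∣⟦⟧∣² ℝ.0#) (ℝ.zeroˡ ℝ.0#))))))) ]′ (proj₂ (proj₂ (limit r)))

-- Local uniform mixing and convergent sequences of times

module UniformMixing (em : ExcludedMiddle 0ℓ) (𝓡 : CompleteOrderedField) where

  open Mixing em 𝓡
  open RealLine em 𝓡
  open RealLimits em 𝓡
  open ComplexNumbers em 𝓡
  open ℂR using (refl; sym; trans; +-cong; *-congˡ; *-identityʳ)

  1/suc≤1 : ∀ m → 1/suc m ≤ ℝ.1#
  1/suc≤1 m = *-cancelˡ-≤ (fromℕ-suc-pos m) (≤-trans (≤-reflexive (ℝ.⁻¹-inverse (<⇒≉ (fromℕ-suc-pos m))))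
    (≤-trans (x≤x+y (fromℕ-nonneg m)) (≤-reflexive (ℝ.sym (ℝ.*-identityʳ _)))))

  module Sequential {n : ℕ} (u : Fin n) (√n : ℝ) (√n-square : √n ℝ.* √n ℝ.≈ ℝ.fromℕ n)
                    (W W̄ : ℝ → Vec n) (W̄≈conj : ∀ t j → W̄ t j ≈ conj (W t j)) where

    N 1/n : ℝ
    N = ℝ.fromℕ n
    1/n = N ℝ.⁻¹

    ∣√n*∣² : ∀ z → ∣ ⟦ √n ⟧ * z ∣² ℝ.≈ N ℝ.* ∣ z ∣²
    ∣√n*∣² z = ℝ.trans (∣∣²-* ⟦ √n ⟧ z) (ℝ.*-congʳ (ℝ.trans (∣⟦⟧∣² √n) √n-square))

    N*1/n : N ℝ.* 1/n ℝ.≈ ℝ.1#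
    N*1/n = ℝ.⁻¹-inverse (<⇒≉ (fromℕ-pos u))

    deviation : ℝ → Vec n
    deviation t = W t ⊙ W̄ t -ᵛ ⟦ 1/n ⟧ · 𝟏

    deviation-entry : ∀ t j → deviation t j ≈ ⟦ ∣ W t j ∣² ℝ.- 1/n ⟧
    deviation-entry t j = trans
      (+-cong (trans (*-congˡ (W̄≈conj t j)) (*-conj (W t j))) (ℂR.-‿cong (*-identityʳ ⟦ 1/n ⟧)))
      (ℝ.refl , ℝ.-‿inverseʳ ℝ.0#)

    LocalMixing SequentialMixing : Set
    LocalMixing = ∀ ε → ℝ.0# < ε → ∃ λ τ → ‖ deviation τ ‖ < ε
    SequentialMixing = ∃₂ λ (τ : ℕ → ℝ) (μ : Vec n) → Unimodular μ × (λ m → ⟦ √n ⟧ · W (τ m)) ⟶ᵛ μ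

    sequential⇒local : SequentialMixing → LocalMixing
    sequential⇒local (τ , μ , unimodular , y→μ) ε 0<ε =
      let K , small = ‖‖-small {n} {λ m → deviation (τ m)} deviation→0 ε 0<ε in τ K , small K ℕ.≤-refl
      where
      square→ : ∀ j → Lim (λ m → ∣ W (τ m) j ∣²) 1/n
      square→ j = lim-cong
        (λ m → ℝ.trans (ℝ.*-congˡ (∣√n*∣² (W (τ m) j))) (ℝ.trans (ℝ.sym (ℝ.*-assoc _ _ _))
          (ℝ.trans (ℝ.*-congʳ (ℝ.trans (ℝ.*-comm 1/n N) N*1/n)) (ℝ.*-identityˡ _))))
        (ℝ.trans (ℝ.*-congˡ (∣∣≈1⇒∣∣²≈1 (unimodular j))) (ℝ.*-identityʳ 1/n))
        (lim-scale 1/n (⇝-∣∣² {λ m → ⟦ √n ⟧ * W (τ m) j} (⟶ᵛ⇒⇝ y→μ j)))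
      deviation→0 : ∀ j → (λ m → deviation (τ m) j) ⇝ 0ᶜ
      deviation→0 j = ⇝-cong (λ m → sym (deviation-entry (τ m) j)) refl
        (lim-cong (λ m → ℝ.refl) (ℝ.-‿inverseʳ 1/n) (lim-- (square→ j) (lim-const 1/n)) , lim-const ℝ.0#)

    -- Indexing the two parts by `Fin 2` lets one application of `bolzano-weierstrass₂` find a
    -- common subsequence for all real and imaginary parts.
    component : Fin 2 → ℂ → ℝ
    component zero    = re
    component (suc _) = im

    component-square : ∀ h z → component h z ℝ.* component h z ≤ ∣ z ∣²
    component-square zero    z = x≤x+y (square-nonneg (im z))
    component-square (suc _) z = x≤y+x (square-nonneg (re z))

    module _ (τ : ℕ → ℝ) (close : ∀ m j → abs (∣ W (τ m) j ∣² ℝ.- 1/n) ≤ 1/suc m) where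

      0≤1/n : ℝ.0# ≤ 1/n
      0≤1/n = <⇒≤ (⁻¹-pos (fromℕ-pos u))

      -- Boundedness is read off from the mixing itself: closeness gives |W_j|² ≤ 1 + 1/n. The
      -- square on the right is what `square-cancel-≤` expects.
      square-bounded : ∀ m j → ∣ W (τ m) j ∣² ≤ (ℝ.1# ℝ.+ 1/n) ℝ.* (ℝ.1# ℝ.+ 1/n)
      square-bounded m j = begin
        ∣ W (τ m) j ∣²
          ≈⟨ ℝ′.solve 2 (λ a b → a ℝ′.:= (a ℝ′.:- b) ℝ′.:+ b) ℝ.refl ∣ W (τ m) j ∣² 1/n ⟩
        (∣ W (τ m) j ∣² ℝ.- 1/n) ℝ.+ 1/n
          ≤⟨ ℝ.+-mono-≤ 1/n (≤-trans (x≤abs _) (≤-trans (close m j) (1/suc≤1 m))) ⟩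
        ℝ.1# ℝ.+ 1/n
          ≤⟨ x≤x+y (+-nonneg 0≤1/n (square-nonneg 1/n)) ⟩
        ℝ.1# ℝ.+ 1/n ℝ.+ (1/n ℝ.+ 1/n ℝ.* 1/n)
          ≈⟨ ℝ′.solve 1 (λ a → ℝ′.:1 ℝ′.:+ a ℝ′.:+ (a ℝ′.:+ a ℝ′.:* a) ℝ′.:= (ℝ′.:1 ℝ′.:+ a) ℝ′.:* (ℝ′.:1 ℝ′.:+ a))
               ℝ.refl 1/n ⟩
        (ℝ.1# ℝ.+ 1/n) ℝ.* (ℝ.1# ℝ.+ 1/n) ∎
        where open ≤R

      bounded : ∀ h j m → abs (component h (W (τ m) j)) ≤ ℝ.1# ℝ.+ 1/n
      bounded h j m = square-cancel-≤ (+-nonneg 0≤1 0≤1/n) (≤-trans (≤-reflexive (abs-square (component h (W (τ m) j))))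
        (≤-trans (component-square h (W (τ m) j)) (square-bounded m j)))

      subsequence-limit : (φ : ℕ → ℕ) → (∀ m → m ℕ.≤ φ m) → (l : Fin 2 → Fin n → ℝ) →
        (∀ h j → Lim (λ m → component h (W (τ (φ m)) j)) (l h j)) → SequentialMixing
      subsequence-limit φ m≤φm l W→l =
          (λ m → τ (φ m)) , μ , unimodular , ⇝⇒⟶ᵛ (λ j → ⇝-* {λ _ → ⟦ √n ⟧} {λ m → W (τ (φ m)) j} (⇝-const ⟦ √n ⟧) (W→ω j))
        where
        ω μ : Vec n
        ω j = l zero j +i l (suc zero) j
        μ = ⟦ √n ⟧ · ω
        W→ω : ∀ j → (λ m → W (τ (φ m)) j) ⇝ ω j
        W→ω j = W→l zero j , W→l (suc zero) j
        -- Along the subsequence the squared moduli tend both to |ω_j|² and, by the choice of the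
        -- times, to 1/n; scaling by √n then makes the limit unimodular.
        ∣ω∣² : ∀ j → ∣ ω j ∣² ℝ.≈ 1/n
        ∣ω∣² j = lim-unique (⇝-∣∣² {λ m → W (τ (φ m)) j} (W→ω j))
          (lim-subsequence {λ m → ∣ W (τ m) j ∣²} m≤φm (lim-from-rate (λ m → close m j)))
        unimodular : Unimodular μ
        unimodular j = ∣∣²≈1⇒∣∣≈1 {μ j} (ℝ.trans (∣√n*∣² (ω j)) (ℝ.trans (ℝ.*-congˡ (∣ω∣² j)) N*1/n))

    local⇒sequential : LocalMixing → SequentialMixing
    local⇒sequential mixing =
      let φ , m≤φm , l , W→l = bolzano-weierstrass₂ {2} {n} {λ h j m → component h (W (τ m) j)} (bounded τ close)
      in subsequence-limit τ close φ m≤φm l W→l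
      where
      τ : ℕ → ℝ
      τ m = proj₁ (mixing (1/suc m) (1/suc-pos m))
      close : ∀ m j → abs (∣ W (τ m) j ∣² ℝ.- 1/n) ≤ 1/suc m
      close m j = ≤-trans (abs-cong-≤ (ℝ.sym (proj₁ (deviation-entry (τ m) j))))
        (≤-trans (re≤‖‖ (deviation (τ m)) j) (<⇒≤ (proj₂ (mixing (1/suc m) (1/suc-pos m)))))

-- The graph matrices are real and symmetric

module GraphMatrices (em : ExcludedMiddle 0ℓ) (𝓡 : CompleteOrderedField) where

  open Mixing em 𝓡
  open ComplexNumbers em 𝓡
  open SpectralDecomposition em 𝓡

  -- The common property of A, L and Q on which the spectral theorem rests. The real matrix is kept
  -- as data, since the entries of M are complex and real only up to `≈`.
  RealSymmetric : ∀ {n} → Mat n → Set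
  RealSymmetric {n} M = ∃ λ (R : Fin n → Fin n → ℝ) → (∀ j k → M j k ≈ ⟦ R j k ⟧) × (∀ j k → R j k ℝ.≈ R k j)

  module _ {n : ℕ} (X : WeightedGraph n) where
    open WeightedGraph X

    diagonal : Fin n → Fin n → ℝ
    diagonal j k = degree X j ℝ.* ℝ′.δ j k

    diagonal-sym : ∀ j k → diagonal j k ℝ.≈ diagonal k j
    diagonal-sym j k with j ≟ k
    ... | yes ≡.refl = ℝ.refl
    ... | no  j≢k    = ℝ.trans (off-diagonal j≢k) (ℝ.sym (off-diagonal (j≢k ∘ ≡.sym)))
      where
      off-diagonal : ∀ {j k} → j ≡.≢ k → diagonal j k ℝ.≈ ℝ.0#
      off-diagonal j≢k = ℝ.trans (ℝ.*-congˡ (ℝ′.δ-≢ j≢k)) (ℝ.zeroʳ _)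

    𝐃≈ : ∀ j k → 𝐃 X j k ≈ ⟦ diagonal j k ⟧
    𝐃≈ j k = ℂR.trans (ℂR.*-congˡ (ℂR.trans (𝐞≈δ j k) (δ≈⟦δ⟧ j k))) (ℂR.sym (⟦⟧-* _ _))

    realSymmetric : ∀ {M} → M ∈ 𝐀 X ∷ 𝐋 X ∷ 𝐐 X ∷ [] → RealSymmetric M
    realSymmetric (here ≡.refl) = weight , (λ j k → ℂR.refl) , weight-symmetric
    realSymmetric (there (here ≡.refl)) = (λ j k → diagonal j k ℝ.- weight j k) ,
      (λ j k → ℂR.trans (ℂR.+-congʳ (𝐃≈ j k)) (ℝ.refl , ℝ.-‿inverseʳ ℝ.0#)) ,
      λ j k → ℝ.+-cong (diagonal-sym j k) (ℝ.-‿cong (weight-symmetric j k))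
    realSymmetric (there (there (here ≡.refl))) = (λ j k → diagonal j k ℝ.+ weight j k) ,
      (λ j k → ℂR.trans (ℂR.+-congʳ (𝐃≈ j k)) (ℝ.refl , ℝ.+-identityˡ ℝ.0#)) ,
      λ j k → ℝ.+-cong (diagonal-sym j k) (weight-symmetric j k)

-- Assembly of the equivalences

module MixingEquivalences (em : ExcludedMiddle 0ℓ) (𝓡 : CompleteOrderedField) where
  open Mixing em 𝓡
  open RealLine em 𝓡
  open RealLimits em 𝓡 using (fromℕ-nonneg)
  open ComplexNumbers em 𝓡
  open ComplexExponential em 𝓡 using (exp-cong; ∣exp∣²≈1)
  open SpectralTheorem em 𝓡 using (spectral-theorem)
  open SpectralDecomposition em 𝓡
  open UniformMixing em 𝓡
  open GraphMatrices em 𝓡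

  phase-imaginary : ∀ t x → re (i * ⟦ t ⟧ * ⟦ x ⟧) ℝ.≈ ℝ.0#
  phase-imaginary = ℝ′.solve 2 (λ t x → (:0 :* t :- :1 :* :0) :* x :- (:0 :* :0 :+ :1 :* t) :* :0 := :0) ℝ.refl
    where open ℝ′

  module _ {n : ℕ} (M : Mat n) (real-symmetric : RealSymmetric M) (u : Fin n) where

    √n : ℝ
    √n = √ (ℝ.fromℕ n)

    √n-square : √n ℝ.* √n ℝ.≈ ℝ.fromℕ n
    √n-square = proj₂ (√-spec (fromℕ-nonneg n))

    R : Fin n → Fin n → ℝ
    R = proj₁ real-symmetric

    M≈R : ∀ j k → M j k ≈ ⟦ R j k ⟧
    M≈R = proj₁ (proj₂ real-symmetric)

    R-sym : ∀ j k → R j k ℝ.≈ R k j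
    R-sym = proj₂ (proj₂ real-symmetric)

    Condition₂ Condition₃ Condition₃′ : (ℕ → ℝ) → Vec n → Set
    Condition₂ τ μ = (λ m → ⟦ √n ⟧ · (U M (τ m) *ᵛ 𝐞 u)) ⟶ᵛ μ
    Condition₃ τ μ =
      ∀ λ′ → Φ M (𝐞 u) λ′ →
      ∃ λ l → ((λ m → exp (i * ⟦ τ m ⟧ * λ′)) ⟶ l) ×
              ((l * ⟦ √n ⟧) · (E M λ′ *ᵛ 𝐞 u) ≈ᵛ E M λ′ *ᵛ μ)
    Condition₃′ τ μ =
      ∀ v λ′ → IsEigenpair M v λ′ → Φ M (𝐞 u) λ′ →
      ∃ λ l → ((λ m → exp (i * ⟦ τ m ⟧ * λ′)) ⟶ l) ×
              (l * ⟦ √n ⟧ * (v ᵀ· 𝐞 u) ≈ v ᵀ· μ)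

    W W̄ : ℝ → Vec n
    W t = U M t *ᵛ 𝐞 u
    W̄ t = conjᴹ (U M t) *ᵛ 𝐞 u

    W̄≈conj : ∀ t j → W̄ t j ≈ conj (W t j)
    W̄≈conj t j = ℂR.trans (sum-𝐞 (conjᴹ (U M t) j) u) (conj-cong (ℂR.sym (sum-𝐞 (U M t j) u)))

    open Sequential u √n √n-square W W̄ W̄≈conj using (local⇒sequential; sequential⇒local)

    1⇔2 : LocalεUniformMixing M u ⇔ (∃₂ λ τ μ → Unimodular μ × Condition₂ τ μ)
    1⇔2 = mk⇔ local⇒sequential sequential⇒local

    cis : ℝ → ℂ → ℂ
    cis t z = exp (i * ⟦ t ⟧ * z)

    cis-cong : ∀ t {z w} → z ≈ w → cis t z ≈ cis t w
    cis-cong t z≈w = exp-cong (ℂR.*-congˡ {i * ⟦ t ⟧} z≈w)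

    ∣cis∣² : ∀ t x → ∣ cis t ⟦ x ⟧ ∣² ℝ.≈ ℝ.1#
    ∣cis∣² t x = ∣exp∣²≈1 (i * ⟦ t ⟧ * ⟦ x ⟧) (phase-imaginary t x)

    module _ (Q : Fin n → Fin n → ℝ) (θ : Fin n → ℝ)
      (columns : ∀ r s → ℝ.sum (λ j → Q j r ℝ.* Q j s) ℝ.≈ ℝ′.δ r s)
      (rows : ∀ j k → ℝ.sum (λ r → Q j r ℝ.* Q k r) ℝ.≈ ℝ′.δ j k)
      (eigencolumns : ∀ j r → ℝ.sum (λ k → R j k ℝ.* Q k r) ℝ.≈ θ r ℝ.* Q j r)
      (τ : ℕ → ℝ) (μ : Vec n) (unimodular : Unimodular μ) where

      open Coordinates M R M≈R R-sym Q θ columns rows eigencolumns using (c; q; U𝐞-coordinate)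

      W-coordinate : ∀ t r → c r (W t) ≈ cis t ⟦ θ r ⟧ * q r u
      W-coordinate t r = U𝐞-coordinate t u r

      ∣μ∣² : ∀ j → ∣ μ j ∣² ℝ.≈ ℝ.1#
      ∣μ∣² j = ∣∣≈1⇒∣∣²≈1 {μ j} (unimodular j)

      open Coordinates.Conditions M R M≈R R-sym Q θ columns rows eigencolumns u √n √n-square
        cis cis-cong ∣cis∣² W W-coordinate τ μ ∣μ∣²
        using (3⇒3″; 3″⇒3; 3″⇒3′; 3′⇒3″; 2⇒3″; 3″⇒2)

      2⇔3-diagonalised : (Condition₂ τ μ ⇔ Condition₃ τ μ) × (Condition₃ τ μ ⇔ Condition₃′ τ μ)
      2⇔3-diagonalised = mk⇔ (λ c → 3″⇒3 (2⇒3″ c)) (λ c → 3″⇒2 (3⇒3″ c)) ,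
                         mk⇔ (λ c → 3″⇒3′ (3⇒3″ c)) (λ c → 3″⇒3 (3′⇒3″ c))

    -- The conditions do not mention a basis, so the equivalences proved for an arbitrary
    -- orthonormal eigenbasis hold as soon as one exists.
    2⇔3 : ∀ τ μ → Unimodular μ → (Condition₂ τ μ ⇔ Condition₃ τ μ) × (Condition₃ τ μ ⇔ Condition₃′ τ μ)
    2⇔3 = let Q , θ , (columns , rows) , eigencolumns = spectral-theorem R R-sym
          in 2⇔3-diagonalised Q θ columns rows eigencolumns

    equivalences :
      (LocalεUniformMixing M u ⇔ (∃₂ λ τ μ → Unimodular μ × Condition₂ τ μ)) ×
      ((∃₂ λ τ μ → Unimodular μ × Condition₂ τ μ) ⇔ (∃₂ λ τ μ → Unimodular μ × Condition₃ τ μ)) ×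
      (∀ τ μ → Unimodular μ → Condition₃ τ μ ⇔ Condition₃′ τ μ)
    equivalences = 1⇔2 ,
      mk⇔ (λ (τ , μ , uni , cond) → τ , μ , uni , Equivalence.to (proj₁ (2⇔3 τ μ uni)) cond)
          (λ (τ , μ , uni , cond) → τ , μ , uni , Equivalence.from (proj₁ (2⇔3 τ μ uni)) cond) ,
      λ τ μ uni → proj₂ (2⇔3 τ μ uni)

proposition1 :
    (em : ExcludedMiddle 0ℓ) (𝓡 : CompleteOrderedField) →
    let open Mixing em 𝓡 in
    {n : ℕ} (X : WeightedGraph n) (M : Mat n) → M ∈ 𝐀 X ∷ 𝐋 X ∷ 𝐐 X ∷ [] →
    (u : Fin n) →
    let √n : ℂ
        √n = ⟦ √ (ℝ.fromℕ n) ⟧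

        Condition₂ : (ℕ → ℝ) → Vec n → Set
        Condition₂ τ μ = (λ m → √n · (U M (τ m) *ᵛ 𝐞 u)) ⟶ᵛ μ

        Condition₃ : (ℕ → ℝ) → Vec n → Set
        Condition₃ τ μ =
          ∀ λ′ → Φ M (𝐞 u) λ′ →
          ∃ λ l → ((λ m → exp (i * ⟦ τ m ⟧ * λ′)) ⟶ l) ×
                  ((l * √n) · (E M λ′ *ᵛ 𝐞 u) ≈ᵛ E M λ′ *ᵛ μ)

        Condition₃′ : (ℕ → ℝ) → Vec n → Set
        Condition₃′ τ μ =
          ∀ v λ′ → IsEigenpair M v λ′ → Φ M (𝐞 u) λ′ →
          ∃ λ l → ((λ m → exp (i * ⟦ τ m ⟧ * λ′)) ⟶ l) ×
                  (l * √n * (v ᵀ· 𝐞 u) ≈ v ᵀ· μ)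
    in
    (LocalεUniformMixing M u ⇔ (∃₂ λ τ μ → Unimodular μ × Condition₂ τ μ)) ×
    ((∃₂ λ τ μ → Unimodular μ × Condition₂ τ μ) ⇔
     (∃₂ λ τ μ → Unimodular μ × Condition₃ τ μ)) ×
    (∀ τ μ → Unimodular μ → Condition₃ τ μ ⇔ Condition₃′ τ μ)
proposition1 em 𝓡 X M M∈ u = equivalences M (realSymmetric X M∈) u
  where
  open MixingEquivalences em 𝓡
  open GraphMatrices em 𝓡
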